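{- Fix an integer $k \geq 2$. There exists $N = N(k)$ such that for every $n \geq N$ the following holds: if $\mathcal{F} \subseteq \mathcal{M}_{kn}^k$ is a partially 2-intersecting family of maximum possible size (i.e., no partially 2-intersecting subfamily of $\mathcal{M}_{kn}^k$ is larger), then $\mathcal{F}$ is canonically partially 2-intersecting, i.e., $\mathcal{F} = \mathcal{F}_{ij}$ for some 2-element subset $\{i,j\} \subseteq [kn]$.
   Context: $K_{kn}^k$ denotes the complete $k$-uniform hypergraph on vertex set $[kn]=\{1,\dots,kn\}$, and $\mathcal{M}_{kn}^k$ is the set of its perfect hypermatchings, i.e., partitions of $[kn]$ into $n$ blocks ($k$-edges) of size $k$. Two perfect hypermatchings $m,m'$ partially 2-intersect if there exist $k$-edges $e \in m$, $e' \in m'$ with $|e \cap e'| \geq 2$. A family $\mathcal{F} \subseteq \mathcal{M}_{kn}^k$ is partially 2-intersecting if every two of its members partially 2-intersect. For a 2-set $\{i,j\} \subseteq [kn]$, $\mathcal{F}_{ij} = \{ m \in \mathcal{M}_{kn}^k : \{i,j\} \subseteq e \text{ for some } e \in m\}$; these are the canonically partially 2-intersecting families. -}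

module Defs where

open import Data.Nat using (ℕ; _*_; _≤_)
open import Data.Bool using (Bool; true; false)
open import Data.Fin using (Fin)
open import Data.Vec using (Vec; lookup; toList)
open import Data.List using (List; length; filter)
open import Data.List.Membership.Propositional using (_∈_)
open import Data.List.Relation.Unary.All using (All)
open import Data.List.Relation.Unary.Unique.Propositional using (Unique)
open import Data.Product using (Σ; _×_; ∃; ∃-syntax)
open import Data.Bool.Properties using (T?)
open import Relation.Binary.PropositionalEquality using (_≡_; _≢_)
open import Function.Bundles using (_⇔_)

-- A candidate hypermatching on vertex set Fin V is encoded by its
-- "same block" relation as a Boolean V×V matrix: entry (i , j) is true
-- iff i and j lie in the same edge. Matrices (Vec of Vec) make equality of
-- matchings propositional equality, so distinct matchings = distinct matrices.
Rel : ℕ → Set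
Rel V = Vec (Vec Bool V) V

_∼[_]_ : {V : ℕ} → Fin V → Rel V → Fin V → Set
i ∼[ m ] j = lookup (lookup m i) j ≡ true

blockSize : {V : ℕ} → Rel V → Fin V → ℕ
blockSize m i = length (filter T? (toList (lookup m i)))

record IsPerfectMatching (k V : ℕ) (m : Rel V) : Set where
  field
    refl∼  : ∀ i → i ∼[ m ] i
    sym∼   : ∀ i j → i ∼[ m ] j → j ∼[ m ] i
    trans∼ : ∀ i j l → i ∼[ m ] j → j ∼[ m ] l → i ∼[ m ] l
    size∼  : ∀ i → blockSize m i ≡ k

Partially2Intersect : {V : ℕ} → Rel V → Rel V → Set
Partially2Intersect {V} m m' =
  Σ (Fin V) λ i → Σ (Fin V) λ j → i ≢ j × i ∼[ m ] j × i ∼[ m' ] j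

-- A family of perfect hypermatchings of K^k_{kn}: a duplicate-free list of
-- perfect matchings (its size is the length of the list).
record Family (k n : ℕ) (F : List (Rel (k * n))) : Set where
  field
    unique   : Unique F
    matchings : All (IsPerfectMatching k (k * n)) F

IsPartially2Intersecting : {V : ℕ} → List (Rel V) → Set
IsPartially2Intersecting F = ∀ {m m'} → m ∈ F → m' ∈ F → Partially2Intersect m m'

IsMaximumP2I : (k n : ℕ) → List (Rel (k * n)) → Set
IsMaximumP2I k n F =
  Family k n F × IsPartially2Intersecting F ×
  (∀ G → Family k n G → IsPartially2Intersecting G → length G ≤ length F)

IsCanonical : (k n : ℕ) → List (Rel (k * n)) → Set
IsCanonical k n F =
  Σ (Fin (k * n)) λ i → Σ (Fin (k * n)) λ j → i ≢ j ×
    (∀ m → (m ∈ F) ⇔ (IsPerfectMatching k (k * n) m × i ∼[ m ] j))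

{-# OPTIONS --safe #-}
module Submission where

-- A matching is viewed as the set of pairs of vertices that it joins, so that a
-- partially 2-intersecting family is an intersecting family of sets.
--
-- Let 𝓐 be the set of all perfect matchings and R a suitable polynomial in log n.
-- Call S a core of a family if it maximises deg(S) R^∣S∣, where deg(S) counts the
-- members containing S; the members containing a core are then R-spread around it.
-- By the minimal-fragment argument of Park and Pham, a random colouring of the
-- pairs almost surely has a member of one spread family inside the first half of
-- the colours and a member of the other inside the second half.  Hence families
-- with disjoint cores contain disjoint members, and in an intersecting family all
-- cores of large subfamilies meet.  Since 𝓐 itself is far more spread than R,
-- every subfamily of density at least n^-s has a core of size O(log n).
--
-- Let S₁ be a core of a maximum family F.  If every pair x ∈ S₁ is missed by a
-- large part of F, then this part has a core avoiding x, so nearly all of F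
-- contains one of O(log² n) couples of distinct pairs and has density
-- O(log² n / n²), less than that of a star.  So some pair p lies in all but a
-- fraction n^-s of F.  If m ∈ F misses p, then F misses all matchings through p
-- that are disjoint from m; boundedly many transpositions turn a typical matching
-- through p into such a one, so these have density more than n^-s, and F is
-- smaller than the star of p.  Thus F lies in this star, and equals it.

open import Defs
open import Data.Bool using (Bool; true; false; if_then_else_)
import Data.Bool.Properties as Boolₚ
open import Data.Bool.Properties using (T?)
open import Data.Empty using (⊥-elim)
open import Data.Fin using (Fin; toℕ; fromℕ<; remQuot; combine)
import Data.Fin.Properties as Finₚ
open import Data.Fin.Subset using (Subset; _⊆_; _∪_; _∩_; _─_; ∣_∣; ⁅_⁆) renaming (_∈_ to _∈ˢ_; _∉_ to _∉ˢ_; ⊥ to ∅)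
open import Data.Fin.Subset.Properties using (_⊆?_; x∈p∪q⁺; x∈p∪q⁻; x∈p∩q⁺; x∈p∩q⁻; p─q⊆p; x∈p∧x∉q⇒x∈p─q; p⊆q⇒∣p∣≤∣q∣; p⊂q⇒∣p∣<∣q∣; ⊆-antisym; ∣⊥∣≡0; ⊥⊆; ∣p∣≤n; x∈⁅y⁆⇒x≡y; ∣⁅x⁆∣≡1; nonempty?) renaming (_∈?_ to _∈ˢ?_)
open import Data.List using (List; []; _∷_; _++_; map; filter; length; take; allFin; cartesianProduct; cartesianProductWith)
open import Data.List.Extrema.Nat using (argmin; argmax; argmin-sel; f[argmin]≤f[xs]; f[xs]≤f[argmax])
import Data.List.Membership.DecPropositional as DecMembership
open import Data.List.Membership.Propositional using (_∈_) renaming (_─_ to _∖_)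
open import Data.List.Membership.Propositional.Properties using (∈-filter⁻; ∈-filter⁺; ∈-map⁺; ∈-map⁻; ∈-allFin; ∈-cartesianProduct⁺; ∈-cartesianProductWith⁺; ∈-++⁺ˡ; ∈-++⁺ʳ)
open import Data.List.Properties using (length-map; length-++; length-tabulate; length-take; map-tabulate)
open import Data.List.Relation.Unary.All using (All; []; _∷_)
import Data.List.Relation.Unary.All as All
import Data.List.Relation.Unary.All.Properties as Allₚ
open import Data.List.Relation.Unary.AllPairs using ([]; _∷_)
open import Data.List.Relation.Unary.Any using (here; there)
open import Data.List.Relation.Unary.Unique.Propositional using (Unique)
import Data.List.Relation.Unary.Unique.Propositional.Properties as Uniqueₚ
open import Data.Nat using (ℕ; zero; suc; _+_; _*_; _∸_; _^_; _≤_; _<_; z≤n; s≤s; s≤s⁻¹; z<s; >-nonZero; _≤?_; _<?_; _⊓_)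
open import Data.Nat.DivMod using (_/_; _%_; m≡m%n+[m/n]*n; m%n<n)
open import Data.Nat.Properties
open import Data.Nat.Tactic.RingSolver using (solve-∀)
open import Data.Product using (Σ; _×_; _,_; proj₁; proj₂; ∃)
import Data.Product.Properties as ×ₚ
open import Data.Sum using (_⊎_; inj₁; inj₂; [_,_]′; map₂)
open import Data.Vec using (Vec; []; _∷_; lookup; zipWith; here; there)
import Data.Vec as Vec
import Data.Vec.Properties as Vecₚ
open import Function using (_∘_; id)
open import Function.Bundles using (mk⇔)
open import Relation.Binary.Definitions using (DecidableEquality)
open import Relation.Binary.PropositionalEquality using (_≡_; _≢_; refl; sym; trans; cong; cong₂; subst; subst₂; module ≡-Reasoning)
open import Relation.Nullary using (¬_; Dec; yes; no; does; ¬?; _×-dec_; _→-dec_; contradiction)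
open import Relation.Nullary.Decidable using (map′; decidable-stable; dec-true; toSum; _⊎-dec_)
open import Relation.Unary using (Decidable)
open IsPerfectMatching

-- All probabilities are counts: a random colouring is a vector over `2 J` colours, and expectations
-- are sums over all vectors. Each round of the fragment argument reveals one colour class and
-- halves the bound on the sizes of the remaining sets. So a number `J` of rounds of order log n
-- empties them, each round may lose a fraction of order `1 / J`, and `R` comes out as `64 J²`. The
-- decisive gap is that `R` is polylogarithmic in `n`, while `𝓐` is spread like a small power of
-- `n`: it keeps cores logarithmic, so that the couples of pairs cannot compete with the density of
-- order `1 / n` of a star. Pairs inside one block are not independent; the spread bound for `𝓐`
-- therefore discards every pair that touches a pinned one and pays with exponents in `k`. The
-- negligible density must also lie below what the transpositions cost: each costs a factor `V * V`,
-- and about `4 k²` of them are needed, which determines `s` in terms of `k` alone.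

^-distribʳ-* : ∀ t m n → (m * n) ^ t ≡ m ^ t * n ^ t
^-distribʳ-* zero    m n = refl
^-distribʳ-* (suc t) m n = trans (cong (m * n *_) (^-distribʳ-* t m n)) (interchange m n (m ^ t) (n ^ t))
  where
  interchange : ∀ a b c d → (a * b) * (c * d) ≡ (a * c) * (b * d)
  interchange = solve-∀

-- Finite sums over lists

∑ : {A : Set} → List A → (A → ℕ) → ℕ
∑ []       f = 0
∑ (x ∷ xs) f = f x + ∑ xs f

∑-mono : {A : Set} (xs : List A) {f g : A → ℕ} → (∀ x → x ∈ xs → f x ≤ g x) → ∑ xs f ≤ ∑ xs g
∑-mono []       h = z≤n
∑-mono (x ∷ xs) h = +-mono-≤ (h x (here refl)) (∑-mono xs (λ y y∈ → h y (there y∈)))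

∑-cong : {A : Set} (xs : List A) {f g : A → ℕ} → (∀ x → f x ≡ g x) → ∑ xs f ≡ ∑ xs g
∑-cong []       h = refl
∑-cong (x ∷ xs) h = cong₂ _+_ (h x) (∑-cong xs h)

∑-const : {A : Set} (xs : List A) (c : ℕ) → ∑ xs (λ _ → c) ≡ length xs * c
∑-const []       c = refl
∑-const (x ∷ xs) c = cong (c +_) (∑-const xs c)

∑-zero : {A : Set} (xs : List A) → ∑ xs (λ _ → 0) ≡ 0
∑-zero xs = trans (∑-const xs 0) (*-zeroʳ (length xs))

∑-+ : {A : Set} (xs : List A) (f g : A → ℕ) → ∑ xs (λ x → f x + g x) ≡ ∑ xs f + ∑ xs g
∑-+ []       f g = refl
∑-+ (x ∷ xs) f g = trans (cong (f x + g x +_) (∑-+ xs f g)) (interchange (f x) (g x) (∑ xs f) (∑ xs g))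
  where
  interchange : ∀ a b c d → (a + b) + (c + d) ≡ (a + c) + (b + d)
  interchange = solve-∀

∑-*ʳ : {A : Set} (xs : List A) (f : A → ℕ) (c : ℕ) → ∑ xs f * c ≡ ∑ xs (λ x → f x * c)
∑-*ʳ []       f c = refl
∑-*ʳ (x ∷ xs) f c = trans (*-distribʳ-+ c (f x) (∑ xs f)) (cong (f x * c +_) (∑-*ʳ xs f c))

∑-*ˡ : {A : Set} (c : ℕ) (xs : List A) (f : A → ℕ) → c * ∑ xs f ≡ ∑ xs (λ x → c * f x)
∑-*ˡ c xs f = trans (*-comm c (∑ xs f)) (trans (∑-*ʳ xs f c) (∑-cong xs (λ x → *-comm (f x) c)))

∑-swap : {A B : Set} (xs : List A) (ys : List B) (f : A → B → ℕ) →
  ∑ xs (λ x → ∑ ys (f x)) ≡ ∑ ys (λ y → ∑ xs (λ x → f x y))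
∑-swap []       ys f = sym (∑-zero ys)
∑-swap (x ∷ xs) ys f = trans (cong (∑ ys (f x) +_) (∑-swap xs ys f))
  (sym (∑-+ ys (f x) (λ y → ∑ xs (λ x → f x y))))

∑-++ : {A : Set} (xs ys : List A) (f : A → ℕ) → ∑ (xs ++ ys) f ≡ ∑ xs f + ∑ ys f
∑-++ []       ys f = refl
∑-++ (x ∷ xs) ys f = trans (cong (f x +_) (∑-++ xs ys f)) (sym (+-assoc (f x) _ _))

∑-map : {A B : Set} (g : A → B) (xs : List A) (f : B → ℕ) → ∑ (map g xs) f ≡ ∑ xs (f ∘ g)
∑-map g []       f = refl
∑-map g (x ∷ xs) f = cong (f (g x) +_) (∑-map g xs f)

∑-term : {A : Set} {xs : List A} {x : A} (f : A → ℕ) → x ∈ xs → f x ≤ ∑ xs f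
∑-term f (here refl) = m≤m+n _ _
∑-term f (there x∈)  = ≤-trans (∑-term f x∈) (m≤n+m _ _)

∑-pos : {A : Set} (xs : List A) (f : A → ℕ) → 0 < ∑ xs f → ∃ λ x → x ∈ xs × 0 < f x
∑-pos (x ∷ xs) f p with f x in eq
... | suc m = x , here refl , subst (0 <_) (sym eq) z<s
... | zero  with ∑-pos xs f p
...   | y , y∈ , q = y , there y∈ , q

∑-∖ : {A : Set} {xs : List A} {x : A} (f : A → ℕ) (x∈ : x ∈ xs) → ∑ xs f ≡ f x + ∑ (xs ∖ x∈) f
∑-∖ f (here refl) = refl
∑-∖ {xs = y ∷ xs} {x} f (there x∈) = trans (cong (f y +_) (∑-∖ f x∈))
  (rotate (f y) (f x) (∑ (xs ∖ x∈) f))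
  where
  rotate : ∀ a b c → a + (b + c) ≡ b + (a + c)
  rotate = solve-∀

∈-∖ : {A : Set} {xs : List A} {x y : A} (x∈ : x ∈ xs) → y ∈ xs → y ≢ x → y ∈ (xs ∖ x∈)
∈-∖ (here refl) (here refl) y≢x = ⊥-elim (y≢x refl)
∈-∖ (here refl) (there y∈)  y≢x = y∈
∈-∖ (there x∈)  (here refl) y≢x = here refl
∈-∖ (there x∈)  (there y∈)  y≢x = there (∈-∖ x∈ y∈ y≢x)

∑-⊆ : {A : Set} {xs : List A} (ys : List A) (f : A → ℕ) → Unique xs → (∀ {x} → x ∈ xs → x ∈ ys) → ∑ xs f ≤ ∑ ys f
∑-⊆ ys f [] sub = z≤n
∑-⊆ {xs = x ∷ xs} ys f (x∉ ∷ u) sub = subst (f x + ∑ xs f ≤_) (sym (∑-∖ f (sub (here refl))))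
  (+-monoʳ-≤ (f x) (∑-⊆ (ys ∖ sub (here refl)) f u
    (λ y∈ → ∈-∖ (sub (here refl)) (sub (there y∈)) (λ y≡x → All.lookup x∉ y∈ (sym y≡x)))))

length≡∑ : {A : Set} (xs : List A) → length xs ≡ ∑ xs (λ _ → 1)
length≡∑ xs = sym (trans (∑-const xs 1) (*-identityʳ (length xs)))

-- Indicators and counting

𝟙 : {P : Set} → Dec P → ℕ
𝟙 d = if does d then 1 else 0

𝟙-yes : {P : Set} (d : Dec P) → P → 𝟙 d ≡ 1
𝟙-yes (yes _) p = refl
𝟙-yes (no ¬p) p = ⊥-elim (¬p p)

𝟙-no : {P : Set} (d : Dec P) → ¬ P → 𝟙 d ≡ 0
𝟙-no (yes p) ¬p = ⊥-elim (¬p p)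
𝟙-no (no _)  ¬p = refl

𝟙≤1 : {P : Set} (d : Dec P) → 𝟙 d ≤ 1
𝟙≤1 (yes _) = s≤s z≤n
𝟙≤1 (no _)  = z≤n

𝟙-pos : {P : Set} (d : Dec P) → 0 < 𝟙 d → P
𝟙-pos (yes p) _ = p

𝟙-mono : {P Q : Set} (d : Dec P) (e : Dec Q) → (P → Q) → 𝟙 d ≤ 𝟙 e
𝟙-mono (no _)  e h = z≤n
𝟙-mono (yes p) e h = ≤-reflexive (sym (𝟙-yes e (h p)))

𝟙-≤ : {P : Set} (d : Dec P) {m : ℕ} → (P → 1 ≤ m) → 𝟙 d ≤ m
𝟙-≤ (yes p) h = h p
𝟙-≤ (no _)  h = z≤n

𝟙*≤ : {P : Set} (d : Dec P) (m : ℕ) {b : ℕ} → (P → m ≤ b) → 𝟙 d * m ≤ b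
𝟙*≤ (yes p) m h = ≤-trans (≤-reflexive (*-identityˡ m)) (h p)
𝟙*≤ (no _)  m h = z≤n

𝟙-split : {P : Set} (d : Dec P) → 𝟙 d + 𝟙 (¬? d) ≡ 1
𝟙-split (yes _) = refl
𝟙-split (no _)  = refl

# : {A : Set} {P : A → Set} → Decidable P → List A → ℕ
# P? xs = ∑ xs (λ x → 𝟙 (P? x))

#-mono : {A : Set} {P Q : A → Set} (P? : Decidable P) (Q? : Decidable Q) (xs : List A) →
  (∀ x → x ∈ xs → P x → Q x) → # P? xs ≤ # Q? xs
#-mono P? Q? xs h = ∑-mono xs (λ x x∈ → 𝟙-mono (P? x) (Q? x) (h x x∈))

#≤length : {A : Set} {P : A → Set} (P? : Decidable P) (xs : List A) → # P? xs ≤ length xs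
#≤length P? xs = subst (# P? xs ≤_) (sym (length≡∑ xs)) (∑-mono xs (λ x _ → 𝟙≤1 (P? x)))

#-pos : {A : Set} {P : A → Set} (P? : Decidable P) (xs : List A) → 0 < # P? xs → ∃ λ x → x ∈ xs × P x
#-pos P? xs p with ∑-pos xs _ p
... | x , x∈ , q = x , x∈ , 𝟙-pos (P? x) q

#-filter : {A : Set} {P Q : A → Set} (P? : Decidable P) (Q? : Decidable Q) (xs : List A) →
  # Q? (filter P? xs) ≡ ∑ xs (λ x → 𝟙 (P? x) * 𝟙 (Q? x))
#-filter P? Q? [] = refl
#-filter P? Q? (x ∷ xs) with P? x
... | yes _ = cong₂ _+_ (sym (*-identityˡ _)) (#-filter P? Q? xs)
... | no _  = #-filter P? Q? xs

length-filter : {A : Set} {P : A → Set} (P? : Decidable P) (xs : List A) → length (filter P? xs) ≡ # P? xs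
length-filter P? [] = refl
length-filter P? (x ∷ xs) with P? x
... | yes _ = cong suc (length-filter P? xs)
... | no _  = length-filter P? xs

length-split : {A : Set} {P : A → Set} (P? : Decidable P) (xs : List A) →
  # P? xs + # (¬? ∘ P?) xs ≡ length xs
length-split P? xs = trans (sym (∑-+ xs _ _)) (trans (∑-cong xs (λ x → 𝟙-split (P? x))) (sym (length≡∑ xs)))

-- Enumeration of vectors and subsets

allVecs : {A : Set} → List A → (n : ℕ) → List (Vec A n)
allVecs as zero    = [] ∷ []
allVecs as (suc n) = cartesianProductWith _∷_ as (allVecs as n)

∈-allVecs : {A : Set} {as : List A} → (∀ a → a ∈ as) → ∀ {n} (v : Vec A n) → v ∈ allVecs as n
∈-allVecs h []      = here refl
∈-allVecs h (a ∷ v) = ∈-cartesianProductWith⁺ _∷_ (h a) (∈-allVecs h v)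

allVecs-Unique : {A : Set} {as : List A} → Unique as → ∀ n → Unique (allVecs as n)
allVecs-Unique u zero    = [] ∷ []
allVecs-Unique u (suc n) = Uniqueₚ.cartesianProductWith⁺ _∷_ Vecₚ.∷-injective u (allVecs-Unique u n)

∑-product : {A B C : Set} (f : A → B → C) (xs : List A) (ys : List B) (h : C → ℕ) →
  ∑ (cartesianProductWith f xs ys) h ≡ ∑ xs (λ x → ∑ ys (λ y → h (f x y)))
∑-product f []       ys h = refl
∑-product f (x ∷ xs) ys h = trans (∑-++ (map (f x) ys) _ h) (cong₂ _+_ (∑-map (f x) ys h) (∑-product f xs ys h))

∑-allVecs : {A : Set} (as : List A) (n : ℕ) (f : Vec A (suc n) → ℕ) →
  ∑ (allVecs as (suc n)) f ≡ ∑ as (λ a → ∑ (allVecs as n) (λ v → f (a ∷ v)))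
∑-allVecs as n = ∑-product _∷_ as (allVecs as n)

subsets : (e : ℕ) → List (Subset e)
subsets = allVecs (true ∷ false ∷ [])

∈-subsets : ∀ {e} (T : Subset e) → T ∈ subsets e
∈-subsets = ∈-allVecs λ { true → here refl ; false → there (here refl) }

#subsets : ∀ {e} (P : Subset e) → # (_⊆? P) (subsets e) ≡ 2 ^ ∣ P ∣
#subsets [] = refl
#subsets {suc e} (true ∷ P) = trans (∑-allVecs _ e _) (cong₂ _+_ (#subsets P) (cong (_+ 0) (#subsets P)))
#subsets {suc e} (false ∷ P) = trans (∑-allVecs _ e _)
  (cong₂ _+_ (∑-zero (subsets e)) (trans (+-identityʳ _) (#subsets P)))

≤-if-positive : ∀ m {b} → (0 < m → m ≤ b) → m ≤ b
≤-if-positive zero    h = z≤n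
≤-if-positive (suc m) h = h z<s

∉-─ : ∀ {n} {x : Fin n} (p q : Subset n) → x ∈ˢ (p ─ q) → x ∉ˢ q
∉-─ (_ ∷ p) (true ∷ q) () here
∉-─ (_ ∷ p) (_ ∷ q) (there x∈) (there y∈) = ∉-─ p q x∈ y∈

⊆∧∣≥∣⇒⊇ : ∀ {n} {p q : Subset n} → p ⊆ q → ∣ q ∣ ≤ ∣ p ∣ → q ⊆ p
⊆∧∣≥∣⇒⊇ {p = p} p⊆q q≤p {x} x∈q with x ∈ˢ? p
... | yes x∈p = x∈p
... | no x∉p = ⊥-elim (<-irrefl refl (<-≤-trans (p⊂q⇒∣p∣<∣q∣ (p⊆q , x , x∈q , x∉p)) q≤p))

-- Random colourings and minimal fragments

module Fragments {Col : Set} (_≟_ : DecidableEquality Col) (cols : List Col) (e : ℕ) where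

  Ω : List (Vec Col e)
  Ω = allVecs cols e

  class : ∀ {n} → Col → Vec Col n → Subset n
  class a c = Vec.map (λ b → does (b ≟ a)) c

  class⁻ : ∀ {n} a (c : Vec Col n) {x} → x ∈ˢ class a c → lookup c x ≡ a
  class⁻ a (b ∷ c) {Fin.zero} p with b ≟ a
  ... | yes b≡a = b≡a
  class⁻ a (b ∷ c) {Fin.zero} () | no _
  class⁻ a (b ∷ c) {Fin.suc x} (there p) = class⁻ a c p

  class⁺ : ∀ {n} a (c : Vec Col n) {x} → lookup c x ≡ a → x ∈ˢ class a c
  class⁺ a (b ∷ c) {Fin.zero} p with b ≟ a
  ... | yes _ = here
  ... | no b≢a = ⊥-elim (b≢a p)
  class⁺ a (b ∷ c) {Fin.suc x} p = there (class⁺ a c p)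

  recolour : ∀ {n} → Col → Subset n → Vec Col n → Vec Col n
  recolour a = zipWith (λ t b → if t then a else b)

  recolour-∈ : ∀ {n} a (T : Subset n) c {x} → x ∈ˢ T → lookup (recolour a T c) x ≡ a
  recolour-∈ a (true ∷ T) (b ∷ c) here = refl
  recolour-∈ a (_ ∷ T) (b ∷ c) (there p) = recolour-∈ a T c p

  recolour-∉ : ∀ {n} a (T : Subset n) c {x} → x ∉ˢ T → lookup (recolour a T c) x ≡ lookup c x
  recolour-∉ a (true ∷ T)  (b ∷ c) {Fin.zero}  p = ⊥-elim (p here)
  recolour-∉ a (false ∷ T) (b ∷ c) {Fin.zero}  p = refl
  recolour-∉ a (_ ∷ T)     (b ∷ c) {Fin.suc x} p = recolour-∉ a T c (p ∘ there)

  -- Recolouring forgets the colours on `T` and nothing else, so it is at most `length cols ^ ∣ T ∣`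
  -- to one.
  ∑-recolour : ∀ {n a} → a ∈ cols → (T : Subset n) (ψ : Vec Col n → ℕ) →
    ∑ (allVecs cols n) (ψ ∘ recolour a T) ≤ length cols ^ ∣ T ∣ * ∑ (allVecs cols n) ψ
  ∑-recolour a∈ [] ψ = ≤-reflexive (sym (+-identityʳ _))
  ∑-recolour {suc n} {a} a∈ (false ∷ T) ψ = begin
    ∑ (allVecs cols (suc n)) (ψ ∘ recolour a (false ∷ T))
      ≡⟨ ∑-allVecs cols n _ ⟩
    ∑ cols (λ b → ∑ (allVecs cols n) (λ c → ψ (b ∷ recolour a T c)))
      ≤⟨ ∑-mono cols (λ b _ → ∑-recolour a∈ T (λ c → ψ (b ∷ c))) ⟩
    ∑ cols (λ b → length cols ^ ∣ T ∣ * ∑ (allVecs cols n) (λ c → ψ (b ∷ c)))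
      ≡⟨ ∑-*ˡ (length cols ^ ∣ T ∣) cols _ ⟨
    length cols ^ ∣ T ∣ * ∑ cols (λ b → ∑ (allVecs cols n) (λ c → ψ (b ∷ c)))
      ≡⟨ cong (length cols ^ ∣ T ∣ *_) (∑-allVecs cols n ψ) ⟨
    length cols ^ ∣ T ∣ * ∑ (allVecs cols (suc n)) ψ ∎
    where open ≤-Reasoning
  ∑-recolour {suc n} {a} a∈ (true ∷ T) ψ = begin
    ∑ (allVecs cols (suc n)) (ψ ∘ recolour a (true ∷ T))
      ≡⟨ ∑-allVecs cols n _ ⟩
    ∑ cols (λ _ → ∑ (allVecs cols n) (λ c → ψ (a ∷ recolour a T c)))
      ≡⟨ ∑-const cols _ ⟩
    length cols * ∑ (allVecs cols n) (λ c → ψ (a ∷ recolour a T c))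
      ≤⟨ *-monoʳ-≤ (length cols) (∑-recolour a∈ T (λ c → ψ (a ∷ c))) ⟩
    length cols * (length cols ^ ∣ T ∣ * ∑ (allVecs cols n) (λ c → ψ (a ∷ c)))
      ≡⟨ *-assoc (length cols) _ _ ⟨
    length cols ^ suc ∣ T ∣ * ∑ (allVecs cols n) (λ c → ψ (a ∷ c))
      ≤⟨ *-monoʳ-≤ (length cols ^ suc ∣ T ∣) (∑-term (λ b → ∑ (allVecs cols n) (λ c → ψ (b ∷ c))) a∈) ⟩
    length cols ^ suc ∣ T ∣ * ∑ cols (λ b → ∑ (allVecs cols n) (λ c → ψ (b ∷ c)))
      ≡⟨ cong (length cols ^ suc ∣ T ∣ *_) (∑-allVecs cols n ψ) ⟨
    length cols ^ suc ∣ T ∣ * ∑ (allVecs cols (suc n)) ψ ∎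
    where open ≤-Reasoning

  -- The minimum fragment: among the members inside `W ∪ S`, one with fewest elements outside `W` is
  -- chosen, and those elements are kept. The default `S` of `argmin` is itself a candidate whenever
  -- `S ∈ L`.
  minimiser fragment : List (Subset e) → Subset e → Subset e → Subset e
  minimiser L W S = argmin (λ S′ → ∣ S′ ─ W ∣) S (filter (_⊆? (W ∪ S)) L)
  fragment L W S = minimiser L W S ─ W

  module _ (L : List (Subset e)) (W : Subset e) {S : Subset e} (S∈L : S ∈ L) where

    private
      minimiser-spec : minimiser L W S ∈ filter (_⊆? (W ∪ S)) L
      minimiser-spec with argmin-sel (λ S′ → ∣ S′ ─ W ∣) S (filter (_⊆? (W ∪ S)) L)
      ... | inj₁ eq = subst (_∈ filter (_⊆? (W ∪ S)) L) (sym eq) (∈-filter⁺ (_⊆? (W ∪ S)) S∈L (x∈p∪q⁺ ∘ inj₂))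
      ... | inj₂ m∈ = m∈

    minimiser-∈ : minimiser L W S ∈ L
    minimiser-∈ = proj₁ (∈-filter⁻ (_⊆? (W ∪ S)) {xs = L} minimiser-spec)

    minimiser-⊆ : minimiser L W S ⊆ W ∪ S
    minimiser-⊆ = proj₂ (∈-filter⁻ (_⊆? (W ∪ S)) {xs = L} minimiser-spec)

    fragment-minimal : ∀ {S′} → S′ ∈ L → S′ ⊆ W ∪ S → ∣ fragment L W S ∣ ≤ ∣ S′ ─ W ∣
    fragment-minimal S′∈ S′⊆ = All.lookup (f[argmin]≤f[xs] {f = λ S′ → ∣ S′ ─ W ∣} S (filter (_⊆? (W ∪ S)) L))
      (∈-filter⁺ (_⊆? (W ∪ S)) S′∈ S′⊆)

    fragment-⊆ : fragment L W S ⊆ S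
    fragment-⊆ x∈ with x∈p∪q⁻ W S (minimiser-⊆ (p─q⊆p _ W x∈))
    ... | inj₁ x∈W = ⊥-elim (∉-─ _ W x∈ x∈W)
    ... | inj₂ x∈S = x∈S

  -- U lists the colours revealed so far; only their classes influence fam.
  -- By loss, the i rounds played so far cost at most i K / z members on average.
  record Stage (G : List (Subset e)) (K R z : ℕ) (U : List Col) (j i : ℕ) : Set where
    field
      fam       : Vec Col e → List (Subset e)
      invariant : ∀ c c′ → (∀ u → u ∈ U → class u c ≡ class u c′) → fam c ≡ fam c′
      avoids    : ∀ c {S u x} → S ∈ fam c → u ∈ U → x ∈ˢ S → lookup c x ≢ u
      bounded   : ∀ c → length (fam c) ≤ length G
      small     : ∀ c {S} → S ∈ fam c → ∣ S ∣ < 2 ^ j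
      spread    : ∀ c T → # (T ⊆?_) (fam c) * R ^ ∣ T ∣ ≤ K
      parent    : ∀ c {S} → S ∈ fam c → ∃ λ g → g ∈ G × (∀ x → x ∈ˢ g → x ∈ˢ S ⊎ lookup c x ∈ U)
      loss      : length Ω * length G * z ≤ ∑ Ω (length ∘ fam) * z + i * (K * length Ω)

  -- Any choice serves that depends on the list alone, since the encoding has to recover it from the
  -- recoloured vector. The default `∅` obeys every positive size bound.
  pick : List (Subset e) → Subset e
  pick []      = ∅
  pick (S ∷ _) = S

  pick-∈ : ∀ {S Ls} → S ∈ Ls → pick Ls ∈ Ls
  pick-∈ {Ls = _ ∷ _} _ = here refl

  pick-bound : ∀ {b} Ls → 0 < b → (∀ {S} → S ∈ Ls → ∣ S ∣ < b) → ∣ pick Ls ∣ < b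
  pick-bound []       b>0 h = subst (_< _) (sym (∣⊥∣≡0 e)) b>0
  pick-bound (S ∷ Ls) b>0 h = h (here refl)

  -- One round reveals the class of `a`, replaces every member by its fragment and discards the
  -- fragments with `2 ^ j` or more elements. The point is that few are discarded on average.
  module Round {G : List (Subset e)} {K z : ℕ} {U : List Col} {j i : ℕ}
    (z>0 : 0 < z) (st : Stage G K (4 * length cols * z) z U (suc j) i)
    {a : Col} (a∈ : a ∈ cols) (a∉U : ¬ a ∈ U) where

    open Stage st

    private
      R : ℕ
      R = 4 * length cols * z

      frag : Vec Col e → Subset e → Subset e
      frag c = fragment (fam c) (class a c)

      small? : Decidable {A = Subset e} (λ T → ∣ T ∣ < 2 ^ j)
      small? T = ∣ T ∣ <? 2 ^ j

      fam′ : Vec Col e → List (Subset e)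
      fam′ c = filter small? (map (frag c) (fam c))

      bad : Vec Col e → ℕ
      bad c = ∑ (fam c) (λ S → 𝟙 (¬? (small? (frag c S))))

      hits : Vec Col e → Subset e → ℕ
      hits c T = # (λ S → Vecₚ.≡-dec Boolₚ._≟_ T (frag c S)) (fam c)

      P : Vec Col e → Subset e
      P c = pick (filter (_⊆? class a c) (fam c))

      ψ : Subset e → Vec Col e → ℕ
      ψ T c = 𝟙 (T ⊆? P c) * # (T ⊆?_) (fam c)

      fam-length : ∀ c → length (fam c) ≡ length (fam′ c) + bad c
      fam-length c = sym (trans (cong (_+ bad c) (trans (length-filter small? (map (frag c) (fam c))) (∑-map (frag c) (fam c) _)))
        (length-split (small? ∘ frag c) (fam c)))

      bad≤hits : ∀ c → bad c ≤ ∑ (subsets e) (λ T → 𝟙 (¬? (small? T)) * hits c T)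
      bad≤hits c = begin
        bad c
          ≤⟨ ∑-mono (fam c) (λ S _ → ≤-trans (≤-reflexive (sym (trans (cong (𝟙 (¬? (small? (frag c S))) *_) (𝟙-yes (Vecₚ.≡-dec Boolₚ._≟_ (frag c S) (frag c S)) refl)) (*-identityʳ _))))
               (∑-term (λ T → 𝟙 (¬? (small? T)) * 𝟙 (Vecₚ.≡-dec Boolₚ._≟_ T (frag c S))) (∈-subsets (frag c S)))) ⟩
        ∑ (fam c) (λ S → ∑ (subsets e) (λ T → 𝟙 (¬? (small? T)) * 𝟙 (Vecₚ.≡-dec Boolₚ._≟_ T (frag c S))))
          ≡⟨ ∑-swap (fam c) (subsets e) _ ⟩
        ∑ (subsets e) (λ T → ∑ (fam c) (λ S → 𝟙 (¬? (small? T)) * 𝟙 (Vecₚ.≡-dec Boolₚ._≟_ T (frag c S))))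
          ≡⟨ ∑-cong (subsets e) (λ T → sym (∑-*ˡ (𝟙 (¬? (small? T))) (fam c) _)) ⟩
        ∑ (subsets e) (λ T → 𝟙 (¬? (small? T)) * hits c T) ∎
        where open ≤-Reasoning

      -- The pair (c , T) is encoded by the recolouring c′, in which T joins class a.
      -- Minimality of T forces T = P c′ ─ class a c, so T is one of the 2 ^ ∣ P c′ ∣
      -- subsets of P c′, and c is one of the C ^ ∣ T ∣ preimages of c′.
      module Encode (c : Vec Col e) {S : Subset e} (S∈ : S ∈ fam c) where
        T : Subset e
        T = frag c S
        c′ : Vec Col e
        c′ = recolour a T c

        class-other : ∀ u → u ∈ U → class u c ≡ class u c′
        class-other u u∈ = ⊆-antisym
          (λ {x} x∈ → class⁺ u c′ (trans (recolour-∉ a T c (λ x∈T → avoids c S∈ u∈ (fragment-⊆ (fam c) (class a c) S∈ x∈T) (class⁻ u c x∈))) (class⁻ u c x∈)))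
          back
          where
          back : class u c′ ⊆ class u c
          back {x} x∈ = [ (λ x∈T → ⊥-elim (a∉U (subst (_∈ U) (trans (sym (class⁻ u c′ x∈)) (recolour-∈ a T c x∈T)) u∈)))
                        , (λ x∉T → class⁺ u c (trans (sym (recolour-∉ a T c x∉T)) (class⁻ u c′ x∈))) ]′ (toSum (x ∈ˢ? T))

        fam-same : fam c ≡ fam c′
        fam-same = invariant c c′ class-other

        class-a : ∀ {x} → x ∈ˢ class a c′ → x ∈ˢ class a c ⊎ x ∈ˢ T
        class-a {x} x∈ = [ inj₂ , (λ x∉T → inj₁ (class⁺ a c (trans (sym (recolour-∉ a T c x∉T)) (class⁻ a c′ x∈)))) ]′ (toSum (x ∈ˢ? T))

        min⊆ : minimiser (fam c) (class a c) S ⊆ class a c′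
        min⊆ {x} x∈ = [ (λ x∈T → class⁺ a c′ (recolour-∈ a T c x∈T)) , outside-T ]′ (toSum (x ∈ˢ? T))
          where
          outside-T : x ∉ˢ T → x ∈ˢ class a c′
          outside-T x∉T = [ (λ x∈W → class⁺ a c′ (trans (recolour-∉ a T c x∉T) (class⁻ a c x∈W)))
                          , (λ x∉W → ⊥-elim (x∉T (x∈p∧x∉q⇒x∈p─q x∈ x∉W))) ]′ (toSum (x ∈ˢ? class a c))

        P-spec : P c′ ∈ filter (_⊆? class a c′) (fam c′)
        P-spec = pick-∈ (∈-filter⁺ (_⊆? class a c′)
          (subst (minimiser (fam c) (class a c) S ∈_) fam-same (minimiser-∈ (fam c) (class a c) S∈)) min⊆)

        P-∈ : P c′ ∈ fam c
        P-∈ = subst (P c′ ∈_) (sym fam-same) (proj₁ (∈-filter⁻ (_⊆? class a c′) {xs = fam c′} P-spec))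

        P-⊆ : P c′ ⊆ class a c′
        P-⊆ = proj₂ (∈-filter⁻ (_⊆? class a c′) {xs = fam c′} P-spec)

        P⊆W∪S : P c′ ⊆ class a c ∪ S
        P⊆W∪S x∈ = x∈p∪q⁺ (map₂ (fragment-⊆ (fam c) (class a c) S∈) (class-a (P-⊆ x∈)))

        P─W⊆T : P c′ ─ class a c ⊆ T
        P─W⊆T x∈ = [ (λ x∈W → ⊥-elim (∉-─ (P c′) (class a c) x∈ x∈W)) , id ]′ (class-a (P-⊆ (p─q⊆p (P c′) (class a c) x∈)))

        T⊆P : T ⊆ P c′
        T⊆P x∈ = p─q⊆p (P c′) (class a c) (⊆∧∣≥∣⇒⊇ P─W⊆T (fragment-minimal (fam c) (class a c) S∈ P-∈ P⊆W∪S) x∈)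

        hits≤ : hits c T ≤ ψ T c′
        hits≤ = begin
          hits c T                    ≤⟨ #-mono (λ S → Vecₚ.≡-dec Boolₚ._≟_ T (frag c S)) (T ⊆?_) (fam c) (λ S′ S′∈ T≡ → subst (_⊆ S′) (sym T≡) (fragment-⊆ (fam c) (class a c) S′∈)) ⟩
          # (T ⊆?_) (fam c)           ≡⟨ cong (# (T ⊆?_)) fam-same ⟩
          # (T ⊆?_) (fam c′)          ≡⟨ *-identityˡ _ ⟨
          1 * # (T ⊆?_) (fam c′)      ≡⟨ cong (_* # (T ⊆?_) (fam c′)) (𝟙-yes (T ⊆? P c′) T⊆P) ⟨
          ψ T c′                      ∎
          where open ≤-Reasoning

      hits≤ψ : ∀ c T → hits c T ≤ ψ T (recolour a T c)
      hits≤ψ c T = ≤-if-positive (hits c T) λ pos →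
        let (S , S∈ , T≡) = #-pos (λ S → Vecₚ.≡-dec Boolₚ._≟_ T (frag c S)) (fam c) pos
        in subst (λ T → hits c T ≤ ψ T (recolour a T c)) (sym T≡) (Encode.hits≤ c S∈)

      B : ℕ
      B = 2 ^ (2 ^ suc j)

      -- The origin of `R = 4 * length cols * z`. For every element of `T`, the factor `length cols`
      -- pays for the colour forgotten by recolouring, and the factor 4 for naming `T` inside `P c`,
      -- since `∣ T ∣ ≥ 2 ^ j` gives `4 ^ ∣ T ∣ ≥ B`. A single factor `z` remains as the gain.
      weight : ∀ c T → 2 ^ j ≤ ∣ T ∣ → (length cols ^ ∣ T ∣ * # (T ⊆?_) (fam c) * z) * B ≤ K
      weight c T big = begin
        (length cols ^ t * d * z) * B
          ≤⟨ *-mono-≤ (*-monoʳ-≤ (length cols ^ t * d) z≤z^t) B≤4^t ⟩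
        (length cols ^ t * d * z ^ t) * 4 ^ t
          ≡⟨ rearrange (length cols ^ t) d (z ^ t) (4 ^ t) ⟩
        d * ((4 ^ t * length cols ^ t) * z ^ t)
          ≡⟨ cong (λ w → d * (w * z ^ t)) (^-distribʳ-* t 4 (length cols)) ⟨
        d * ((4 * length cols) ^ t * z ^ t)
          ≡⟨ cong (d *_) (^-distribʳ-* t (4 * length cols) z) ⟨
        d * R ^ t
          ≤⟨ spread c T ⟩
        K ∎
        where
        open ≤-Reasoning
        t d : ℕ
        t = ∣ T ∣
        d = # (T ⊆?_) (fam c)
        rearrange : ∀ p q r s → (p * q * r) * s ≡ q * ((s * p) * r)
        rearrange = solve-∀
        z≤z^t : z ≤ z ^ t
        z≤z^t = ≤-trans (≤-reflexive (sym (^-identityʳ z))) (^-monoʳ-≤ z {{>-nonZero z>0}} (≤-trans (m^n>0 2 j) big))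
        B≤4^t : B ≤ 4 ^ t
        B≤4^t = ≤-trans (^-monoʳ-≤ 2 (*-monoʳ-≤ 2 big)) (≤-reflexive (sym (^-*-assoc 2 2 t)))

      -- Only subsets of `P c` contribute. There are at most `B` of them, as `∣ P c ∣ < 2 ^ suc j`,
      -- and by `weight` each contributes at most `K / B`.
      per-colouring : ∀ c → ∑ (subsets e) (λ T → 𝟙 (¬? (small? T)) * (length cols ^ ∣ T ∣ * ψ T c)) * z ≤ K
      per-colouring c = *-cancelʳ-≤ _ K B {{>-nonZero (m^n>0 2 (2 ^ suc j))}} (begin
        ∑ (subsets e) (λ T → 𝟙 (¬? (small? T)) * (length cols ^ ∣ T ∣ * ψ T c)) * z * B
          ≡⟨ *-assoc (∑ (subsets e) (λ T → 𝟙 (¬? (small? T)) * (length cols ^ ∣ T ∣ * ψ T c))) z B ⟩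
        ∑ (subsets e) (λ T → 𝟙 (¬? (small? T)) * (length cols ^ ∣ T ∣ * ψ T c)) * (z * B)
          ≡⟨ ∑-*ʳ (subsets e) _ (z * B) ⟩
        ∑ (subsets e) (λ T → 𝟙 (¬? (small? T)) * (length cols ^ ∣ T ∣ * ψ T c) * (z * B))
          ≤⟨ ∑-mono (subsets e) (λ T _ → term T) ⟩
        ∑ (subsets e) (λ T → 𝟙 (T ⊆? P c) * K)
          ≡⟨ ∑-*ʳ (subsets e) _ K ⟨
        # (_⊆? P c) (subsets e) * K
          ≡⟨ cong (_* K) (#subsets (P c)) ⟩
        2 ^ ∣ P c ∣ * K
          ≤⟨ *-monoˡ-≤ K (^-monoʳ-≤ 2 (<⇒≤ (pick-bound (filter (_⊆? class a c) (fam c)) (m^n>0 2 (suc j)) (λ S∈ → small c (proj₁ (∈-filter⁻ (_⊆? class a c) {xs = fam c} S∈)))))) ⟩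
        B * K
          ≡⟨ *-comm B K ⟩
        K * B ∎)
        where
        open ≤-Reasoning
        rearrange : ∀ p q r s t → p * (q * r) * (s * t) ≡ q * (p * r * s * t)
        rearrange = solve-∀
        term : ∀ T → 𝟙 (¬? (small? T)) * (length cols ^ ∣ T ∣ * ψ T c) * (z * B) ≤ 𝟙 (T ⊆? P c) * K
        term T = ≤-trans (≤-reflexive (*-assoc (𝟙 (¬? (small? T))) _ (z * B)))
          (𝟙*≤ (¬? (small? T)) _ (λ ¬small → ≤-trans
            (≤-reflexive (rearrange (length cols ^ ∣ T ∣) (𝟙 (T ⊆? P c)) (# (T ⊆?_) (fam c)) z B))
            (*-monoʳ-≤ (𝟙 (T ⊆? P c)) (weight c T (≮⇒≥ ¬small)))))

      -- Discarded members are grouped by the value `T` of their fragment. Passing to the recoloured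
      -- vector costs `length cols ^ ∣ T ∣`, after which each vector can be treated on its own by
      -- `per-colouring`.
      ∑bad : ∑ Ω bad * z ≤ K * length Ω
      ∑bad = begin
        ∑ Ω bad * z
          ≤⟨ *-monoˡ-≤ z (∑-mono Ω (λ c _ → ≤-trans (bad≤hits c) (∑-mono (subsets e) (λ T _ → *-monoʳ-≤ (𝟙 (¬? (small? T))) (hits≤ψ c T))))) ⟩
        ∑ Ω (λ c → ∑ (subsets e) (λ T → 𝟙 (¬? (small? T)) * ψ T (recolour a T c))) * z
          ≡⟨ cong (_* z) (∑-swap Ω (subsets e) _) ⟩
        ∑ (subsets e) (λ T → ∑ Ω (λ c → 𝟙 (¬? (small? T)) * ψ T (recolour a T c))) * z
          ≡⟨ cong (_* z) (∑-cong (subsets e) (λ T → sym (∑-*ˡ (𝟙 (¬? (small? T))) Ω _))) ⟩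
        ∑ (subsets e) (λ T → 𝟙 (¬? (small? T)) * ∑ Ω (ψ T ∘ recolour a T)) * z
          ≤⟨ *-monoˡ-≤ z (∑-mono (subsets e) (λ T _ → *-monoʳ-≤ (𝟙 (¬? (small? T))) (∑-recolour a∈ T (ψ T)))) ⟩
        ∑ (subsets e) (λ T → 𝟙 (¬? (small? T)) * (length cols ^ ∣ T ∣ * ∑ Ω (ψ T))) * z
          ≡⟨ cong (_* z) (∑-cong (subsets e) (λ T → trans (cong (𝟙 (¬? (small? T)) *_) (∑-*ˡ (length cols ^ ∣ T ∣) Ω _)) (∑-*ˡ (𝟙 (¬? (small? T))) Ω _))) ⟩
        ∑ (subsets e) (λ T → ∑ Ω (λ c → 𝟙 (¬? (small? T)) * (length cols ^ ∣ T ∣ * ψ T c))) * z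
          ≡⟨ cong (_* z) (∑-swap (subsets e) Ω _) ⟩
        ∑ Ω (λ c → ∑ (subsets e) (λ T → 𝟙 (¬? (small? T)) * (length cols ^ ∣ T ∣ * ψ T c))) * z
          ≡⟨ ∑-*ʳ Ω _ z ⟩
        ∑ Ω (λ c → ∑ (subsets e) (λ T → 𝟙 (¬? (small? T)) * (length cols ^ ∣ T ∣ * ψ T c)) * z)
          ≤⟨ ∑-mono Ω (λ c _ → per-colouring c) ⟩
        ∑ Ω (λ _ → K)
          ≡⟨ ∑-const Ω K ⟩
        length Ω * K
          ≡⟨ *-comm (length Ω) K ⟩
        K * length Ω ∎
        where open ≤-Reasoning

      from : ∀ c {T} → T ∈ fam′ c → ∃ λ S → S ∈ fam c × T ≡ frag c S
      from c T∈ = ∈-map⁻ (frag c) (proj₁ (∈-filter⁻ small? {xs = map (frag c) (fam c)} T∈))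

      avoids′ : ∀ c {T u x} → T ∈ fam′ c → u ∈ a ∷ U → x ∈ˢ T → lookup c x ≢ u
      avoids′ c T∈ u∈ x∈ eq =
        let (S , S∈ , T≡) = from c T∈
        in fragment-avoids S∈ u∈ (subst (_ ∈ˢ_) T≡ x∈) eq
        where
        fragment-avoids : ∀ {S u x} → S ∈ fam c → u ∈ a ∷ U → x ∈ˢ frag c S → lookup c x ≢ u
        fragment-avoids {S} S∈ (here u≡a) x∈ eq = ∉-─ (minimiser (fam c) (class a c) S) (class a c) x∈ (class⁺ a c (trans eq u≡a))
        fragment-avoids S∈ (there u∈)     x∈ eq = avoids c S∈ u∈ (fragment-⊆ (fam c) (class a c) S∈ x∈) eq

      -- A fragment lies in the set it comes from, and equal fragments are still counted separately
      -- in the list, so degrees do not grow.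
      spread′ : ∀ c T → # (T ⊆?_) (fam′ c) * R ^ ∣ T ∣ ≤ K
      spread′ c T = ≤-trans (*-monoˡ-≤ (R ^ ∣ T ∣) (begin
        # (T ⊆?_) (fam′ c)                    ≡⟨ #-filter small? (T ⊆?_) (map (frag c) (fam c)) ⟩
        ∑ (map (frag c) (fam c)) (λ S → 𝟙 (small? S) * 𝟙 (T ⊆? S))
                                              ≡⟨ ∑-map (frag c) (fam c) _ ⟩
        ∑ (fam c) (λ S → 𝟙 (small? (frag c S)) * 𝟙 (T ⊆? frag c S))
          ≤⟨ ∑-mono (fam c) (λ S S∈ → 𝟙*≤ (small? (frag c S)) _ (λ _ → 𝟙-mono (T ⊆? frag c S) (T ⊆? S) (λ T⊆ x∈ → fragment-⊆ (fam c) (class a c) S∈ (T⊆ x∈)))) ⟩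
        # (T ⊆?_) (fam c) ∎)) (spread c T)
        where open ≤-Reasoning

      parent′ : ∀ c {T} → T ∈ fam′ c → ∃ λ g → g ∈ G × (∀ x → x ∈ˢ g → x ∈ˢ T ⊎ lookup c x ∈ a ∷ U)
      parent′ c {T} T∈ =
        let (S , S∈ , T≡) = from c T∈
            -- The ancestor is that of the minimiser, not of `S`: it is the minimiser that differs
            -- from the fragment only inside class `a`.
            (g , g∈ , h) = parent c (minimiser-∈ (fam c) (class a c) S∈)
        in g , g∈ , λ x x∈ → [ (λ x∈m → split x (minimiser (fam c) (class a c) S) T≡ x∈m) , (λ u∈ → inj₂ (there u∈)) ]′ (h x x∈)
        where
        split : ∀ x M → T ≡ M ─ class a c → x ∈ˢ M → x ∈ˢ T ⊎ lookup c x ∈ a ∷ U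
        split x M T≡ x∈M = [ (λ x∈W → inj₂ (here (class⁻ a c x∈W)))
                           , (λ x∉W → inj₁ (subst (x ∈ˢ_) (sym T≡) (x∈p∧x∉q⇒x∈p─q x∈M x∉W))) ]′ (toSum (x ∈ˢ? class a c))

      loss′ : length Ω * length G * z ≤ ∑ Ω (length ∘ fam′) * z + suc i * (K * length Ω)
      loss′ = begin
        length Ω * length G * z
          ≤⟨ loss ⟩
        ∑ Ω (length ∘ fam) * z + i * (K * length Ω)
          ≡⟨ cong (λ w → w * z + i * (K * length Ω)) (trans (∑-cong Ω fam-length) (∑-+ Ω (length ∘ fam′) bad)) ⟩
        (∑ Ω (length ∘ fam′) + ∑ Ω bad) * z + i * (K * length Ω)
          ≡⟨ rearrange (∑ Ω (length ∘ fam′)) (∑ Ω bad) z (i * (K * length Ω)) ⟩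
        ∑ Ω (length ∘ fam′) * z + (∑ Ω bad * z + i * (K * length Ω))
          ≤⟨ +-monoʳ-≤ (∑ Ω (length ∘ fam′) * z) (+-monoˡ-≤ (i * (K * length Ω)) ∑bad) ⟩
        ∑ Ω (length ∘ fam′) * z + suc i * (K * length Ω) ∎
        where
        open ≤-Reasoning
        rearrange : ∀ p q r s → (p + q) * r + s ≡ p * r + (q * r + s)
        rearrange = solve-∀

    next : Stage G K R z (a ∷ U) j (suc i)
    next = record
      { fam       = fam′
      ; invariant = λ c c′ h → cong₂ (λ L W → filter small? (map (fragment L W) L))
                      (invariant c c′ (λ u u∈ → h u (there u∈))) (h a (here refl))
      ; avoids    = avoids′
      ; bounded   = λ c → ≤-trans (subst (length (fam′ c) ≤_) (sym (fam-length c)) (m≤m+n _ (bad c))) (bounded c)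
      ; small     = λ c T∈ → proj₂ (∈-filter⁻ small? {xs = map (frag c) (fam c)} T∈)
      ; spread    = spread′
      ; parent    = parent′
      ; loss      = loss′
      }

-- Playing all rounds

module _ {Col : Set} (_≟_ : DecidableEquality Col) (cols : List Col) (e : ℕ) where
  open Fragments _≟_ cols e

  -- Every colour of `cs` serves for one round and each round halves the size bound. At the end all
  -- sets have fewer than `2 ^ 0` elements, so they are empty and their ancestors lie within the
  -- revealed colours.
  run : ∀ {G K z} → 0 < z → (cs : List Col) (U : List Col) (i : ℕ) →
    (∀ {a} → a ∈ cs → a ∈ cols) → Unique cs → (∀ {a} → a ∈ cs → ¬ a ∈ U) →
    Stage G K (4 * length cols * z) z U (length cs) i →
    ∃ λ U′ → (∀ {u} → u ∈ U′ → u ∈ cs ⊎ u ∈ U) × Stage G K (4 * length cols * z) z U′ 0 (length cs + i)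
  run z>0 []       U i sub u new st = U , inj₂ , st
  run z>0 (a ∷ cs) U i sub (a∉ ∷ u) new st
    with run z>0 cs (a ∷ U) (suc i) (sub ∘ there) u
           (λ { b∈ (here refl) → All.lookup a∉ b∈ refl ; b∈ (there b∈U) → new (there b∈) b∈U })
           (Round.next z>0 st (sub (here refl)) (new (here refl)))
  ... | U′ , within , st′ = U′ , classify ∘ within
      , subst (Stage _ _ _ _ U′ 0) (+-suc (length cs) i) st′
    where
    classify : ∀ {u} → u ∈ cs ⊎ u ∈ a ∷ U → u ∈ a ∷ cs ⊎ u ∈ U
    classify (inj₁ u∈)          = inj₁ (there u∈)
    classify (inj₂ (here refl)) = inj₁ (here refl)
    classify (inj₂ (there u∈))  = inj₂ u∈

  start : ∀ G K R z j → (∀ {S} → S ∈ G → ∣ S ∣ < 2 ^ j) →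
    (∀ T → # (T ⊆?_) G * R ^ ∣ T ∣ ≤ K) → Stage G K R z [] j 0
  start G K R z j sm sp = record
    { fam       = λ _ → G
    ; invariant = λ _ _ _ → refl
    ; avoids    = λ _ _ ()
    ; bounded   = λ _ → ≤-refl
    ; small     = λ _ → sm
    ; spread    = λ _ → sp
    ; parent    = λ _ {S} S∈ → S , S∈ , λ _ → inj₁
    ; loss      = ≤-reflexive (sym (trans (+-identityʳ _) (cong (_* z) (∑-const Ω (length G)))))
    }

  -- With z = 8 J a colouring chosen uniformly at random leaves a member of the
  -- family inside the J given colour classes with probability at least 3/4.
  module Final {G : List (Subset e)} {K J : ℕ} {U : List Col} (J>0 : 0 < J)
    (G>0 : 0 < length G) (K≤2G : K ≤ 2 * length G)
    (st : Stage G K (4 * length cols * (8 * J)) (8 * J) U 0 (J + 0)) where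

    open Stage st

    alive? : Decidable (λ c → 1 ≤ length (fam c))
    alive? c = 1 ≤? length (fam c)

    -- Markov's inequality: `J` rounds lose at most `J * K / (8 * J)`, hence at most a quarter of
    -- `length G`, on average, and a colouring that is not alive has lost all of `G`.
    alive-majority : 3 * length Ω ≤ 4 * # alive? Ω
    alive-majority = +-cancelʳ-≤ (length Ω) _ _ (*-cancelˡ-≤ (2 * J * length G)
      {{>-nonZero (*-mono-≤ (*-mono-≤ (s≤s (z≤n {1})) J>0) G>0)}} (begin
      2 * J * length G * (3 * length Ω + length Ω)
        ≡⟨ r₁ J (length G) (length Ω) ⟩
      length Ω * length G * (8 * J)
        ≤⟨ loss ⟩
      ∑ Ω (length ∘ fam) * (8 * J) + (J + 0) * (K * length Ω)
        ≤⟨ +-mono-≤ (*-monoˡ-≤ (8 * J) (∑-mono Ω (λ c _ → fam≤ c))) (*-monoʳ-≤ (J + 0) (*-monoˡ-≤ (length Ω) K≤2G)) ⟩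
      ∑ Ω (λ c → 𝟙 (alive? c) * length G) * (8 * J) + (J + 0) * (2 * length G * length Ω)
        ≡⟨ cong (λ w → w * (8 * J) + (J + 0) * (2 * length G * length Ω)) (sym (∑-*ʳ Ω _ (length G))) ⟩
      # alive? Ω * length G * (8 * J) + (J + 0) * (2 * length G * length Ω)
        ≡⟨ r₂ J (length G) (length Ω) (# alive? Ω) ⟩
      2 * J * length G * (4 * # alive? Ω + length Ω) ∎))
      where
      open ≤-Reasoning
      r₁ : ∀ j g w → 2 * j * g * (3 * w + w) ≡ w * g * (8 * j)
      r₁ = solve-∀
      r₂ : ∀ j g w a → a * g * (8 * j) + (j + 0) * (2 * g * w) ≡ 2 * j * g * (4 * a + w)
      r₂ = solve-∀
      fam≤ : ∀ c → length (fam c) ≤ 𝟙 (alive? c) * length G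
      fam≤ c with length (fam c) in eq
      ... | zero  = z≤n
      ... | suc l = subst (suc l ≤_) (sym (*-identityˡ _)) (subst (_≤ length G) eq (bounded c))

    survivor : ∀ c → 1 ≤ length (fam c) → ∃ λ g → g ∈ G × (∀ x → x ∈ˢ g → lookup c x ∈ U)
    survivor c ne with fam c in eq
    ... | S ∷ L with parent c (subst (S ∈_) (sym eq) (here refl)) | small c (subst (S ∈_) (sym eq) (here refl))
    ...   | g , g∈ , h | ∣S∣<1 = g , g∈ , λ x x∈ → [ (λ x∈S → ⊥-elim (empty x∈S)) , id ]′ (h x x∈)
      where
      empty : ∀ {x} → ¬ x ∈ˢ S
      empty {x} x∈S = <-irrefl refl (<-≤-trans ∣S∣<1 (subst (_≤ ∣ S ∣) (∣⁅x⁆∣≡1 x)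
        (p⊆q⇒∣p∣≤∣q∣ (λ y∈ → subst (_∈ˢ S) (sym (x∈⁅y⁆⇒x≡y x y∈)) x∈S))))

-- Disjoint members of two spread families

m*n>0⇒m>0 : ∀ m {n} → 0 < m * n → 0 < m
m*n>0⇒m>0 (suc m) _ = z<s

-- This is `4 * length cols * z` for `J + J` colours and `z = 8 * J`.
spreadness : ℕ → ℕ
spreadness J = 4 * (J + J) * (8 * J)

Disjoint : ∀ {e} → Subset e → Subset e → Set
Disjoint p q = ∀ x → x ∈ˢ p → x ∉ˢ q

module TwoSided (e J : ℕ) (J>0 : 0 < J) (e<2^J : e < 2 ^ J) where
  private
    Col : Set
    Col = Bool × Fin J

    _≟ᶜ_ : DecidableEquality Col
    _≟ᶜ_ = ×ₚ.≡-dec Boolₚ._≟_ Finₚ._≟_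

    side : Bool → List Col
    side b = map (b ,_) (allFin J)

    cols : List Col
    cols = side true ++ side false

    length-side : ∀ b → length (side b) ≡ J
    length-side b = trans (length-map (b ,_) (allFin J)) (length-tabulate id)

    ∈-side : ∀ b i → (b , i) ∈ side b
    ∈-side b i = ∈-map⁺ (b ,_) (∈-allFin i)

    ∈-cols : ∀ a → a ∈ cols
    ∈-cols (true  , i) = ∈-++⁺ˡ (∈-side true i)
    ∈-cols (false , i) = ∈-++⁺ʳ (side true) (∈-side false i)

    open Fragments _≟ᶜ_ cols e

    finish : ∀ b G K → (∀ T → # (T ⊆?_) G * spreadness J ^ ∣ T ∣ ≤ K) →
      ∃ λ U → (∀ {u} → u ∈ U → proj₁ u ≡ b) × Stage G K (4 * length cols * (8 * J)) (8 * J) U 0 (J + 0)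
    finish b G K sp with run _≟ᶜ_ cols e (*-mono-≤ (s≤s (z≤n {7})) J>0) (side b) [] 0 (λ {a} _ → ∈-cols a)
        (Uniqueₚ.map⁺ (cong proj₂) (Uniqueₚ.allFin⁺ J)) (λ _ ())
        (start _≟ᶜ_ cols e G K _ (8 * J) (length (side b))
          (λ {S} _ → ≤-<-trans (∣p∣≤n S) (subst (λ j → e < 2 ^ j) (sym (length-side b)) e<2^J))
          (λ T → subst (λ C → # (T ⊆?_) G * (4 * C * (8 * J)) ^ ∣ T ∣ ≤ K)
            (sym (trans (length-++ (side true)) (cong₂ _+_ (length-side true) (length-side false)))) (sp T)))
    ... | U , within , st = U , tag ∘ within , subst (λ j → Stage G K _ _ U 0 (j + 0)) (length-side b) st
      where
      tag : ∀ {u} → u ∈ side b ⊎ u ∈ [] → proj₁ u ≡ b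
      tag (inj₁ u∈) with ∈-map⁻ (b ,_) u∈
      ... | _ , _ , refl = refl

    Ω>0 : 0 < length Ω
    Ω>0 = nonempty (∈-allVecs ∈-cols (Vec.replicate e (true , fromℕ< J>0)))
      where
      nonempty : ∀ {A : Set} {x : A} {xs} → x ∈ xs → 0 < length xs
      nonempty (here _)  = z<s
      nonempty (there _) = z<s

  -- One colouring serves both families. Each of the two events holds for at least 3/4 of all
  -- colourings, so they occur together, and then the two members use colours of opposite sides.
  disjoint-members : ∀ {G H K K′} → 0 < length G → 0 < length H → K ≤ 2 * length G → K′ ≤ 2 * length H →
    (∀ T → # (T ⊆?_) G * spreadness J ^ ∣ T ∣ ≤ K) → (∀ T → # (T ⊆?_) H * spreadness J ^ ∣ T ∣ ≤ K′) →
    ∃ λ g → ∃ λ h → g ∈ G × h ∈ H × Disjoint g h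
  disjoint-members {G} {H} {K} {K′} G>0 H>0 K≤ K′≤ spG spH with finish true G K spG | finish false H K′ spH
  ... | U , U-true , st | U′ , U-false , st′ = conclude (∑-pos Ω _ both>0)
    where
    module FG = Final _≟ᶜ_ cols e J>0 G>0 K≤ st
    module FH = Final _≟ᶜ_ cols e J>0 H>0 K′≤ st′

    both : Vec Col e → ℕ
    both c = 𝟙 (FG.alive? c) * 𝟙 (FH.alive? c)

    bonferroni : ∀ {P Q : Set} (d : Dec P) (d′ : Dec Q) → 𝟙 d + 𝟙 d′ ≤ 1 + 𝟙 d * 𝟙 d′
    bonferroni (yes _) (yes _) = s≤s (s≤s z≤n)
    bonferroni (yes _) (no _)  = s≤s z≤n
    bonferroni (no _)  (yes _) = s≤s z≤n
    bonferroni (no _)  (no _)  = z≤n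

    sum≤ : # FG.alive? Ω + # FH.alive? Ω ≤ length Ω + ∑ Ω both
    sum≤ = begin
      # FG.alive? Ω + # FH.alive? Ω                      ≡⟨ ∑-+ Ω _ _ ⟨
      ∑ Ω (λ c → 𝟙 (FG.alive? c) + 𝟙 (FH.alive? c))     ≤⟨ ∑-mono Ω (λ c _ → bonferroni (FG.alive? c) (FH.alive? c)) ⟩
      ∑ Ω (λ c → 1 + both c)                             ≡⟨ ∑-+ Ω (λ _ → 1) both ⟩
      ∑ Ω (λ _ → 1) + ∑ Ω both                           ≡⟨ cong (_+ ∑ Ω both) (length≡∑ Ω) ⟨
      length Ω + ∑ Ω both                                ∎
      where open ≤-Reasoning

    both>0 : 0 < ∑ Ω both
    both>0 with ∑ Ω both | sum≤
    ... | suc _ | _ = z<s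
    ... | zero  | le = ⊥-elim (<-irrefl refl (begin-strict
      4 * length Ω                               <⟨ m<m+n (4 * length Ω) (*-mono-≤ (s≤s (z≤n {1})) Ω>0) ⟩
      4 * length Ω + 2 * length Ω                ≡⟨ r (length Ω) ⟩
      3 * length Ω + 3 * length Ω                ≤⟨ +-mono-≤ FG.alive-majority FH.alive-majority ⟩
      4 * # FG.alive? Ω + 4 * # FH.alive? Ω      ≡⟨ *-distribˡ-+ 4 (# FG.alive? Ω) (# FH.alive? Ω) ⟨
      4 * (# FG.alive? Ω + # FH.alive? Ω)        ≤⟨ *-monoʳ-≤ 4 le ⟩
      4 * (length Ω + 0)                         ≡⟨ cong (4 *_) (+-identityʳ (length Ω)) ⟩
      4 * length Ω                               ∎))
      where
      open ≤-Reasoning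
      r : ∀ w → 4 * w + 2 * w ≡ 3 * w + 3 * w
      r = solve-∀

    conclude : (∃ λ c → c ∈ Ω × 0 < both c) → ∃ λ g → ∃ λ h → g ∈ G × h ∈ H × Disjoint g h
    conclude (c , _ , pos)
      with FG.survivor c (𝟙-pos (FG.alive? c) (m*n>0⇒m>0 (𝟙 (FG.alive? c)) pos))
         | FH.survivor c (𝟙-pos (FH.alive? c) (m*n>0⇒m>0 (𝟙 (FH.alive? c)) (subst (0 <_) (*-comm (𝟙 (FG.alive? c)) (𝟙 (FH.alive? c))) pos)))
    ... | g , g∈ , g⊆ | h , h∈ , h⊆ = g , h , g∈ , h∈ , λ x x∈g x∈h →
      true≢false (trans (sym (U-true (g⊆ x x∈g))) (U-false (h⊆ x x∈h)))
      where
      true≢false : true ≢ false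
      true≢false ()

-- Cores of a family

∑-allFin : ∀ n (f : Fin (suc n) → ℕ) → ∑ (allFin (suc n)) f ≡ f Fin.zero + ∑ (allFin n) (f ∘ Fin.suc)
∑-allFin n f = cong (f Fin.zero +_) (trans (cong (λ l → ∑ l f) (sym (map-tabulate id Fin.suc))) (∑-map Fin.suc (allFin n) f))

∣∣≡# : ∀ {n} (p : Subset n) → ∣ p ∣ ≡ # (_∈ˢ? p) (allFin n)
∣∣≡# [] = refl
∣∣≡# {suc n} (true ∷ p)  = trans (cong suc (∣∣≡# p)) (sym (∑-allFin n (λ x → 𝟙 (x ∈ˢ? (true ∷ p)))))
∣∣≡# {suc n} (false ∷ p) = trans (∣∣≡# p) (sym (∑-allFin n (λ x → 𝟙 (x ∈ˢ? (false ∷ p)))))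

disjoint-∪ : ∀ {n} (p q : Subset n) → Disjoint p q → ∣ p ∣ + ∣ q ∣ ≤ ∣ p ∪ q ∣
disjoint-∪ [] [] d = z≤n
disjoint-∪ (true ∷ p)  (true ∷ q)  d = contradiction here (d Fin.zero here)
disjoint-∪ (true ∷ p)  (false ∷ q) d = s≤s (disjoint-∪ p q (λ x a b → d (Fin.suc x) (there a) (there b)))
disjoint-∪ (false ∷ p) (true ∷ q)  d = subst (_≤ suc ∣ p ∪ q ∣) (sym (+-suc ∣ p ∣ ∣ q ∣))
  (s≤s (disjoint-∪ p q (λ x a b → d (Fin.suc x) (there a) (there b))))
disjoint-∪ (false ∷ p) (false ∷ q) d = disjoint-∪ p q (λ x a b → d (Fin.suc x) (there a) (there b))

Meets : ∀ {e} → Subset e → Subset e → Set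
Meets p q = ∃ λ x → x ∈ˢ p × x ∈ˢ q

meets? : ∀ {e} (p q : Subset e) → Dec (Meets p q)
meets? p q with nonempty? (p ∩ q)
... | yes (x , x∈) = yes (x , x∈p∩q⁻ p q x∈)
... | no ¬ne = no λ (x , x∈) → ¬ne (x , x∈p∩q⁺ x∈)

deg : ∀ {e} → List (Subset e) → Subset e → ℕ
deg F T = # (T ⊆?_) F

deg-∅ : ∀ {e} (F : List (Subset e)) → deg F ∅ ≡ length F
deg-∅ F = trans (∑-cong F (λ S → 𝟙-yes (∅ ⊆? S) ⊥⊆)) (sym (length≡∑ F))

IsCore : ∀ {e} → ℕ → List (Subset e) → Subset e → Set
IsCore R F S = ∀ T → deg F T * R ^ ∣ T ∣ ≤ deg F S * R ^ ∣ S ∣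

core-exists : ∀ {e} R (F : List (Subset e)) → ∃ (IsCore R F)
core-exists {e} R F = argmax (λ T → deg F T * R ^ ∣ T ∣) ∅ (subsets e) ,
  λ T → All.lookup (f[xs]≤f[argmax] {f = λ T → deg F T * R ^ ∣ T ∣} ∅ (subsets e)) (∈-subsets T)

module _ {e R : ℕ} {F : List (Subset e)} {S : Subset e} (core : IsCore R F S) where

  core-weight : length F ≤ deg F S * R ^ ∣ S ∣
  core-weight = begin
    length F                          ≡⟨ deg-∅ F ⟨
    deg F ∅                           ≡⟨ *-identityʳ _ ⟨
    deg F ∅ * R ^ 0                   ≡⟨ cong (λ m → deg F ∅ * R ^ m) (∣⊥∣≡0 e) ⟨
    deg F ∅ * R ^ ∣ ∅ {e} ∣           ≤⟨ core ∅ ⟩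
    deg F S * R ^ ∣ S ∣               ∎
    where open ≤-Reasoning

  core-pos : 0 < length F → 0 < deg F S
  core-pos F>0 = m*n>0⇒m>0 (deg F S) (<-≤-trans F>0 core-weight)

  -- Maximality of `S` tested at `S ∪ T`, with `R ^ ∣ S ∣` cancelled: around its core the family is
  -- `R`-spread.
  core-extend : 0 < R → ∀ T → Disjoint S T → deg F (S ∪ T) * R ^ ∣ T ∣ ≤ deg F S
  core-extend R>0 T d = *-cancelʳ-≤ _ _ (R ^ ∣ S ∣) {{m^n≢0 R ∣ S ∣ {{>-nonZero R>0}}}} (begin
    deg F (S ∪ T) * R ^ ∣ T ∣ * R ^ ∣ S ∣      ≡⟨ *-assoc (deg F (S ∪ T)) _ _ ⟩
    deg F (S ∪ T) * (R ^ ∣ T ∣ * R ^ ∣ S ∣)    ≡⟨ cong (deg F (S ∪ T) *_) (*-comm (R ^ ∣ T ∣) (R ^ ∣ S ∣)) ⟩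
    deg F (S ∪ T) * (R ^ ∣ S ∣ * R ^ ∣ T ∣)    ≡⟨ cong (deg F (S ∪ T) *_) (^-distribˡ-+-* R ∣ S ∣ ∣ T ∣) ⟨
    deg F (S ∪ T) * R ^ (∣ S ∣ + ∣ T ∣)        ≤⟨ *-monoʳ-≤ (deg F (S ∪ T)) (^-monoʳ-≤ R {{>-nonZero R>0}} (disjoint-∪ S T d)) ⟩
    deg F (S ∪ T) * R ^ ∣ S ∪ T ∣              ≤⟨ core (S ∪ T) ⟩
    deg F S * R ^ ∣ S ∣                        ∎)
    where open ≤-Reasoning

  -- Disjoint remainders `g ─ S` and `h ─ S′` make `g` and `h` disjoint only if `g` avoids `S′` and
  -- `h` avoids `S`. Hence members meeting `Q`, the core of the other family, are removed first.
  module Link (R>0 : 0 < R) (Q : Subset e) (S∩Q : Disjoint S Q) (2Q≤R : 2 * ∣ Q ∣ ≤ R) where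

    good? : Decidable (λ g → S ⊆ g × ¬ Meets g Q)
    good? g = (S ⊆? g) ×-dec ¬? (meets? g Q)

    link : List (Subset e)
    link = map (_─ S) (filter good? F)

    length-link : length link ≡ # good? F
    length-link = trans (length-map (_─ S) (filter good? F)) (length-filter good? F)

    link-∈ : ∀ {g′} → g′ ∈ link → ∃ λ g → g ∈ F × S ⊆ g × ¬ Meets g Q × g′ ≡ g ─ S
    link-∈ g′∈ with ∈-map⁻ (_─ S) g′∈
    ... | g , g∈ , eq with ∈-filter⁻ good? {xs = F} g∈
    ...   | g∈F , S⊆g , ¬m = g , g∈F , S⊆g , ¬m , eq

    link-spread : ∀ T → deg link T * R ^ ∣ T ∣ ≤ deg F S
    link-spread T with meets? S T
    ... | no ¬m = ≤-trans (*-monoˡ-≤ (R ^ ∣ T ∣) (begin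
        deg link T
          ≡⟨ trans (∑-map (_─ S) (filter good? F) _) (#-filter good? (λ g → T ⊆? (g ─ S)) F) ⟩
        ∑ F (λ g → 𝟙 (good? g) * 𝟙 (T ⊆? (g ─ S)))
          ≤⟨ ∑-mono F (λ g _ → 𝟙*≤ (good? g) _ (λ (S⊆g , _) → 𝟙-mono (T ⊆? (g ─ S)) ((S ∪ T) ⊆? g)
               (λ T⊆ x∈ → [ S⊆g , (λ x∈T → p─q⊆p g S (T⊆ x∈T)) ]′ (x∈p∪q⁻ S T x∈)))) ⟩
        deg F (S ∪ T) ∎))
      (core-extend R>0 T (λ x x∈S x∈T → ¬m (x , x∈S , x∈T)))
      where open ≤-Reasoning
    ... | yes (x , x∈S , x∈T) = ≤-trans (≤-reflexive (cong (_* R ^ ∣ T ∣) (n≤0⇒n≡0 (begin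
        deg link T
          ≡⟨ ∑-map (_─ S) (filter good? F) _ ⟩
        ∑ (filter good? F) (λ g → 𝟙 (T ⊆? (g ─ S)))
          ≤⟨ ∑-mono (filter good? F) (λ g _ → ≤-reflexive (𝟙-no (T ⊆? (g ─ S)) (λ T⊆ → ∉-─ g S (T⊆ x∈T) x∈S))) ⟩
        ∑ (filter good? F) (λ _ → 0)
          ≡⟨ ∑-zero (filter good? F) ⟩
        0 ∎)))) z≤n
      where open ≤-Reasoning

    private
      escape : ∀ g → 𝟙 (S ⊆? g) ≤ 𝟙 (good? g) + ∑ (allFin e) (λ x → 𝟙 (x ∈ˢ? Q) * 𝟙 ((S ∪ ⁅ x ⁆) ⊆? g))
      escape g = 𝟙-≤ (S ⊆? g) (λ S⊆g → cases S⊆g (meets? g Q))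
        where
        cases : S ⊆ g → Dec (Meets g Q) → 1 ≤ 𝟙 (good? g) + ∑ (allFin e) (λ x → 𝟙 (x ∈ˢ? Q) * 𝟙 ((S ∪ ⁅ x ⁆) ⊆? g))
        cases S⊆g (no ¬m) = ≤-trans (≤-reflexive (sym (𝟙-yes (good? g) ((λ {y} → S⊆g {y}) , ¬m)))) (m≤m+n _ _)
        cases S⊆g (yes (x , x∈g , x∈Q)) = ≤-trans (≤-trans
          (≤-reflexive (sym (cong₂ _*_ (𝟙-yes (x ∈ˢ? Q) x∈Q) (𝟙-yes ((S ∪ ⁅ x ⁆) ⊆? g)
            (λ y∈ → [ S⊆g , (λ y∈x → subst (_∈ˢ g) (sym (x∈⁅y⁆⇒x≡y x y∈x)) x∈g) ]′ (x∈p∪q⁻ S ⁅ x ⁆ y∈))))))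
          (∑-term (λ x → 𝟙 (x ∈ˢ? Q) * 𝟙 ((S ∪ ⁅ x ⁆) ⊆? g)) (∈-allFin x))) (m≤n+m _ _)

      removed : ℕ
      removed = ∑ (allFin e) (λ x → 𝟙 (x ∈ˢ? Q) * deg F (S ∪ ⁅ x ⁆))

      deg≤ : deg F S ≤ length link + removed
      deg≤ = begin
        deg F S
          ≤⟨ ∑-mono F (λ g _ → escape g) ⟩
        ∑ F (λ g → 𝟙 (good? g) + ∑ (allFin e) (λ x → 𝟙 (x ∈ˢ? Q) * 𝟙 ((S ∪ ⁅ x ⁆) ⊆? g)))
          ≡⟨ ∑-+ F _ _ ⟩
        # good? F + ∑ F (λ g → ∑ (allFin e) (λ x → 𝟙 (x ∈ˢ? Q) * 𝟙 ((S ∪ ⁅ x ⁆) ⊆? g)))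
          ≡⟨ cong₂ _+_ (sym length-link) (trans (∑-swap F (allFin e) _) (∑-cong (allFin e) (λ x → sym (∑-*ˡ (𝟙 (x ∈ˢ? Q)) F _)))) ⟩
        length link + removed ∎
        where open ≤-Reasoning

      removed*R : removed * R ≤ ∣ Q ∣ * deg F S
      removed*R = begin
        removed * R
          ≡⟨ ∑-*ʳ (allFin e) _ R ⟩
        ∑ (allFin e) (λ x → 𝟙 (x ∈ˢ? Q) * deg F (S ∪ ⁅ x ⁆) * R)
          ≤⟨ ∑-mono (allFin e) (λ x _ → term x (x ∈ˢ? Q)) ⟩
        ∑ (allFin e) (λ x → 𝟙 (x ∈ˢ? Q) * deg F S)
          ≡⟨ ∑-*ʳ (allFin e) _ (deg F S) ⟨
        # (_∈ˢ? Q) (allFin e) * deg F S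
          ≡⟨ cong (_* deg F S) (∣∣≡# Q) ⟨
        ∣ Q ∣ * deg F S ∎
        where
        open ≤-Reasoning
        term : ∀ x (d : Dec (x ∈ˢ Q)) → 𝟙 d * deg F (S ∪ ⁅ x ⁆) * R ≤ 𝟙 d * deg F S
        term x (no _) = z≤n
        term x (yes x∈Q) = begin
          1 * deg F (S ∪ ⁅ x ⁆) * R          ≡⟨ cong₂ _*_ (*-identityˡ (deg F (S ∪ ⁅ x ⁆))) (sym (trans (cong (R ^_) (∣⁅x⁆∣≡1 x)) (^-identityʳ R))) ⟩
          deg F (S ∪ ⁅ x ⁆) * R ^ ∣ ⁅ x ⁆ ∣  ≤⟨ core-extend R>0 ⁅ x ⁆ (λ y y∈S y∈x → S∩Q y y∈S (subst (_∈ˢ Q) (sym (x∈⁅y⁆⇒x≡y x y∈x)) x∈Q)) ⟩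
          deg F S                            ≡⟨ *-identityˡ _ ⟨
          1 * deg F S                        ∎

    -- By `core-extend`, a given element of `Q` lies in at most one `R`-th of the members containing
    -- `S`; since `2 * ∣ Q ∣ ≤ R`, at most half of them are removed.
    link-large : deg F S ≤ 2 * length link
    link-large = *-cancelʳ-≤ _ _ R {{>-nonZero R>0}} (+-cancelʳ-≤ (deg F S * R) _ _ (begin
      deg F S * R + deg F S * R              ≡⟨ r₁ (deg F S) R ⟩
      2 * (deg F S * R)                      ≤⟨ *-monoʳ-≤ 2 (*-monoˡ-≤ R deg≤) ⟩
      2 * ((length link + removed) * R)      ≡⟨ r₂ (length link) removed R ⟩
      2 * length link * R + 2 * (removed * R) ≤⟨ +-monoʳ-≤ (2 * length link * R) (*-monoʳ-≤ 2 removed*R) ⟩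
      2 * length link * R + 2 * (∣ Q ∣ * deg F S) ≡⟨ cong (2 * length link * R +_) (r₃ ∣ Q ∣ (deg F S)) ⟩
      2 * length link * R + deg F S * (2 * ∣ Q ∣) ≤⟨ +-monoʳ-≤ (2 * length link * R) (*-monoʳ-≤ (deg F S) 2Q≤R) ⟩
      2 * length link * R + deg F S * R      ∎))
      where
      open ≤-Reasoning
      r₁ : ∀ a b → a * b + a * b ≡ 2 * (a * b)
      r₁ = solve-∀
      r₂ : ∀ a b c → 2 * ((a + b) * c) ≡ 2 * a * c + 2 * (b * c)
      r₂ = solve-∀
      r₃ : ∀ a b → 2 * (a * b) ≡ b * (2 * a)
      r₃ = solve-∀

    link-pos : 0 < length F → 0 < length link
    link-pos F>0 = m*n>0⇒m>0 (length link) (subst (0 <_) (*-comm 2 (length link)) (<-≤-trans (core-pos F>0) link-large))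

disjoint-cores : ∀ {e} J → 0 < J → e < 2 ^ J → {F F′ : List (Subset e)} {S S′ : Subset e} →
  0 < length F → 0 < length F′ → IsCore (spreadness J) F S → IsCore (spreadness J) F′ S′ →
  2 * ∣ S ∣ ≤ spreadness J → 2 * ∣ S′ ∣ ≤ spreadness J → Disjoint S S′ →
  ∃ λ g → ∃ λ h → g ∈ F × h ∈ F′ × Disjoint g h
disjoint-cores {e} J J>0 e<2^J {F} {F′} {S} {S′} F>0 F′>0 core core′ small small′ d =
  lift (TwoSided.disjoint-members e J J>0 e<2^J (L.link-pos F>0) (L′.link-pos F′>0)
    L.link-large L′.link-large L.link-spread L′.link-spread)
  where
  R>0 : 0 < spreadness J
  R>0 = *-mono-≤ (*-mono-≤ (s≤s (z≤n {3})) (≤-trans J>0 (m≤m+n J J))) (*-mono-≤ (s≤s (z≤n {7})) J>0)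
  module L  = Link {R = spreadness J} {F} {S} core R>0 S′ d small′
  module L′ = Link {R = spreadness J} {F′} {S′} core′ R>0 S (λ x x∈S′ x∈S → d x x∈S x∈S′) small

  lift : (∃ λ g → ∃ λ h → g ∈ L.link × h ∈ L′.link × Disjoint g h) → ∃ λ g → ∃ λ h → g ∈ F × h ∈ F′ × Disjoint g h
  lift (g₀ , h₀ , g₀∈ , h₀∈ , dis) = undo-links (L.link-∈ g₀∈) (L′.link-∈ h₀∈)
    where
    undo-links : (∃ λ g → g ∈ F × S ⊆ g × ¬ Meets g S′ × g₀ ≡ g ─ S) → (∃ λ h → h ∈ F′ × S′ ⊆ h × ¬ Meets h S × h₀ ≡ h ─ S′) →
      ∃ λ g → ∃ λ h → g ∈ F × h ∈ F′ × Disjoint g h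
    undo-links (g , g∈ , _ , ¬gS′ , g₀≡) (h , h∈ , _ , ¬hS , h₀≡) = g , h , g∈ , h∈ , λ x x∈g x∈h →
      dis x (subst (x ∈ˢ_) (sym g₀≡) (x∈p∧x∉q⇒x∈p─q x∈g (λ x∈S → ¬hS (x , x∈h , x∈S))))
            (subst (x ∈ˢ_) (sym h₀≡) (x∈p∧x∉q⇒x∈p─q x∈h (λ x∈S′ → ¬gS′ (x , x∈g , x∈S′))))

-- Perfect matchings and transpositions

-- An involution maps `xs` injectively into itself, which gives one inequality for every `f`; the
-- reverse one is the same inequality for `f ∘ φ`.
∑-involution : {A : Set} {xs : List A} (φ : A → A) → Unique xs → (∀ x → φ (φ x) ≡ x) →
  (∀ {x} → x ∈ xs → φ x ∈ xs) → (f : A → ℕ) → ∑ xs (f ∘ φ) ≡ ∑ xs f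
∑-involution {xs = xs} φ u inv closed f = ≤-antisym (half f)
  (≤-trans (≤-reflexive (∑-cong xs (λ x → cong f (sym (inv x))))) (half (f ∘ φ)))
  where
  half : ∀ f → ∑ xs (f ∘ φ) ≤ ∑ xs f
  half f = subst (_≤ ∑ xs f) (∑-map φ xs f) (∑-⊆ xs f
    (Uniqueₚ.map⁺ (λ {x} {y} eq → trans (sym (inv x)) (trans (cong φ eq) (inv y))) u)
    (λ y∈ → let (x , x∈ , eq) = ∈-map⁻ φ y∈ in subst (_∈ xs) (sym eq) (closed x∈)))

length-mono-⊆ : {A : Set} {xs : List A} (ys : List A) → Unique xs → (∀ {x} → x ∈ xs → x ∈ ys) → length xs ≤ length ys
length-mono-⊆ {xs = xs} ys u sub = subst₂ _≤_ (sym (length≡∑ xs)) (sym (length≡∑ ys)) (∑-⊆ ys (λ _ → 1) u sub)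

module _ {V : ℕ} where
  open DecMembership (Finₚ._≟_ {V}) public using (_∈?_)

  #∈≤length : ∀ L → # (_∈? L) (allFin V) ≤ length L
  #∈≤length L = subst (_≤ length L) (length-filter (_∈? L) (allFin V))
    (length-mono-⊆ L (Uniqueₚ.filter⁺ (_∈? L) (Uniqueₚ.allFin⁺ V)) (proj₂ ∘ ∈-filter⁻ (_∈? L) {xs = allFin V}))

  swap : Fin V → Fin V → Fin V → Fin V
  swap u v i = if does (i Finₚ.≟ u) then v else if does (i Finₚ.≟ v) then u else i

  swap-fst : ∀ u v → swap u v u ≡ v
  swap-fst u v with u Finₚ.≟ u
  ... | yes _ = refl
  ... | no u≢u = ⊥-elim (u≢u refl)

  swap-snd : ∀ u v → swap u v v ≡ u
  swap-snd u v with v Finₚ.≟ u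
  ... | yes v≡u = v≡u
  ... | no _ with v Finₚ.≟ v
  ...   | yes _ = refl
  ...   | no v≢v = ⊥-elim (v≢v refl)

  swap-other : ∀ u v {i} → i ≢ u → i ≢ v → swap u v i ≡ i
  swap-other u v {i} i≢u i≢v with i Finₚ.≟ u
  ... | yes i≡u = ⊥-elim (i≢u i≡u)
  ... | no _ with i Finₚ.≟ v
  ...   | yes i≡v = ⊥-elim (i≢v i≡v)
  ...   | no _ = refl

  swap-involutive : ∀ u v i → swap u v (swap u v i) ≡ i
  swap-involutive u v i = cases (i Finₚ.≟ u) (i Finₚ.≟ v)
    where
    cases : Dec (i ≡ u) → Dec (i ≡ v) → swap u v (swap u v i) ≡ i
    cases (yes refl) _ = trans (cong (swap u v) (swap-fst u v)) (swap-snd u v)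
    cases (no _) (yes refl) = trans (cong (swap u v) (swap-snd u v)) (swap-fst u v)
    cases (no i≢u) (no i≢v) = trans (cong (swap u v) (swap-other u v i≢u i≢v)) (swap-other u v i≢u i≢v)

  entry : Rel V → Fin V → Fin V → Bool
  entry m i j = lookup (lookup m i) j

  rel? : ∀ m i j → Dec (i ∼[ m ] j)
  rel? m i j = entry m i j Boolₚ.≟ true

  act : Fin V → Fin V → Rel V → Rel V
  act u v m = Vec.tabulate λ i → Vec.tabulate λ j → entry m (swap u v i) (swap u v j)

  act-entry : ∀ u v m i j → entry (act u v m) i j ≡ entry m (swap u v i) (swap u v j)
  act-entry u v m i j = trans (cong (λ r → lookup r j) (Vecₚ.lookup∘tabulate _ i)) (Vecₚ.lookup∘tabulate _ j)

  Rel-ext : ∀ {m m′ : Rel V} → (∀ i j → entry m i j ≡ entry m′ i j) → m ≡ m′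
  Rel-ext {m} {m′} h = trans (sym (Vecₚ.tabulate∘lookup m)) (trans (Vecₚ.tabulate-cong (λ i →
    trans (sym (Vecₚ.tabulate∘lookup (lookup m i))) (trans (Vecₚ.tabulate-cong (h i)) (Vecₚ.tabulate∘lookup (lookup m′ i)))))
    (Vecₚ.tabulate∘lookup m′))

  act-involutive : ∀ u v m → act u v (act u v m) ≡ m
  act-involutive u v m = Rel-ext λ i j → trans (act-entry u v (act u v m) i j)
    (trans (act-entry u v m _ _) (cong₂ (entry m) (swap-involutive u v i) (swap-involutive u v j)))

  filterT≡# : ∀ {n} (r : Vec Bool n) → length (filter T? (Vec.toList r)) ≡ # (λ j → lookup r j Boolₚ.≟ true) (allFin n)
  filterT≡# [] = refl
  filterT≡# {suc n} (true ∷ r)  = trans (cong suc (filterT≡# r)) (sym (∑-allFin n (λ j → 𝟙 (lookup (true ∷ r) j Boolₚ.≟ true))))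
  filterT≡# {suc n} (false ∷ r) = trans (filterT≡# r) (sym (∑-allFin n (λ j → 𝟙 (lookup (false ∷ r) j Boolₚ.≟ true))))

  blockSize≡# : ∀ m i → blockSize m i ≡ # (rel? m i) (allFin V)
  blockSize≡# m i = filterT≡# (lookup m i)

module Matchings (k V : ℕ) where

  PM : Rel V → Set
  PM = IsPerfectMatching k V

  pm? : Decidable PM
  pm? m = map′ (λ (r , s , t , z) → record { refl∼ = r ; sym∼ = s ; trans∼ = t ; size∼ = z })
    (λ p → refl∼ p , sym∼ p , trans∼ p , size∼ p)
    (Finₚ.all? (λ i → rel? m i i)
      ×-dec (Finₚ.all? λ i → Finₚ.all? λ j → rel? m i j →-dec rel? m j i)
      ×-dec (Finₚ.all? λ i → Finₚ.all? λ j → Finₚ.all? λ l → rel? m i j →-dec (rel? m j l →-dec rel? m i l))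
      ×-dec (Finₚ.all? λ i → blockSize m i ≟ k))

  𝓐 : List (Rel V)
  𝓐 = filter pm? (allVecs (subsets V) V)

  ∈-𝓐⁺ : ∀ {m} → PM m → m ∈ 𝓐
  ∈-𝓐⁺ {m} p = ∈-filter⁺ pm? (∈-allVecs ∈-subsets m) p

  ∈-𝓐⁻ : ∀ {m} → m ∈ 𝓐 → PM m
  ∈-𝓐⁻ m∈ = proj₂ (∈-filter⁻ pm? {xs = allVecs (subsets V) V} m∈)

  𝓐-Unique : Unique 𝓐
  𝓐-Unique = Uniqueₚ.filter⁺ pm? (allVecs-Unique (allVecs-Unique (((λ ()) ∷ []) ∷ ([] ∷ [])) V) V)

  block : ∀ {m} → m ∈ 𝓐 → ∀ i → # (rel? m i) (allFin V) ≡ k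
  block {m} m∈ i = trans (sym (blockSize≡# m i)) (size∼ (∈-𝓐⁻ m∈) i)

  act-pm : ∀ u v {m} → PM m → PM (act u v m)
  act-pm u v {m} p = record
    { refl∼  = λ i → fold i i (refl∼ p (τ i))
    ; sym∼   = λ i j h → fold j i (sym∼ p (τ i) (τ j) (unfold i j h))
    ; trans∼ = λ i j l h h′ → fold i l (trans∼ p (τ i) (τ j) (τ l) (unfold i j h) (unfold j l h′))
    ; size∼  = λ i → trans (blockSize≡# (act u v m) i) (trans
        (∑-cong (allFin V) (λ j → cong (λ b → 𝟙 (b Boolₚ.≟ true)) (act-entry u v m i j)))
        (trans (∑-involution τ (Uniqueₚ.allFin⁺ V) (swap-involutive u v) (λ _ → ∈-allFin _) (λ j → 𝟙 (rel? m (τ i) j)))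
          (trans (sym (blockSize≡# m (τ i))) (size∼ p (τ i)))))
    }
    where
    τ : Fin V → Fin V
    τ = swap u v
    fold : ∀ i j → τ i ∼[ m ] τ j → i ∼[ act u v m ] j
    fold i j h = trans (act-entry u v m i j) h
    unfold : ∀ i j → i ∼[ act u v m ] j → τ i ∼[ m ] τ j
    unfold i j h = trans (sym (act-entry u v m i j)) h

  ∑-act : ∀ u v (f : Rel V → ℕ) → ∑ 𝓐 (f ∘ act u v) ≡ ∑ 𝓐 f
  ∑-act u v = ∑-involution (act u v) 𝓐-Unique (act-involutive u v) (λ m∈ → ∈-𝓐⁺ (act-pm u v (∈-𝓐⁻ m∈)))

  Pair : Set
  Pair = Fin V × Fin V

  Joins : Rel V → Pair → Set
  Joins m (i , j) = i ≢ j × i ∼[ m ] j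

  joins? : ∀ m p → Dec (Joins m p)
  joins? m (i , j) = ¬? (i Finₚ.≟ j) ×-dec rel? m i j

  Sat : List Pair → Rel V → Set
  Sat ps m = All (Joins m) ps

  sat? : ∀ ps → Decidable (Sat ps)
  sat? ps m = All.all? (joins? m) ps

  N : List Pair → ℕ
  N ps = # (sat? ps) 𝓐

  N-mono : ∀ ps qs → (∀ {m} → m ∈ 𝓐 → Sat ps m → Sat qs m) → N ps ≤ N qs
  N-mono ps qs h = #-mono (sat? ps) (sat? qs) 𝓐 (λ m m∈ → h m∈)

  support : List Pair → List (Fin V)
  support []             = []
  support ((i , j) ∷ ps) = i ∷ j ∷ support ps

  length-support : ∀ ps → length (support ps) ≡ 2 * length ps
  length-support []       = refl
  length-support (p ∷ ps) = trans (cong (suc ∘ suc) (length-support ps)) (r (length ps))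
    where
    r : ∀ l → suc (suc (2 * l)) ≡ 2 * suc l
    r = solve-∀

  -- The transposition of `y` and `y′` fixes `x` and the support of `T`, and it permutes `𝓐`.
  N-exchange : ∀ x y y′ T → ¬ y ∈ x ∷ support T → ¬ y′ ∈ x ∷ support T → N ((x , y) ∷ T) ≤ N ((x , y′) ∷ T)
  N-exchange x y y′ T y∉ y′∉ = begin
    N ((x , y) ∷ T)                                   ≤⟨ ∑-mono 𝓐 (λ m _ → 𝟙-mono (sat? ((x , y) ∷ T) m) (sat? ((x , y′) ∷ T) (act y y′ m)) (transport m)) ⟩
    ∑ 𝓐 (λ m → 𝟙 (sat? ((x , y′) ∷ T) (act y y′ m)))  ≡⟨ ∑-act y y′ (λ m → 𝟙 (sat? ((x , y′) ∷ T) m)) ⟩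
    N ((x , y′) ∷ T)                                  ∎
    where
    open ≤-Reasoning
    fixed : ∀ {i L} → ¬ y ∈ L → ¬ y′ ∈ L → i ∈ L → swap y y′ i ≡ i
    fixed y∉L y′∉L i∈ = swap-other y y′ (λ { refl → y∉L i∈ }) (λ { refl → y′∉L i∈ })
    transport-T : ∀ m S → ¬ y ∈ support S → ¬ y′ ∈ support S → Sat S m → Sat S (act y y′ m)
    transport-T m [] _ _ [] = []
    transport-T m ((i , j) ∷ S) n n′ ((i≢j , i∼j) ∷ s) =
      (i≢j , trans (act-entry y y′ m i j) (trans (cong₂ (entry m) (fixed n n′ (here refl)) (fixed n n′ (there (here refl)))) i∼j))
      ∷ transport-T m S (λ y∈ → n (there (there y∈))) (λ y∈ → n′ (there (there y∈))) s
    transport : ∀ m → Sat ((x , y) ∷ T) m → Sat ((x , y′) ∷ T) (act y y′ m)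
    transport m ((x≢y , x∼y) ∷ s) =
      ((λ x≡y′ → y′∉ (here (sym x≡y′))) , trans (act-entry y y′ m x y′) (trans (cong₂ (entry m) (fixed y∉ y′∉ (here refl)) (swap-snd y y′)) x∼y))
      ∷ transport-T m T (y∉ ∘ there) (y′∉ ∘ there) s

  -- Every vertex outside `x ∷ support T` is at least as frequent a partner of `x` as `y` is, by
  -- `N-exchange`, but a single matching has room for at most `k` of them in the block of `x`.
  N-extend : ∀ x y T → ¬ y ∈ x ∷ support T → N ((x , y) ∷ T) * (V ∸ suc (2 * length T)) ≤ k * N T
  N-extend x y T y∉ = begin
    N ((x , y) ∷ T) * (V ∸ suc (2 * length T))
      ≤⟨ *-monoʳ-≤ (N ((x , y) ∷ T)) free-count ⟩
    N ((x , y) ∷ T) * # free? (allFin V)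
      ≡⟨ ∑-*ˡ (N ((x , y) ∷ T)) (allFin V) _ ⟩
    ∑ (allFin V) (λ y′ → N ((x , y) ∷ T) * 𝟙 (free? y′))
      ≤⟨ ∑-mono (allFin V) (λ y′ _ → ≤-trans (≤-reflexive (*-comm (N ((x , y) ∷ T)) (𝟙 (free? y′)))) (𝟙*≤ (free? y′) _ (N-exchange x y y′ T y∉))) ⟩
    ∑ (allFin V) (λ y′ → N ((x , y′) ∷ T))
      ≡⟨ ∑-swap (allFin V) 𝓐 _ ⟩
    ∑ 𝓐 (λ m → ∑ (allFin V) (λ y′ → 𝟙 (sat? ((x , y′) ∷ T) m)))
      ≤⟨ ∑-mono 𝓐 (λ m m∈ → ≤-trans (∑-mono (allFin V) (λ y′ _ → split m y′)) (≤-reflexive (trans (sym (∑-*ʳ (allFin V) _ (𝟙 (sat? T m)))) (cong (_* 𝟙 (sat? T m)) (block m∈ x))))) ⟩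
    ∑ 𝓐 (λ m → k * 𝟙 (sat? T m))
      ≡⟨ ∑-*ˡ k 𝓐 _ ⟨
    k * N T ∎
    where
    open ≤-Reasoning
    free? : Decidable (λ y′ → ¬ y′ ∈ x ∷ support T)
    free? y′ = ¬? (y′ ∈? (x ∷ support T))
    free-count : V ∸ suc (2 * length T) ≤ # free? (allFin V)
    free-count = begin
      V ∸ suc (2 * length T)
        ≡⟨ cong (λ l → V ∸ suc l) (length-support T) ⟨
      V ∸ length (x ∷ support T)
        ≤⟨ ∸-monoʳ-≤ V (#∈≤length (x ∷ support T)) ⟩
      V ∸ # (_∈? (x ∷ support T)) (allFin V)
        ≡⟨ cong (_∸ # (_∈? (x ∷ support T)) (allFin V)) (trans (sym (length-tabulate {n = V} id)) (sym (length-split (_∈? (x ∷ support T)) (allFin V)))) ⟩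
      # (_∈? (x ∷ support T)) (allFin V) + # free? (allFin V) ∸ # (_∈? (x ∷ support T)) (allFin V)
        ≡⟨ m+n∸m≡n (# (_∈? (x ∷ support T)) (allFin V)) _ ⟩
      # free? (allFin V) ∎
    split : ∀ m y′ → 𝟙 (sat? ((x , y′) ∷ T) m) ≤ 𝟙 (rel? m x y′) * 𝟙 (sat? T m)
    split m y′ = 𝟙-≤ (sat? ((x , y′) ∷ T) m) (λ { ((_ , x∼y′) ∷ s) →
      ≤-reflexive (sym (cong₂ _*_ (𝟙-yes (rel? m x y′) x∼y′) (𝟙-yes (sat? T m) s))) })

  -- Since `k ≥ 2`, each matching gives `x` a partner besides itself, and by symmetry no candidate
  -- is more frequent than `y`. The copy of `length 𝓐` added on both sides accounts for `x` in its
  -- own block.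
  N-pair-lower : 2 ≤ k → ∀ {x y} → x ≢ y → length 𝓐 ≤ V * N ((x , y) ∷ [])
  N-pair-lower 2≤k {x} {y} x≢y = +-cancelˡ-≤ (length 𝓐) _ _ (begin
    length 𝓐 + length 𝓐
      ≡⟨ r (length 𝓐) ⟩
    2 * length 𝓐
      ≤⟨ *-monoˡ-≤ (length 𝓐) 2≤k ⟩
    k * length 𝓐
      ≡⟨ trans (*-comm k (length 𝓐)) (sym (∑-const 𝓐 k)) ⟩
    ∑ 𝓐 (λ _ → k)
      ≤⟨ ∑-mono 𝓐 (λ m m∈ → ≤-trans (≤-reflexive (sym (block m∈ x))) (∑-mono (allFin V) (λ y′ _ → split m y′))) ⟩
    ∑ 𝓐 (λ m → ∑ (allFin V) (λ y′ → 𝟙 (y′ ∈? (x ∷ [])) + 𝟙 (sat? ((x , y′) ∷ []) m)))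
      ≡⟨ trans (∑-cong 𝓐 (λ m → ∑-+ (allFin V) _ _)) (∑-+ 𝓐 _ _) ⟩
    ∑ 𝓐 (λ _ → # (_∈? (x ∷ [])) (allFin V)) + ∑ 𝓐 (λ m → ∑ (allFin V) (λ y′ → 𝟙 (sat? ((x , y′) ∷ []) m)))
      ≤⟨ +-mono-≤ (≤-trans (∑-mono 𝓐 (λ _ _ → #∈≤length (x ∷ []))) (≤-reflexive (sym (length≡∑ 𝓐))))
                  (≤-trans (≤-reflexive (∑-swap 𝓐 (allFin V) _)) (∑-mono (allFin V) (λ y′ _ → compare y′))) ⟩
    length 𝓐 + ∑ (allFin V) (λ _ → N ((x , y) ∷ []))
      ≡⟨ cong (length 𝓐 +_) (trans (∑-const (allFin V) _) (cong (_* N ((x , y) ∷ [])) (length-tabulate {n = V} id))) ⟩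
    length 𝓐 + V * N ((x , y) ∷ []) ∎)
    where
    open ≤-Reasoning
    r : ∀ a → a + a ≡ 2 * a
    r = solve-∀
    split : ∀ m y′ → 𝟙 (rel? m x y′) ≤ 𝟙 (y′ ∈? (x ∷ [])) + 𝟙 (sat? ((x , y′) ∷ []) m)
    split m y′ = 𝟙-≤ (rel? m x y′) (λ x∼y′ → cases x∼y′ (y′ Finₚ.≟ x))
      where
      cases : x ∼[ m ] y′ → Dec (y′ ≡ x) → 1 ≤ 𝟙 (y′ ∈? (x ∷ [])) + 𝟙 (sat? ((x , y′) ∷ []) m)
      cases _ (yes eq) = ≤-trans (≤-reflexive (sym (𝟙-yes (y′ ∈? (x ∷ [])) (here eq)))) (m≤m+n _ _)
      cases x∼y′ (no y′≢x) = ≤-trans (≤-reflexive (sym (𝟙-yes (sat? ((x , y′) ∷ []) m) (((λ eq → y′≢x (sym eq)) , x∼y′) ∷ [])))) (m≤n+m _ _)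
    compare : ∀ y′ → N ((x , y′) ∷ []) ≤ N ((x , y) ∷ [])
    compare y′ = cases (y′ Finₚ.≟ x)
      where
      cases : Dec (y′ ≡ x) → N ((x , y′) ∷ []) ≤ N ((x , y) ∷ [])
      cases (no y′≢x) = N-exchange x y′ y [] (λ { (here eq) → y′≢x eq }) (λ { (here eq) → x≢y (sym eq) })
      cases (yes refl) = N-mono ((x , x) ∷ []) ((x , y) ∷ []) (λ { _ ((x≢x , _) ∷ []) → ⊥-elim (x≢x refl) })

-- Matchings as sets of pairs, and how spread they are

does⇒ : {P : Set} (d : Dec P) → does d ≡ true → P
does⇒ (yes p) _ = p

module Encoding (k V : ℕ) where
  open Matchings k V public

  pairAt : Fin (V * V) → Pair
  pairAt = remQuot {V} V

  -- The pairs are ordered, so a matching contains each joined pair in both orders. This only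
  -- doubles sizes; whether two matchings meet is unaffected.
  enc : Rel V → Subset (V * V)
  enc m = Vec.tabulate (λ x → does (joins? m (pairAt x)))

  ∈-enc⁻ : ∀ m {x} → x ∈ˢ enc m → Joins m (pairAt x)
  ∈-enc⁻ m {x} x∈ = does⇒ (joins? m (pairAt x)) (trans (sym (Vecₚ.lookup∘tabulate _ x)) (Vecₚ.[]=⇒lookup x∈))

  ∈-enc⁺ : ∀ m {x} → Joins m (pairAt x) → x ∈ˢ enc m
  ∈-enc⁺ m {x} j = Vecₚ.lookup⇒[]= x (enc m) (trans (Vecₚ.lookup∘tabulate _ x) (dec-true (joins? m (pairAt x)) j))

  pairsOf : Subset (V * V) → List Pair
  pairsOf S = map pairAt (filter (_∈ˢ? S) (allFin (V * V)))

  pairsOf-Unique : ∀ S → Unique (pairsOf S)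
  pairsOf-Unique S = Uniqueₚ.map⁺ (λ {x} {y} eq → trans (sym (Finₚ.combine-remQuot {V} V x)) (trans (cong (λ (i , j) → combine i j) eq) (Finₚ.combine-remQuot {V} V y)))
    (Uniqueₚ.filter⁺ (_∈ˢ? S) (Uniqueₚ.allFin⁺ (V * V)))

  length-pairsOf : ∀ S → length (pairsOf S) ≡ ∣ S ∣
  length-pairsOf S = trans (length-map pairAt (filter (_∈ˢ? S) (allFin (V * V)))) (trans (length-filter (_∈ˢ? S) (allFin (V * V))) (sym (∣∣≡# S)))

  ⊆enc⇒Sat : ∀ {S m} → S ⊆ enc m → Sat (pairsOf S) m
  ⊆enc⇒Sat {S} {m} S⊆ = All.tabulate (λ p∈ → let (x , x∈ , eq) = ∈-map⁻ pairAt p∈ in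
    subst (Joins m) (sym eq) (∈-enc⁻ m (S⊆ (proj₂ (∈-filter⁻ (_∈ˢ? S) {xs = allFin (V * V)} x∈)))))

  ∣enc∣≤ : ∀ {m} → m ∈ 𝓐 → ∣ enc m ∣ ≤ V * k
  ∣enc∣≤ {m} m∈ = begin
    ∣ enc m ∣
      ≡⟨ trans (sym (length-pairsOf (enc m))) (length≡∑ (pairsOf (enc m))) ⟩
    ∑ (pairsOf (enc m)) (λ _ → 1)
      ≤⟨ ∑-mono (pairsOf (enc m)) (λ (i , j) p∈ → ≤-reflexive (sym (𝟙-yes (rel? m i j) (proj₂ (All.lookup (⊆enc⇒Sat {enc m} {m} id) p∈))))) ⟩
    ∑ (pairsOf (enc m)) (λ (i , j) → 𝟙 (rel? m i j))
      ≤⟨ ∑-⊆ (cartesianProduct (allFin V) (allFin V)) _ (pairsOf-Unique (enc m)) (λ {(i , j)} _ → ∈-cartesianProduct⁺ (∈-allFin i) (∈-allFin j)) ⟩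
    ∑ (cartesianProduct (allFin V) (allFin V)) (λ (i , j) → 𝟙 (rel? m i j))
      ≡⟨ ∑-product _,_ (allFin V) (allFin V) _ ⟩
    ∑ (allFin V) (λ i → # (rel? m i) (allFin V))
      ≡⟨ ∑-cong (allFin V) (block m∈) ⟩
    ∑ (allFin V) (λ _ → k)
      ≡⟨ trans (∑-const (allFin V) k) (cong (_* k) (length-tabulate {n = V} id)) ⟩
    V * k ∎
    where open ≤-Reasoning

  deg-map-enc : ∀ F S → deg (map enc F) S ≡ # (λ m → S ⊆? enc m) F
  deg-map-enc F S = ∑-map enc F _

  Touches : Fin V → Fin V → Pair → Set
  Touches x y (i , j) = (x ≡ i ⊎ x ≡ j) ⊎ (y ≡ i ⊎ y ≡ j)

  touches? : ∀ x y → Decidable (Touches x y)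
  touches? x y (i , j) = ((x Finₚ.≟ i) ⊎-dec (x Finₚ.≟ j)) ⊎-dec ((y Finₚ.≟ i) ⊎-dec (y Finₚ.≟ j))

  -- The block of `x` has `k` vertices, each giving two ordered pairs with `x`, and likewise for
  -- `y`. This is the `4 * k` in the exponents below.
  #touches≤ : ∀ {m} → m ∈ 𝓐 → ∀ x y {ps} → Unique ps → Sat ps m → # (touches? x y) ps ≤ 4 * k
  #touches≤ {m} m∈ x y {ps} u sat = begin
    # (touches? x y) ps
      ≡⟨ length-filter (touches? x y) ps ⟨
    length (filter (touches? x y) ps)
      ≤⟨ length-mono-⊆ (star x ++ star y) (Uniqueₚ.filter⁺ (touches? x y) u) covered ⟩
    length (star x ++ star y)
      ≡⟨ trans (length-++ (star x)) (cong₂ _+_ (length-star x) (length-star y)) ⟩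
    (k + k) + (k + k)
      ≡⟨ r k ⟩
    4 * k ∎
    where
    open ≤-Reasoning
    r : ∀ a → (a + a) + (a + a) ≡ 4 * a
    r = solve-∀
    nbrs : Fin V → List (Fin V)
    nbrs z = filter (rel? m z) (allFin V)
    star : Fin V → List Pair
    star z = map (z ,_) (nbrs z) ++ map (_, z) (nbrs z)
    length-star : ∀ z → length (star z) ≡ k + k
    length-star z = trans (length-++ (map (z ,_) (nbrs z))) (cong₂ _+_
      (trans (length-map _ (nbrs z)) (trans (length-filter (rel? m z) (allFin V)) (block m∈ z)))
      (trans (length-map _ (nbrs z)) (trans (length-filter (rel? m z) (allFin V)) (block m∈ z))))
    in-star : ∀ {z i j} → i ∼[ m ] j → z ≡ i ⊎ z ≡ j → (i , j) ∈ star z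
    in-star {i = i} {j} i∼j (inj₁ refl) = ∈-++⁺ˡ (∈-map⁺ (i ,_) (∈-filter⁺ (rel? m i) (∈-allFin j) i∼j))
    in-star {i = i} {j} i∼j (inj₂ refl) = ∈-++⁺ʳ (map (j ,_) (nbrs j)) (∈-map⁺ (_, j) (∈-filter⁺ (rel? m j) (∈-allFin i) (sym∼ (∈-𝓐⁻ m∈) i j i∼j)))
    covered : ∀ {p} → p ∈ filter (touches? x y) ps → p ∈ star x ++ star y
    covered {i , j} p∈ with ∈-filter⁻ (touches? x y) {xs = ps} p∈
    ... | p∈ps , inj₁ t = ∈-++⁺ˡ (in-star (proj₂ (All.lookup sat p∈ps)) t)
    ... | p∈ps , inj₂ t = ∈-++⁺ʳ (star x) (in-star (proj₂ (All.lookup sat p∈ps)) t)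

  untouched-support : ∀ x y ps → All (λ p → ¬ Touches x y p) ps → ¬ y ∈ support ps
  untouched-support x y (p ∷ ps) (n ∷ _) (here y≡)          = n (inj₂ (inj₁ y≡))
  untouched-support x y (p ∷ ps) (n ∷ _) (there (here y≡))  = n (inj₂ (inj₂ y≡))
  untouched-support x y (p ∷ ps) (_ ∷ ns) (there (there y∈)) = untouched-support x y ps ns y∈

  module Spread (Q : ℕ) (k>0 : 0 < k) (Q>0 : 0 < Q) (V-large : 2 * (k * Q ^ (4 * k + 1)) ≤ V) where

    -- Each step pins one pair and drops the at most 4k pairs meeting it, so the
    -- pinned pairs are vertex-disjoint and each costs a factor of about k / V.
    spread-list : ∀ fuel ps → length ps ≤ fuel → Unique ps → 4 * length ps ≤ V → N ps * Q ^ length ps ≤ length 𝓐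
    spread-list _ [] _ _ _ = subst (_≤ length 𝓐) (sym (*-identityʳ _)) (#≤length (sat? []) 𝓐)
    spread-list (suc fuel) ((x , y) ∷ ps) (s≤s len) (_ ∷ u) short with N ((x , y) ∷ ps) in eq
    ... | zero = z≤n
    -- Some matching contains all the listed pairs; without one, the number of pairs touching `x` or
    -- `y` would not be bounded.
    ... | suc N₀ with #-pos (sat? ((x , y) ∷ ps)) 𝓐 (subst (0 <_) (sym eq) z<s)
    ...   | m , m∈ , (x≢y , x∼y) ∷ sat = begin
      suc N₀ * Q ^ suc (length ps)
        ≡⟨ cong (_* Q ^ suc (length ps)) eq ⟨
      N ((x , y) ∷ ps) * Q ^ suc (length ps)
        ≤⟨ *-mono-≤ (N-mono ((x , y) ∷ ps) ((x , y) ∷ ps′) (λ { _ (j ∷ s) → j ∷ Allₚ.filter⁺ free? s })) (^-monoʳ-≤ Q {{>-nonZero Q>0}} size) ⟩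
      N ((x , y) ∷ ps′) * Q ^ ((4 * k + 1) + length ps′)
        ≡⟨ cong (N ((x , y) ∷ ps′) *_) (^-distribˡ-+-* Q (4 * k + 1) (length ps′)) ⟩
      N ((x , y) ∷ ps′) * (Q ^ (4 * k + 1) * Q ^ length ps′)
        ≡⟨ *-assoc (N ((x , y) ∷ ps′)) _ _ ⟨
      N ((x , y) ∷ ps′) * Q ^ (4 * k + 1) * Q ^ length ps′
        ≤⟨ *-monoˡ-≤ (Q ^ length ps′) step ⟩
      N ps′ * Q ^ length ps′
        ≤⟨ spread-list fuel ps′ (≤-trans ps′≤ps len) (Uniqueₚ.filter⁺ free? u) (≤-trans (*-monoʳ-≤ 4 (≤-trans ps′≤ps (n≤1+n _))) short) ⟩
      length 𝓐 ∎
      where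
      open ≤-Reasoning
      free? : Decidable (λ p → ¬ Touches x y p)
      free? p = ¬? (touches? x y p)
      ps′ : List Pair
      ps′ = filter free? ps
      ps′≤ps : length ps′ ≤ length ps
      ps′≤ps = subst (_≤ length ps) (sym (length-filter free? ps)) (#≤length free? ps)
      size : suc (length ps) ≤ (4 * k + 1) + length ps′
      size = begin
        suc (length ps)                                ≡⟨ cong suc (length-split (touches? x y) ps) ⟨
        suc (# (touches? x y) ps + # free? ps)         ≤⟨ s≤s (+-monoˡ-≤ _ (#touches≤ m∈ x y u sat)) ⟩
        suc (4 * k + # free? ps)                       ≡⟨ cong (λ l → suc (4 * k + l)) (length-filter free? ps) ⟨
        suc (4 * k + length ps′)                       ≡⟨ r (4 * k) (length ps′) ⟩
        (4 * k + 1) + length ps′                       ∎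
        where
        r : ∀ a b → suc (a + b) ≡ (a + 1) + b
        r = solve-∀
      -- The hypothesis `short` keeps the vertices already used to at most half of `V`, and the
      -- other half exceeds the bound by `V-large`.
      room : k * Q ^ (4 * k + 1) ≤ V ∸ suc (2 * length ps′)
      room = *-cancelˡ-≤ 2 (begin
        2 * (k * Q ^ (4 * k + 1))                 ≤⟨ V-large ⟩
        V                                         ≡⟨ m+n∸n≡m V V ⟨
        (V + V) ∸ V                               ≤⟨ ∸-monoʳ-≤ (V + V) (≤-trans (≤-trans (m≤n+m _ 2)
                                                       (≤-trans (≤-reflexive (r₁ (length ps′))) (*-monoʳ-≤ 4 (s≤s ps′≤ps)))) short) ⟩
        (V + V) ∸ 2 * suc (2 * length ps′)        ≡⟨ cong (_∸ 2 * suc (2 * length ps′)) (r₂ V) ⟩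
        2 * V ∸ 2 * suc (2 * length ps′)          ≡⟨ *-distribˡ-∸ 2 V (suc (2 * length ps′)) ⟨
        2 * (V ∸ suc (2 * length ps′))            ∎)
        where
        r₁ : ∀ l → 2 + 2 * suc (2 * l) ≡ 4 * suc l
        r₁ = solve-∀
        r₂ : ∀ v → v + v ≡ 2 * v
        r₂ = solve-∀
      step : N ((x , y) ∷ ps′) * Q ^ (4 * k + 1) ≤ N ps′
      step = *-cancelˡ-≤ k {{>-nonZero k>0}} (begin
        k * (N ((x , y) ∷ ps′) * Q ^ (4 * k + 1))          ≡⟨ r k (N ((x , y) ∷ ps′)) (Q ^ (4 * k + 1)) ⟩
        N ((x , y) ∷ ps′) * (k * Q ^ (4 * k + 1))          ≤⟨ *-monoʳ-≤ (N ((x , y) ∷ ps′)) room ⟩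
        N ((x , y) ∷ ps′) * (V ∸ suc (2 * length ps′))     ≤⟨ N-extend x y ps′ y∉ ⟩
        k * N ps′                                          ∎)
        where
        r : ∀ a b c → a * (b * c) ≡ b * (a * c)
        r = solve-∀
        y∉ : ¬ y ∈ x ∷ support ps′
        y∉ (here y≡x) = x≢y (sym y≡x)
        y∉ (there y∈) = untouched-support x y ps′ (Allₚ.all-filter free? ps) y∈

  quarter : ∀ v → 4 ≤ v → ∃ λ h → 4 * h ≤ v × v ≤ 8 * h
  quarter v 4≤v = h , 4h≤v , v≤8h
    where
    h : ℕ
    h = v / 4
    eq : v ≡ v % 4 + h * 4
    eq = m≡m%n+[m/n]*n v 4
    4h≤v : 4 * h ≤ v
    4h≤v = subst (_≤ v) (*-comm h 4) (subst (h * 4 ≤_) (sym eq) (m≤n+m (h * 4) (v % 4)))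
    h>0 : 1 ≤ h
    h>0 with h | eq
    ... | suc _ | _ = s≤s z≤n
    ... | zero  | eq₀ = ⊥-elim (<-irrefl refl (<-≤-trans (m%n<n v 4) (subst (4 ≤_) (trans eq₀ (+-identityʳ (v % 4))) 4≤v)))
    v≤8h : v ≤ 8 * h
    v≤8h = begin
      v                ≡⟨ eq ⟩
      v % 4 + h * 4    ≤⟨ +-monoˡ-≤ (h * 4) (<⇒≤ (m%n<n v 4)) ⟩
      4 + h * 4        ≤⟨ +-monoˡ-≤ (h * 4) (*-monoʳ-≤ 4 h>0) ⟩
      4 * h + h * 4    ≡⟨ r h ⟩
      8 * h            ∎
      where
      open ≤-Reasoning
      r : ∀ a → 4 * a + a * 4 ≡ 8 * a
      r = solve-∀

  module _ (R : ℕ) (k>0 : 0 < k) (R>0 : 0 < R) (4≤V : 4 ≤ V)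
    (V-large : 2 * (k * (R ^ (16 * k)) ^ (4 * k + 1)) ≤ V) where

    -- `spread-list` handles lists of at most `V / 4` pairs, so `S` is cut to its first `h` pairs.
    -- As `S` lies in a matching, it has at most `V * k ≤ 8 * h * k` elements, so a fraction
    -- `1 / (8 * k)` survives the cut and the base `R ^ (16 * k)` makes up for it. The doubled
    -- exponent is what later bounds the size of cores.
    𝓐-spread : ∀ S → deg (map enc 𝓐) S * R ^ (2 * ∣ S ∣) ≤ length 𝓐
    𝓐-spread S with deg (map enc 𝓐) S in eq
    ... | zero = z≤n
    ... | suc d with #-pos (λ m → S ⊆? enc m) 𝓐 (subst (0 <_) (trans (sym eq) (deg-map-enc 𝓐 S)) z<s) | quarter V 4≤V
    ...   | m , m∈ , S⊆ | h , 4h≤V , V≤8h = begin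
      suc d * R ^ (2 * ∣ S ∣)
        ≡⟨ cong (_* R ^ (2 * ∣ S ∣)) (trans (sym eq) (deg-map-enc 𝓐 S)) ⟩
      # (λ m → S ⊆? enc m) 𝓐 * R ^ (2 * ∣ S ∣)
        ≤⟨ *-mono-≤ (#-mono (λ m → S ⊆? enc m) (sat? ps) 𝓐 (λ m _ S⊆m → Allₚ.take⁺ h (⊆enc⇒Sat {S} {m} S⊆m))) (^-monoʳ-≤ R {{>-nonZero R>0}} size) ⟩
      N ps * R ^ (16 * k * length ps)
        ≡⟨ cong (N ps *_) (^-*-assoc R (16 * k) (length ps)) ⟨
      N ps * (R ^ (16 * k)) ^ length ps
        ≤⟨ Spread.spread-list (R ^ (16 * k)) k>0 (m^n>0 R {{>-nonZero R>0}} (16 * k)) V-large (length ps) ps ≤-refl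
             (Uniqueₚ.take⁺ h (pairsOf-Unique S)) (≤-trans (*-monoʳ-≤ 4 (subst (_≤ h) (sym len) (m⊓n≤m h _))) 4h≤V) ⟩
      length 𝓐 ∎
      where
      open ≤-Reasoning
      ps : List Pair
      ps = take h (pairsOf S)
      len : length ps ≡ h ⊓ length (pairsOf S)
      len = length-take h (pairsOf S)
      bound : ∀ c → (c ≡ h) ⊎ (c ≡ ∣ S ∣) → 2 * ∣ S ∣ ≤ 16 * k * c
      bound c (inj₁ refl) = begin
        2 * ∣ S ∣          ≤⟨ *-monoʳ-≤ 2 (≤-trans (p⊆q⇒∣p∣≤∣q∣ S⊆) (∣enc∣≤ m∈)) ⟩
        2 * (V * k)        ≤⟨ *-monoʳ-≤ 2 (*-monoˡ-≤ k V≤8h) ⟩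
        2 * (8 * h * k)    ≡⟨ r h k ⟩
        16 * k * h         ∎
        where
        r : ∀ a b → 2 * (8 * a * b) ≡ 16 * b * a
        r = solve-∀
      bound c (inj₂ refl) = *-monoˡ-≤ ∣ S ∣ (≤-trans (s≤s (s≤s z≤n)) (*-monoʳ-≤ 16 k>0))
      size : 2 * ∣ S ∣ ≤ 16 * k * length ps
      size = bound (length ps) (which (⊓-sel h (length (pairsOf S))))
        where
        which : h ⊓ length (pairsOf S) ≡ h ⊎ h ⊓ length (pairsOf S) ≡ length (pairsOf S) → length ps ≡ h ⊎ length ps ≡ ∣ S ∣
        which (inj₁ e) = inj₁ (trans len e)
        which (inj₂ e) = inj₂ (trans len (trans e (length-pairsOf S)))

  N-pair : ∀ {x y} → x ≢ y → N ((x , y) ∷ []) * (V ∸ 1) ≤ k * length 𝓐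
  N-pair {x} {y} x≢y = ≤-trans (N-extend x y [] λ { (here y≡x) → x≢y (sym y≡x) }) (*-monoʳ-≤ k (#≤length (sat? []) 𝓐))

  -- `m` joins `a` and `b` but not `i` and `j`, so one of `a`, `b` is neither `i` nor `j`. That
  -- endpoint is free to vary in `N-extend`, if necessary after reversing the pair.
  N-two-pairs : ∀ {m i j a b} → PM m → Joins m (a , b) → ¬ i ∼[ m ] j →
    N ((a , b) ∷ (i , j) ∷ []) * (V ∸ 3) ≤ k * N ((i , j) ∷ [])
  N-two-pairs {m} {i} {j} {a} {b} pm (a≢b , a∼b) ¬i∼j = cases (b ∈? (i ∷ j ∷ [])) (a ∈? (i ∷ j ∷ []))
    where
    reverse : N ((a , b) ∷ (i , j) ∷ []) ≤ N ((b , a) ∷ (i , j) ∷ [])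
    reverse = N-mono ((a , b) ∷ (i , j) ∷ []) ((b , a) ∷ (i , j) ∷ []) λ { m∈ ((a≢b , a∼b) ∷ s) → ((λ b≡a → a≢b (sym b≡a)) , sym∼ (∈-𝓐⁻ m∈) a b a∼b) ∷ s }
    cases : Dec (b ∈ i ∷ j ∷ []) → Dec (a ∈ i ∷ j ∷ []) → N ((a , b) ∷ (i , j) ∷ []) * (V ∸ 3) ≤ k * N ((i , j) ∷ [])
    cases (no b∉) _ = N-extend a b ((i , j) ∷ []) λ { (here b≡a) → a≢b (sym b≡a) ; (there b∈) → b∉ b∈ }
    cases (yes _) (no a∉) = ≤-trans (*-monoˡ-≤ (V ∸ 3) reverse)
      (N-extend b a ((i , j) ∷ []) λ { (here a≡b) → a≢b a≡b ; (there a∈) → a∉ a∈ })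
    cases (yes (here refl)) (yes (here refl)) = ⊥-elim (a≢b refl)
    cases (yes (here refl)) (yes (there (here refl))) = ⊥-elim (¬i∼j (sym∼ pm a b a∼b))
    cases (yes (there (here refl))) (yes (here refl)) = ⊥-elim (¬i∼j a∼b)
    cases (yes (there (here refl))) (yes (there (here refl))) = ⊥-elim (a≢b refl)

-- Matchings through a given pair that avoid a given matching

∑-small⇒zero : {A : Set} (xs : List A) (f : A → ℕ) → ∑ xs f < length xs → ∃ λ x → f x ≡ 0
∑-small⇒zero (x ∷ xs) f lt with f x in eq
... | zero  = x , eq
... | suc l = ∑-small⇒zero xs f (≤-trans (s≤s (m≤n+m _ l)) (s≤s⁻¹ lt))

𝟙≡0⇒¬ : {P : Set} (d : Dec P) → 𝟙 d ≡ 0 → ¬ P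
𝟙≡0⇒¬ (no ¬p) _ = ¬p

∣∣>0⇒Nonempty : ∀ {n} (p : Subset n) → 0 < ∣ p ∣ → ∃ λ x → x ∈ˢ p
∣∣>0⇒Nonempty {n} p pos with #-pos (_∈ˢ? p) (allFin n) (subst (0 <_) (∣∣≡# p) pos)
... | x , _ , x∈ = x , x∈

v≤2[v∸3] : ∀ v → 6 ≤ v → v ≤ 2 * (v ∸ 3)
v≤2[v∸3] v 6≤v = begin
  v                  ≡⟨ m+n∸n≡m v v ⟨
  (v + v) ∸ v        ≤⟨ ∸-monoʳ-≤ (v + v) 6≤v ⟩
  (v + v) ∸ 2 * 3    ≡⟨ cong (λ w → (v + w) ∸ 6) (+-identityʳ v) ⟨
  2 * v ∸ 2 * 3      ≡⟨ *-distribˡ-∸ 2 v 3 ⟨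
  2 * (v ∸ 3)        ∎
  where open ≤-Reasoning

module Switching (k V : ℕ) where
  open Encoding k V public

  module Avoiding {m : Rel V} (m∈ : m ∈ 𝓐) {a b : Fin V} (a≢b : a ≢ b) (¬a∼b : ¬ a ∼[ m ] b) where

    common : Rel V → ℕ
    common g = ∣ enc g ∩ enc m ∣

    Level : ℕ → Rel V → Set
    Level j g = Sat ((a , b) ∷ []) g × common g ≤ j

    level? : ∀ j → Decidable (Level j)
    level? j g = sat? ((a , b) ∷ []) g ×-dec (common g ≤? j)

    pm : PM m
    pm = ∈-𝓐⁻ m∈

    module Switch (V>2k²+2 : 2 + (k * k + k * k) < V) {g : Rel V} (g∈ : g ∈ 𝓐) (p∈g : Joins g (a , b)) where
      pg : PM g
      pg = ∈-𝓐⁻ g∈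

      -- Counts the reasons against exchanging `x` with `v`: `v` belongs to the protected pair, or a
      -- path with one step in `m` and one in `g`, in either order, leads from `x` to `v`. From `x`
      -- there are `k * k` paths of each kind, so some `v` has no clash.
      clashes : Fin V → Fin V → ℕ
      clashes x v = 𝟙 (v ∈? (a ∷ b ∷ [])) +
        (∑ (allFin V) (λ z → 𝟙 (rel? m x z) * 𝟙 (rel? g z v)) + ∑ (allFin V) (λ z → 𝟙 (rel? g x z) * 𝟙 (rel? m z v)))

      two-step : ∀ {g₁ g₂} → g₁ ∈ 𝓐 → g₂ ∈ 𝓐 → ∀ x →
        ∑ (allFin V) (λ v → ∑ (allFin V) (λ z → 𝟙 (rel? g₁ x z) * 𝟙 (rel? g₂ z v))) ≡ k * k
      two-step {g₁} {g₂} g₁∈ g₂∈ x = begin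
        ∑ (allFin V) (λ v → ∑ (allFin V) (λ z → 𝟙 (rel? g₁ x z) * 𝟙 (rel? g₂ z v)))
          ≡⟨ ∑-swap (allFin V) (allFin V) _ ⟩
        ∑ (allFin V) (λ z → ∑ (allFin V) (λ v → 𝟙 (rel? g₁ x z) * 𝟙 (rel? g₂ z v)))
          ≡⟨ ∑-cong (allFin V) (λ z → trans (sym (∑-*ˡ (𝟙 (rel? g₁ x z)) (allFin V) _)) (cong (𝟙 (rel? g₁ x z) *_) (block g₂∈ z))) ⟩
        ∑ (allFin V) (λ z → 𝟙 (rel? g₁ x z) * k)
          ≡⟨ trans (sym (∑-*ʳ (allFin V) _ k)) (cong (_* k) (block g₁∈ x)) ⟩
        k * k ∎
        where open ≡-Reasoning

      ∑clashes : ∀ x → ∑ (allFin V) (clashes x) ≤ 2 + (k * k + k * k)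
      ∑clashes x = begin
        ∑ (allFin V) (clashes x)
          ≡⟨ trans (∑-+ (allFin V) _ _) (cong (# (_∈? (a ∷ b ∷ [])) (allFin V) +_) (trans (∑-+ (allFin V) _ _) (cong₂ _+_ (two-step m∈ g∈ x) (two-step g∈ m∈ x)))) ⟩
        # (_∈? (a ∷ b ∷ [])) (allFin V) + (k * k + k * k)
          ≤⟨ +-monoˡ-≤ (k * k + k * k) (#∈≤length (a ∷ b ∷ [])) ⟩
        2 + (k * k + k * k) ∎
        where open ≤-Reasoning

      partner : ∀ x → ∃ λ v → clashes x v ≡ 0
      partner x = ∑-small⇒zero (allFin V) (clashes x)
        (≤-<-trans (∑clashes x) (subst (2 + (k * k + k * k) <_) (sym (length-tabulate {n = V} id)) V>2k²+2))

      module At {x y : Fin V} (x≢y : x ≢ y) (x∼y : x ∼[ g ] y) (x∼ᵐy : x ∼[ m ] y) (x∉p : ¬ x ∈ a ∷ b ∷ []) where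
        v : Fin V
        v = proj₁ (partner x)

        v∉p : ¬ v ∈ a ∷ b ∷ []
        v∉p = 𝟙≡0⇒¬ (v ∈? (a ∷ b ∷ [])) (m+n≡0⇒m≡0 _ (proj₂ (partner x)))

        product≡0 : ∀ {P Q : Set} (d : Dec P) (d′ : Dec Q) → 𝟙 d * 𝟙 d′ ≡ 0 → P → ¬ Q
        product≡0 (yes _) d′ eq _ = 𝟙≡0⇒¬ d′ (trans (sym (+-identityʳ (𝟙 d′))) eq)
        product≡0 (no ¬p) d′ eq p = ⊥-elim (¬p p)

        -- After the exchange `x` sits in the former block of `v`, where `A₁` says that it finds no
        -- partner from `m`; `A₂` says the same for `v` in the former block of `x`. So no new common
        -- pair arises.
        A₁ : ∀ z → x ∼[ m ] z → ¬ z ∼[ g ] v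
        A₁ z = product≡0 (rel? m x z) (rel? g z v) (n≤0⇒n≡0 (≤-trans (∑-term (λ z → 𝟙 (rel? m x z) * 𝟙 (rel? g z v)) (∈-allFin z))
          (≤-reflexive (m+n≡0⇒m≡0 _ (m+n≡0⇒n≡0 (𝟙 (v ∈? (a ∷ b ∷ []))) (proj₂ (partner x)))))))

        A₂ : ∀ z → x ∼[ g ] z → ¬ z ∼[ m ] v
        A₂ z = product≡0 (rel? g x z) (rel? m z v) (n≤0⇒n≡0 (≤-trans (∑-term (λ z → 𝟙 (rel? g x z) * 𝟙 (rel? m z v)) (∈-allFin z))
          (≤-reflexive (m+n≡0⇒n≡0 (∑ (allFin V) (λ z → 𝟙 (rel? m x z) * 𝟙 (rel? g z v))) (m+n≡0⇒n≡0 (𝟙 (v ∈? (a ∷ b ∷ []))) (proj₂ (partner x)))))))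

        ¬x∼v : ¬ x ∼[ g ] v
        ¬x∼v = A₁ x (refl∼ pm x)

        g′ : Rel V
        g′ = act x v g

        moved : ∀ i j {i′ j′} → swap x v i ≡ i′ → swap x v j ≡ j′ → i ∼[ g′ ] j → i′ ∼[ g ] j′
        moved i j ei ej h = trans (sym (trans (act-entry x v g i j) (cong₂ (entry g) ei ej))) h

        data View (i : Fin V) : Set where
          is-x  : i ≡ x → View i
          is-v  : i ≡ v → View i
          other : swap x v i ≡ i → View i

        view : ∀ i → View i
        view i = cases (i Finₚ.≟ x) (i Finₚ.≟ v)
          where
          cases : Dec (i ≡ x) → Dec (i ≡ v) → View i
          cases (yes e) _       = is-x e
          cases (no _) (yes e)  = is-v e
          cases (no n) (no n′)  = other (swap-other x v n n′)

        no-new : ∀ i j → View i → View j → i ≢ j → i ∼[ g′ ] j → i ∼[ m ] j → i ∼[ g ] j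
        no-new i j (is-x refl) (is-x refl) i≢j _ _ = ⊥-elim (i≢j refl)
        no-new i j (is-v refl) (is-v refl) i≢j _ _ = ⊥-elim (i≢j refl)
        no-new i j (is-x refl) (is-v refl) _ h _ = ⊥-elim (¬x∼v (sym∼ pg v x (moved x v (swap-fst x v) (swap-snd x v) h)))
        no-new i j (is-v refl) (is-x refl) _ h _ = ⊥-elim (¬x∼v (moved v x (swap-snd x v) (swap-fst x v) h))
        no-new i j (is-x refl) (other e) _ h h′ = ⊥-elim (A₁ j h′ (sym∼ pg v j (moved x j (swap-fst x v) e h)))
        no-new i j (is-v refl) (other e) _ h h′ = ⊥-elim (A₂ j (moved v j (swap-snd x v) e h) (sym∼ pm v j h′))
        no-new i j (other e) (is-x refl) _ h h′ = ⊥-elim (A₁ i (sym∼ pm i x h′) (moved i x e (swap-fst x v) h))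
        no-new i j (other e) (is-v refl) _ h h′ = ⊥-elim (A₂ i (sym∼ pg i x (moved i v e (swap-snd x v) h)) h′)
        no-new i j (other e) (other e′) _ h _ = moved i j e e′ h

        destroyed : View y → ¬ x ∼[ g′ ] y
        destroyed (is-x y≡x) _ = x≢y (sym y≡x)
        destroyed (is-v y≡v) _ = ¬x∼v (subst (x ∼[ g ]_) y≡v x∼y)
        destroyed (other e) h = A₁ y x∼ᵐy (sym∼ pg v y (moved x y (swap-fst x v) e h))

        smaller : common g′ < common g
        smaller = p⊂q⇒∣p∣<∣q∣ (sub , w , x∈p∩q⁺ (∈-enc⁺ g (at (Joins g) (x≢y , x∼y)) , ∈-enc⁺ m (at (Joins m) (x≢y , x∼ᵐy)))
          , λ w∈ → destroyed (view y) (proj₂ (subst (Joins g′) (Finₚ.remQuot-combine x y) (∈-enc⁻ g′ (proj₁ (x∈p∩q⁻ (enc g′) (enc m) w∈))))))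
          where
          w : Fin (V * V)
          w = combine x y
          at : (P : Pair → Set) → P (x , y) → P (pairAt w)
          at P = subst P (sym (Finₚ.remQuot-combine x y))
          sub : enc g′ ∩ enc m ⊆ enc g ∩ enc m
          sub {t} t∈ =
            let (t∈g′ , t∈m) = x∈p∩q⁻ (enc g′) (enc m) t∈
                (i≢j , h) = ∈-enc⁻ g′ t∈g′
                (_ , h′) = ∈-enc⁻ m t∈m
            in x∈p∩q⁺ (∈-enc⁺ g (i≢j , no-new _ _ (view _) (view _) i≢j h h′) , t∈m)

        keeps : Joins g′ (a , b)
        keeps = a≢b , trans (act-entry x v g a b) (trans (cong₂ (entry g)
          (swap-other x v (λ a≡x → x∉p (here (sym a≡x))) (λ a≡v → v∉p (here (sym a≡v))))
          (swap-other x v (λ b≡x → x∉p (there (here (sym b≡x)))) (λ b≡v → v∉p (there (here (sym b≡v)))))) (proj₂ p∈g))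

      -- A pair common to `g` and `m` is not the pair `a`, `b`, which `m` does not join. So one of
      -- its endpoints lies outside `a ∷ b ∷ []` and can be moved without breaking that pair.
      switch : 0 < common g → ∃ λ u → ∃ λ v → Joins (act u v g) (a , b) × common (act u v g) < common g
      switch pos with ∣∣>0⇒Nonempty (enc g ∩ enc m) pos
      ... | t , t∈ = result (∈-enc⁻ g (proj₁ (x∈p∩q⁻ (enc g) (enc m) t∈))) (∈-enc⁻ m (proj₂ (x∈p∩q⁻ (enc g) (enc m) t∈)))
        where
        result : ∀ {xy} → Joins g xy → Joins m xy → ∃ λ u → ∃ λ v → Joins (act u v g) (a , b) × common (act u v g) < common g
        result {x , y} (x≢y , x∼y) (_ , x∼ᵐy) = cases (x ∈? (a ∷ b ∷ [])) (y ∈? (a ∷ b ∷ []))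
          where
          cases : Dec (x ∈ a ∷ b ∷ []) → Dec (y ∈ a ∷ b ∷ []) → ∃ λ u → ∃ λ v → Joins (act u v g) (a , b) × common (act u v g) < common g
          cases (no x∉) _ = x , At.v x≢y x∼y x∼ᵐy x∉ , At.keeps x≢y x∼y x∼ᵐy x∉ , At.smaller x≢y x∼y x∼ᵐy x∉
          cases (yes _) (no y∉) = y , At.v y≢x y∼x y∼ᵐx y∉ , At.keeps y≢x y∼x y∼ᵐx y∉ , At.smaller y≢x y∼x y∼ᵐx y∉
            where
            y≢x : y ≢ x
            y≢x y≡x = x≢y (sym y≡x)
            y∼x : y ∼[ g ] x
            y∼x = sym∼ pg x y x∼y
            y∼ᵐx : y ∼[ m ] x
            y∼ᵐx = sym∼ pm x y x∼ᵐy
          cases (yes (here refl)) (yes (here refl)) = ⊥-elim (x≢y refl)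
          cases (yes (here refl)) (yes (there (here refl))) = ⊥-elim (¬a∼b x∼ᵐy)
          cases (yes (there (here refl))) (yes (here refl)) = ⊥-elim (¬a∼b (sym∼ pm x y x∼ᵐy))
          cases (yes (there (here refl))) (yes (there (here refl))) = ⊥-elim (x≢y refl)

    module _ (k>0 : 0 < k) (6≤V : 6 ≤ V) (V>2k²+2 : 2 + (k * k + k * k) < V) where

      -- Every matching at level `suc j` is carried to level `j` by some transposition. There are
      -- `V * V` choices of `u` and `v`, and each transposition permutes `𝓐`.
      level-step : ∀ j → # (level? (suc j)) 𝓐 ≤ V * V * # (level? j) 𝓐
      level-step j = begin
        # (level? (suc j)) 𝓐
          ≤⟨ ∑-mono 𝓐 (λ g g∈ → 𝟙-≤ (level? (suc j) g) (λ (s , c) → reach g g∈ s c (1 ≤? common g))) ⟩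
        ∑ 𝓐 (λ g → ∑ (allFin V) (λ u → ∑ (allFin V) (λ v → 𝟙 (level? j (act u v g)))))
          ≡⟨ trans (∑-swap 𝓐 (allFin V) _) (∑-cong (allFin V) (λ u → ∑-swap 𝓐 (allFin V) _)) ⟩
        ∑ (allFin V) (λ u → ∑ (allFin V) (λ v → ∑ 𝓐 (λ g → 𝟙 (level? j (act u v g)))))
          ≡⟨ ∑-cong (allFin V) (λ u → trans (∑-cong (allFin V) (λ v → ∑-act u v (λ g → 𝟙 (level? j g)))) (trans (∑-const (allFin V) _) (cong (_* # (level? j) 𝓐) (length-tabulate {n = V} id)))) ⟩
        ∑ (allFin V) (λ u → V * # (level? j) 𝓐)
          ≡⟨ trans (∑-const (allFin V) _) (cong (_* (V * # (level? j) 𝓐)) (length-tabulate {n = V} id)) ⟩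
        V * (V * # (level? j) 𝓐)
          ≡⟨ *-assoc V V _ ⟨
        V * V * # (level? j) 𝓐 ∎
        where
        open ≤-Reasoning
        counted : ∀ g u v → Level j (act u v g) → 1 ≤ ∑ (allFin V) (λ u → ∑ (allFin V) (λ v → 𝟙 (level? j (act u v g))))
        counted g u v l = ≤-trans (≤-trans (≤-reflexive (sym (𝟙-yes (level? j (act u v g)) l)))
          (∑-term (λ v → 𝟙 (level? j (act u v g))) (∈-allFin v))) (∑-term (λ u → ∑ (allFin V) (λ v → 𝟙 (level? j (act u v g)))) (∈-allFin u))
        stay : ∀ g → act a a g ≡ g
        stay g = Rel-ext λ i j → trans (act-entry a a g i j) (cong₂ (entry g) (swap-same i) (swap-same j))
          where
          swap-same : ∀ i → swap a a i ≡ i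
          swap-same i with i Finₚ.≟ a
          ... | yes i≡a = sym i≡a
          ... | no _ = refl
        reach : ∀ g → g ∈ 𝓐 → Sat ((a , b) ∷ []) g → common g ≤ suc j → Dec (1 ≤ common g) →
          1 ≤ ∑ (allFin V) (λ u → ∑ (allFin V) (λ v → 𝟙 (level? j (act u v g))))
        -- Here `g` is already disjoint from `m`; exchanging `a` with itself leaves it where it is.
        reach g g∈ s c (no ¬pos) = counted g a a (subst (Level j) (sym (stay g)) (s , ≤-trans (s≤s⁻¹ (≰⇒> ¬pos)) z≤n))
        reach g g∈ (p ∷ []) c (yes pos) with Switch.switch V>2k²+2 g∈ p pos
        ... | u , v , keep , less = counted g u v (keep ∷ [] , s≤s⁻¹ (≤-trans less c))

      level-bound : ∀ j → # (level? j) 𝓐 ≤ (V * V) ^ j * # (level? 0) 𝓐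
      level-bound zero    = ≤-reflexive (sym (+-identityʳ _))
      level-bound (suc j) = ≤-trans (level-step j) (≤-trans (*-monoʳ-≤ (V * V) (level-bound j)) (≤-reflexive (sym (*-assoc (V * V) _ _))))

      overlap-sum : ℕ
      overlap-sum = ∑ 𝓐 (λ g → 𝟙 (sat? ((a , b) ∷ []) g) * common g)

      Nₚ : ℕ
      Nₚ = N ((a , b) ∷ [])

      -- First moment: each of the at most `V * k` pairs of `m` lies in at most a fraction
      -- `k / (V ∸ 3)` of the matchings through `a` and `b`, by `N-two-pairs`.
      overlap-sum*[V∸3] : overlap-sum * (V ∸ 3) ≤ (V * k) * (k * Nₚ)
      overlap-sum*[V∸3] = begin
        overlap-sum * (V ∸ 3)
          ≡⟨ cong (_* (V ∸ 3)) (trans (∑-cong 𝓐 (λ g → trans (cong (𝟙 (sat? ((a , b) ∷ []) g) *_) (∣∣≡# (enc g ∩ enc m))) (∑-*ˡ (𝟙 (sat? ((a , b) ∷ []) g)) (allFin (V * V)) _))) (∑-swap 𝓐 (allFin (V * V)) _)) ⟩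
        ∑ (allFin (V * V)) (λ t → ∑ 𝓐 (λ g → 𝟙 (sat? ((a , b) ∷ []) g) * 𝟙 (t ∈ˢ? (enc g ∩ enc m)))) * (V ∸ 3)
          ≡⟨ ∑-*ʳ (allFin (V * V)) _ (V ∸ 3) ⟩
        ∑ (allFin (V * V)) (λ t → ∑ 𝓐 (λ g → 𝟙 (sat? ((a , b) ∷ []) g) * 𝟙 (t ∈ˢ? (enc g ∩ enc m))) * (V ∸ 3))
          ≤⟨ ∑-mono (allFin (V * V)) (λ t _ → term t (t ∈ˢ? enc m)) ⟩
        ∑ (allFin (V * V)) (λ t → 𝟙 (t ∈ˢ? enc m) * (k * Nₚ))
          ≡⟨ trans (sym (∑-*ʳ (allFin (V * V)) _ (k * Nₚ))) (cong (_* (k * Nₚ)) (sym (∣∣≡# (enc m)))) ⟩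
        ∣ enc m ∣ * (k * Nₚ)
          ≤⟨ *-monoˡ-≤ (k * Nₚ) (∣enc∣≤ m∈) ⟩
        (V * k) * (k * Nₚ) ∎
        where
        open ≤-Reasoning
        term : ∀ t (d : Dec (t ∈ˢ enc m)) → ∑ 𝓐 (λ g → 𝟙 (sat? ((a , b) ∷ []) g) * 𝟙 (t ∈ˢ? (enc g ∩ enc m))) * (V ∸ 3) ≤ 𝟙 d * (k * Nₚ)
        term t (no t∉) = ≤-reflexive (cong (_* (V ∸ 3)) (n≤0⇒n≡0 (≤-trans (∑-mono 𝓐 (λ g _ →
          ≤-reflexive (trans (cong (𝟙 (sat? ((a , b) ∷ []) g) *_) (𝟙-no (t ∈ˢ? (enc g ∩ enc m)) (λ t∈ → t∉ (proj₂ (x∈p∩q⁻ (enc g) (enc m) t∈))))) (*-zeroʳ (𝟙 (sat? ((a , b) ∷ []) g)))))) (≤-reflexive (∑-zero 𝓐)))))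
        term t (yes t∈) = begin
          ∑ 𝓐 (λ g → 𝟙 (sat? ((a , b) ∷ []) g) * 𝟙 (t ∈ˢ? (enc g ∩ enc m))) * (V ∸ 3)
            ≤⟨ *-monoˡ-≤ (V ∸ 3) (∑-mono 𝓐 (λ g _ → 𝟙*≤ (sat? ((a , b) ∷ []) g) _ (λ s → 𝟙-mono (t ∈ˢ? (enc g ∩ enc m)) (sat? (pairAt t ∷ (a , b) ∷ []) g) (λ t∈g → ∈-enc⁻ g (proj₁ (x∈p∩q⁻ (enc g) (enc m) t∈g)) ∷ s)))) ⟩
          N (pairAt t ∷ (a , b) ∷ []) * (V ∸ 3)
            ≤⟨ N-two-pairs pm (∈-enc⁻ m t∈) ¬a∼b ⟩
          k * Nₚ
            ≡⟨ *-identityˡ _ ⟨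
          1 * (k * Nₚ) ∎

      overlap-sum≤ : overlap-sum ≤ 2 * (k * k) * Nₚ
      overlap-sum≤ = *-cancelʳ-≤ _ _ V {{>-nonZero (≤-trans (s≤s z≤n) 6≤V)}} (begin
        overlap-sum * V                  ≤⟨ *-monoʳ-≤ overlap-sum (v≤2[v∸3] V 6≤V) ⟩
        overlap-sum * (2 * (V ∸ 3))      ≡⟨ r₁ overlap-sum (V ∸ 3) ⟩
        2 * (overlap-sum * (V ∸ 3))      ≤⟨ *-monoʳ-≤ 2 overlap-sum*[V∸3] ⟩
        2 * ((V * k) * (k * Nₚ))         ≡⟨ r₂ V k Nₚ ⟩
        2 * (k * k) * Nₚ * V             ∎)
        where
        open ≤-Reasoning
        r₁ : ∀ p q → p * (2 * q) ≡ 2 * (p * q)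
        r₁ = solve-∀
        r₂ : ∀ v p q → 2 * ((v * p) * (p * q)) ≡ 2 * (p * p) * q * v
        r₂ = solve-∀

      -- Twice the mean overlap allowed by `overlap-sum≤`, so by Markov's inequality at least half
      -- of the star stays within it. It is also the number of transpositions applied.
      threshold : ℕ
      threshold = 4 * (k * k)

      typical : Nₚ ≤ 2 * # (level? threshold) 𝓐
      typical = *-cancelˡ-≤ (2 * (k * k)) {{>-nonZero (*-mono-≤ (s≤s (z≤n {1})) (*-mono-≤ k>0 k>0))}}
        (+-cancelʳ-≤ (2 * (k * k) * Nₚ) _ _ (begin
        2 * (k * k) * Nₚ + 2 * (k * k) * Nₚ
          ≡⟨ r₁ (k * k) Nₚ ⟩
        threshold * Nₚ
          ≡⟨ ∑-*ˡ threshold 𝓐 _ ⟩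
        ∑ 𝓐 (λ g → threshold * 𝟙 (sat? ((a , b) ∷ []) g))
          ≤⟨ ∑-mono 𝓐 (λ g _ → markov (sat? ((a , b) ∷ []) g) (common g) (common g ≤? threshold)) ⟩
        ∑ 𝓐 (λ g → threshold * 𝟙 (level? threshold g) + 𝟙 (sat? ((a , b) ∷ []) g) * common g)
          ≡⟨ trans (∑-+ 𝓐 _ _) (cong (_+ overlap-sum) (sym (∑-*ˡ threshold 𝓐 _))) ⟩
        threshold * # (level? threshold) 𝓐 + overlap-sum
          ≤⟨ +-monoʳ-≤ _ overlap-sum≤ ⟩
        threshold * # (level? threshold) 𝓐 + 2 * (k * k) * Nₚ
          ≡⟨ cong (_+ 2 * (k * k) * Nₚ) (r₂ (k * k) (# (level? threshold) 𝓐)) ⟩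
        2 * (k * k) * (2 * # (level? threshold) 𝓐) + 2 * (k * k) * Nₚ ∎))
        where
        open ≤-Reasoning
        r₁ : ∀ p q → 2 * p * q + 2 * p * q ≡ 4 * p * q
        r₁ = solve-∀
        r₂ : ∀ p q → 4 * p * q ≡ 2 * p * (2 * q)
        r₂ = solve-∀
        markov : ∀ {P : Set} (d : Dec P) c (e : Dec (c ≤ threshold)) → threshold * 𝟙 d ≤ threshold * 𝟙 (d ×-dec e) + 𝟙 d * c
        markov (no _)  c e       = ≤-trans (≤-reflexive (*-zeroʳ threshold)) z≤n
        markov (yes _) c (yes _) = m≤m+n _ _
        markov (yes _) c (no c≰) = ≤-trans (≤-reflexive (*-identityʳ threshold)) (≤-trans (<⇒≤ (≰⇒> c≰)) (≤-trans (≤-reflexive (sym (*-identityˡ c))) (m≤n+m (1 * c) (threshold * 0))))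

      avoiding-many : Nₚ ≤ 2 * ((V * V) ^ threshold * # (level? 0) 𝓐)
      avoiding-many = ≤-trans typical (*-monoʳ-≤ 2 (level-bound threshold))

-- Maximum families

-- Subfamilies of density below `1 / n ^ s` are neglected, `q` bounds the sizes of cores, and `J` is
-- the number of colours on each side.
record Parameters (k n s q J : ℕ) : Set where
  field
    2≤k           : 2 ≤ k
    J>0           : 0 < J
    pairs<2^J     : (k * n) * (k * n) < 2 ^ J
    6≤V           : 6 ≤ k * n
    V>2k²+2       : 2 + (k * k + k * k) < k * n
    V-large       : 2 * (k * (spreadness J ^ (16 * k)) ^ (4 * k + 1)) ≤ k * n
    core-bound    : ∀ t → spreadness J ^ t ≤ n ^ s → t ≤ q
    2q≤R          : 2 * q ≤ spreadness J
    n-large       : k * (1 + q + 4 * (q * q)) < n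
    n²≤n^s        : n * n ≤ n ^ s
    switch-cost   : (k * n) * (2 * ((k * n) * (k * n)) ^ (4 * (k * k))) ≤ n ^ s

module Maximum {k n s q J : ℕ} (params : Parameters k n s q J)
  {F : List (Rel (k * n))} (F-max : IsMaximumP2I k n F) where

  open Parameters params
  open Switching k (k * n)

  V R : ℕ
  V = k * n
  R = spreadness J

  k>0 : 0 < k
  k>0 = ≤-trans (s≤s z≤n) 2≤k

  n>0 : 0 < n
  n>0 = ≤-trans (s≤s z≤n) n-large

  R>0 : 0 < R
  R>0 = *-mono-≤ (*-mono-≤ (s≤s (z≤n {3})) (≤-trans J>0 (m≤m+n J J))) (*-mono-≤ (s≤s (z≤n {7})) J>0)

  k≤n : k ≤ n
  k≤n = ≤-trans (≤-trans (≤-reflexive (sym (*-identityʳ k))) (*-monoʳ-≤ k (s≤s z≤n))) (<⇒≤ n-large)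

  F-unique : Unique F
  F-unique = Family.unique (proj₁ F-max)

  F⊆𝓐 : ∀ {m} → m ∈ F → m ∈ 𝓐
  F⊆𝓐 m∈ = ∈-𝓐⁺ (All.lookup (Family.matchings (proj₁ F-max)) m∈)

  intersecting : ∀ {m m′} → m ∈ F → m′ ∈ F → Meets (enc m) (enc m′)
  intersecting {m} {m′} m∈ m′∈ with proj₁ (proj₂ F-max) m∈ m′∈
  ... | i , j , i≢j , h , h′ = combine i j
    , ∈-enc⁺ m (subst (Joins m) (sym (Finₚ.remQuot-combine i j)) (i≢j , h))
    , ∈-enc⁺ m′ (subst (Joins m′) (sym (Finₚ.remQuot-combine i j)) (i≢j , h′))

  star≤F : ∀ {a b} → a ≢ b → N ((a , b) ∷ []) ≤ length F
  star≤F {a} {b} a≢b = subst (_≤ length F) (length-filter (sat? ((a , b) ∷ [])) 𝓐)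
    (proj₂ (proj₂ F-max) (filter (sat? ((a , b) ∷ [])) 𝓐)
      (record { unique = Uniqueₚ.filter⁺ (sat? ((a , b) ∷ [])) 𝓐-Unique
              ; matchings = All.tabulate (λ m∈ → ∈-𝓐⁻ (proj₁ (∈-filter⁻ (sat? ((a , b) ∷ [])) {xs = 𝓐} m∈))) })
      (λ m∈ m′∈ → a , b , a≢b , joined m∈ , joined m′∈))
    where
    joined : ∀ {m} → m ∈ filter (sat? ((a , b) ∷ [])) 𝓐 → a ∼[ m ] b
    joined m∈ with ∈-filter⁻ (sat? ((a , b) ∷ [])) {xs = 𝓐} m∈
    ... | _ , (_ , h) ∷ [] = h

  v₀ v₁ : Fin V
  v₀ = fromℕ< {0} (≤-trans (s≤s z≤n) 6≤V)
  v₁ = fromℕ< {1} (≤-trans (s≤s (s≤s z≤n)) 6≤V)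

  v₀≢v₁ : v₀ ≢ v₁
  v₀≢v₁ eq with trans (sym (Finₚ.toℕ-fromℕ< {0} (≤-trans (s≤s z≤n) 6≤V))) (trans (cong toℕ eq) (Finₚ.toℕ-fromℕ< {1} (≤-trans (s≤s (s≤s z≤n)) 6≤V)))
  ... | ()

  𝓐≤VF : length 𝓐 ≤ V * length F
  𝓐≤VF = ≤-trans (N-pair-lower 2≤k v₀≢v₁) (*-monoʳ-≤ V (star≤F v₀≢v₁))

  Small : List (Rel V) → Set
  Small F′ = length F′ * n ^ s < length 𝓐

  small? : Decidable Small
  small? F′ = length F′ * n ^ s <? length 𝓐

  small*n² : ∀ {F′} → Small F′ → length F′ * (n * n) ≤ length 𝓐
  small*n² {F′} sm = ≤-trans (*-monoʳ-≤ (length F′) n²≤n^s) (<⇒≤ sm)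

  record Subfamily (F′ : List (Rel V)) : Set where
    field
      sub    : ∀ {m} → m ∈ F′ → m ∈ F
      uniq   : Unique F′
      large  : ¬ Small F′

  subfamily-filter : {P : Rel V → Set} (P? : Decidable P) → ¬ Small (filter P? F) → Subfamily (filter P? F)
  subfamily-filter P? ¬small = record
    { sub   = λ m∈ → proj₁ (∈-filter⁻ P? {xs = F} m∈)
    ; uniq  = Uniqueₚ.filter⁺ P? F-unique
    ; large = ¬small }

  module _ (𝓐>0 : 0 < length 𝓐) where

    F-large : Subfamily F
    F-large = record { sub = id ; uniq = F-unique ; large = ≤⇒≯ (begin
      length 𝓐            ≤⟨ 𝓐≤VF ⟩
      V * length F        ≡⟨ *-comm V (length F) ⟩
      length F * V        ≤⟨ *-monoʳ-≤ (length F) (≤-trans (*-monoˡ-≤ n k≤n) n²≤n^s) ⟩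
      length F * n ^ s    ∎) }
      where open ≤-Reasoning

    record CoreOf (F′ : List (Rel V)) : Set where
      field
        core     : Subset (V * V)
        is-core  : IsCore R (map enc F′) core
        size     : ∣ core ∣ ≤ q
        nonempty : 0 < length (map enc F′)
        member   : ∃ λ m → m ∈ F′ × core ⊆ enc m

    -- For the core `S`, `core-weight` gives `length F′ ≤ D * R ^ ∣ S ∣`, while `𝓐-spread` gives
    -- `D * R ^ (2 * ∣ S ∣) ≤ length 𝓐`. Comparing the two leaves `R ^ ∣ S ∣ ≤ n ^ s`.
    core-of : ∀ {F′} → Subfamily F′ → CoreOf F′
    core-of {F′} sf = record
      { core = S ; is-core = is-core ; size = core-bound ∣ S ∣ R^S≤n^s ; nonempty = F′>0
      ; member = #-pos (λ m → S ⊆? enc m) F′ (subst (0 <_) (deg-map-enc F′ S) d>0) }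
      where
      open Subfamily sf
      S : Subset (V * V)
      S = proj₁ (core-exists R (map enc F′))
      is-core : IsCore R (map enc F′) S
      is-core = proj₂ (core-exists R (map enc F′))
      𝓐≤ : length 𝓐 ≤ length F′ * n ^ s
      𝓐≤ = ≮⇒≥ large
      F′>0 : 0 < length (map enc F′)
      F′>0 = subst (0 <_) (sym (length-map enc F′)) (m*n>0⇒m>0 (length F′) (<-≤-trans 𝓐>0 𝓐≤))
      d D : ℕ
      d = deg (map enc F′) S
      D = deg (map enc 𝓐) S
      d>0 : 0 < d
      d>0 = core-pos {R = R} {map enc F′} {S} is-core F′>0
      d≤D : d ≤ D
      d≤D = subst₂ _≤_ (sym (deg-map-enc F′ S)) (sym (deg-map-enc 𝓐 S)) (∑-⊆ 𝓐 _ uniq (F⊆𝓐 ∘ sub))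
      R^S≤n^s : R ^ ∣ S ∣ ≤ n ^ s
      R^S≤n^s = *-cancelˡ-≤ (D * R ^ ∣ S ∣) {{>-nonZero (*-mono-≤ (≤-trans d>0 d≤D) (m^n>0 R {{>-nonZero R>0}} ∣ S ∣))}} (begin
        D * R ^ ∣ S ∣ * R ^ ∣ S ∣           ≡⟨ *-assoc D _ _ ⟩
        D * (R ^ ∣ S ∣ * R ^ ∣ S ∣)         ≡⟨ cong (D *_) (trans (sym (^-distribˡ-+-* R ∣ S ∣ ∣ S ∣)) (cong (λ t → R ^ (∣ S ∣ + t)) (sym (+-identityʳ ∣ S ∣)))) ⟩
        D * R ^ (2 * ∣ S ∣)                 ≤⟨ 𝓐-spread R k>0 R>0 (≤-trans (s≤s (s≤s (s≤s (s≤s z≤n)))) 6≤V) V-large S ⟩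
        length 𝓐                            ≤⟨ 𝓐≤ ⟩
        length F′ * n ^ s                   ≡⟨ cong (_* n ^ s) (length-map enc F′) ⟨
        length (map enc F′) * n ^ s         ≤⟨ *-monoˡ-≤ (n ^ s) (core-weight {R = R} {map enc F′} {S} is-core) ⟩
        d * R ^ ∣ S ∣ * n ^ s               ≤⟨ *-monoˡ-≤ (n ^ s) (*-monoˡ-≤ (R ^ ∣ S ∣) d≤D) ⟩
        D * R ^ ∣ S ∣ * n ^ s               ∎)
        where open ≤-Reasoning

    cores-meet : ∀ {F₁ F₂} → Subfamily F₁ → Subfamily F₂ → (c₁ : CoreOf F₁) (c₂ : CoreOf F₂) → ¬ ¬ Meets (CoreOf.core c₁) (CoreOf.core c₂)
    cores-meet sf₁ sf₂ c₁ c₂ apart = absurd (disjoint-cores J J>0 pairs<2^J C₁.nonempty C₂.nonempty C₁.is-core C₂.is-core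
      (≤-trans (*-monoʳ-≤ 2 C₁.size) 2q≤R) (≤-trans (*-monoʳ-≤ 2 C₂.size) 2q≤R) (λ x x∈ x∈′ → apart (x , x∈ , x∈′)))
      where
      module C₁ = CoreOf c₁
      module C₂ = CoreOf c₂
      absurd : ¬ (∃ λ g → ∃ λ h → g ∈ map enc _ × h ∈ map enc _ × Disjoint g h)
      absurd (g , h , g∈ , h∈ , dis) with ∈-map⁻ enc g∈ | ∈-map⁻ enc h∈
      ... | m , m∈ , refl | m′ , m′∈ , refl with intersecting (Subfamily.sub sf₁ m∈) (Subfamily.sub sf₂ m′∈)
      ...   | x , x∈ , x∈′ = dis x x∈ x∈′

    misses? : ∀ S → Decidable (λ m → ¬ Meets (enc m) S)
    misses? S m = ¬? (meets? (enc m) S)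

    -- Otherwise the members missing the core would form a large subfamily with a core of its own.
    -- That second core lies inside a member missing the first, so the two cores would be disjoint.
    core-covers : ∀ {F₁} (sf : Subfamily F₁) (c : CoreOf F₁) → Small (filter (misses? (CoreOf.core c)) F)
    core-covers sf c = decidable-stable (small? (filter (misses? (CoreOf.core c)) F)) λ ¬small →
      let sf₂ = subfamily-filter (misses? (CoreOf.core c)) ¬small
          c₂ = core-of sf₂
          (m , m∈ , S₂⊆) = CoreOf.member c₂
      in cores-meet sf sf₂ c c₂ λ (x , x∈ , x∈₂) →
           proj₂ (∈-filter⁻ (misses? (CoreOf.core c)) {xs = F} m∈) (x , S₂⊆ x∈₂ , x∈)

    has? : ∀ x → Decidable (λ m → x ∈ˢ enc m)
    has? x m = x ∈ˢ? enc m

    -- A union bound over the pairs of `S`. The weight `w` allows it to be nested: once for all of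
    -- `F`, and once for the members through a fixed pair.
    cover : ∀ S (w : Rel V → ℕ) → (∀ m → w m ≤ 1) →
      ∑ F w ≤ length (filter (misses? S) F) + ∑ (allFin (V * V)) (λ y → 𝟙 (y ∈ˢ? S) * ∑ F (λ m → w m * 𝟙 (has? y m)))
    cover S w w≤1 = begin
      ∑ F w
        ≤⟨ ∑-mono F (λ m _ → pointwise m (meets? (enc m) S)) ⟩
      ∑ F (λ m → 𝟙 (misses? S m) + ∑ (allFin (V * V)) (λ y → 𝟙 (y ∈ˢ? S) * (w m * 𝟙 (has? y m))))
        ≡⟨ ∑-+ F _ _ ⟩
      # (misses? S) F + ∑ F (λ m → ∑ (allFin (V * V)) (λ y → 𝟙 (y ∈ˢ? S) * (w m * 𝟙 (has? y m))))
        ≡⟨ cong₂ _+_ (sym (length-filter (misses? S) F)) (trans (∑-swap F (allFin (V * V)) _) (∑-cong (allFin (V * V)) (λ y → sym (∑-*ˡ (𝟙 (y ∈ˢ? S)) F _)))) ⟩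
      length (filter (misses? S) F) + ∑ (allFin (V * V)) (λ y → 𝟙 (y ∈ˢ? S) * ∑ F (λ m → w m * 𝟙 (has? y m))) ∎
      where
      open ≤-Reasoning
      pointwise : ∀ m → Dec (Meets (enc m) S) → w m ≤ 𝟙 (misses? S m) + ∑ (allFin (V * V)) (λ y → 𝟙 (y ∈ˢ? S) * (w m * 𝟙 (has? y m)))
      pointwise m (no ¬meet) = ≤-trans (w≤1 m) (≤-trans (≤-reflexive (sym (𝟙-yes (misses? S m) ¬meet))) (m≤m+n _ _))
      pointwise m (yes (y , y∈ , y∈S)) = ≤-trans (≤-trans (≤-reflexive (sym (trans (cong₂ (λ p r → p * (w m * r)) (𝟙-yes (y ∈ˢ? S) y∈S) (𝟙-yes (has? y m) y∈)) (trans (*-identityˡ _) (*-identityʳ _)))))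
        (∑-term (λ y → 𝟙 (y ∈ˢ? S) * (w m * 𝟙 (has? y m))) (∈-allFin y))) (m≤n+m _ _)

    sum-over : ∀ S (f : Fin (V * V) → ℕ) c b → ∣ S ∣ ≤ q → (∀ y → y ∈ˢ S → f y * c ≤ b) →
      ∑ (allFin (V * V)) (λ y → 𝟙 (y ∈ˢ? S) * f y) * c ≤ q * b
    sum-over S f c b ∣S∣≤q h = begin
      ∑ (allFin (V * V)) (λ y → 𝟙 (y ∈ˢ? S) * f y) * c
        ≡⟨ ∑-*ʳ (allFin (V * V)) _ c ⟩
      ∑ (allFin (V * V)) (λ y → 𝟙 (y ∈ˢ? S) * f y * c)
        ≤⟨ ∑-mono (allFin (V * V)) (λ y _ → term y (y ∈ˢ? S)) ⟩
      ∑ (allFin (V * V)) (λ y → 𝟙 (y ∈ˢ? S) * b)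
        ≡⟨ trans (sym (∑-*ʳ (allFin (V * V)) _ b)) (cong (_* b) (sym (∣∣≡# S))) ⟩
      ∣ S ∣ * b
        ≤⟨ *-monoˡ-≤ b ∣S∣≤q ⟩
      q * b ∎
      where
      open ≤-Reasoning
      term : ∀ y (d : Dec (y ∈ˢ S)) → 𝟙 d * f y * c ≤ 𝟙 d * b
      term y (no _)   = z≤n
      term y (yes y∈) = ≤-trans (≤-reflexive (cong (_* c) (*-identityˡ (f y)))) (≤-trans (h y y∈) (≤-reflexive (sym (*-identityˡ b))))

    -- `m` witnesses that the two pairs differ even up to order. Pinning them costs `k / (V ∸ 1)`
    -- and `k / (V ∸ 3)`; both denominators are at least `V / 2`, whence the 4.
    two-pairs : ∀ {m i j p} → PM m → i ≢ j → Joins m p → ¬ i ∼[ m ] j →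
      N (p ∷ (i , j) ∷ []) * (n * n) ≤ 4 * length 𝓐
    two-pairs {m} {i} {j} {p} pm i≢j jp ¬i∼j = *-cancelˡ-≤ (k * k) {{>-nonZero (*-mono-≤ k>0 k>0)}} (begin
      k * k * (N₂ * (n * n))                          ≡⟨ r₁ k n N₂ ⟩
      N₂ * (V * V)                                    ≤⟨ *-monoʳ-≤ N₂ (*-mono-≤ (v≤2[v∸3] V 6≤V) (≤-trans (v≤2[v∸3] V 6≤V) (*-monoʳ-≤ 2 (∸-monoʳ-≤ V (s≤s (z≤n {2})))))) ⟩
      N₂ * ((2 * (V ∸ 3)) * (2 * (V ∸ 1)))            ≡⟨ r₂ N₂ (V ∸ 3) (V ∸ 1) ⟩
      4 * (N₂ * (V ∸ 3) * (V ∸ 1))                    ≤⟨ *-monoʳ-≤ 4 (*-monoˡ-≤ (V ∸ 1) (N-two-pairs pm jp ¬i∼j)) ⟩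
      4 * (k * N ((i , j) ∷ []) * (V ∸ 1))            ≡⟨ cong (4 *_) (*-assoc k _ _) ⟩
      4 * (k * (N ((i , j) ∷ []) * (V ∸ 1)))          ≤⟨ *-monoʳ-≤ 4 (*-monoʳ-≤ k (N-pair i≢j)) ⟩
      4 * (k * (k * length 𝓐))                        ≡⟨ r₃ k (length 𝓐) ⟩
      k * k * (4 * length 𝓐)                          ∎)
      where
      open ≤-Reasoning
      N₂ : ℕ
      N₂ = N (p ∷ (i , j) ∷ [])
      r₁ : ∀ a b c → a * a * (c * (b * b)) ≡ c * ((a * b) * (a * b))
      r₁ = solve-∀
      r₂ : ∀ a b c → a * ((2 * b) * (2 * c)) ≡ 4 * (a * b * c)
      r₂ = solve-∀
      r₃ : ∀ a b → 4 * (a * (a * b)) ≡ a * a * (4 * b)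
      r₃ = solve-∀

    -- The members missing `x` are numerous enough to have a core. It lies inside one of them, so
    -- its pairs all differ from `x`; and it meets nearly all of `F`, so nearly all members through
    -- `x` contain a second pair from a list of at most `q`.
    pair-degree : ∀ x → proj₁ (pairAt x) ≢ proj₂ (pairAt x) → ¬ Small (filter (¬? ∘ has? x) F) →
      # (has? x) F * (n * n) ≤ length 𝓐 + q * (4 * length 𝓐)
    pair-degree x i≢j ¬small = begin
      # (has? x) F * (n * n)
        ≤⟨ *-monoˡ-≤ (n * n) (cover S (λ m → 𝟙 (has? x m)) (λ m → 𝟙≤1 (has? x m))) ⟩
      (length (filter (misses? S) F) + ∑ (allFin (V * V)) (λ y → 𝟙 (y ∈ˢ? S) * ∑ F (λ m → 𝟙 (has? x m) * 𝟙 (has? y m)))) * (n * n)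
        ≡⟨ *-distribʳ-+ (n * n) (length (filter (misses? S) F)) _ ⟩
      length (filter (misses? S) F) * (n * n) + ∑ (allFin (V * V)) (λ y → 𝟙 (y ∈ˢ? S) * ∑ F (λ m → 𝟙 (has? x m) * 𝟙 (has? y m))) * (n * n)
        ≤⟨ +-mono-≤ (small*n² {filter (misses? S) F} (core-covers sf c)) (sum-over S _ (n * n) (4 * length 𝓐) (CoreOf.size c) both) ⟩
      length 𝓐 + q * (4 * length 𝓐) ∎
      where
      open ≤-Reasoning
      sf : Subfamily (filter (¬? ∘ has? x) F)
      sf = subfamily-filter (¬? ∘ has? x) ¬small
      c : CoreOf (filter (¬? ∘ has? x) F)
      c = core-of sf
      S : Subset (V * V)
      S = CoreOf.core c
      g : Rel V
      g = proj₁ (CoreOf.member c)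
      g-spec : g ∈ F × ¬ x ∈ˢ enc g
      g-spec = ∈-filter⁻ (¬? ∘ has? x) {xs = F} (proj₁ (proj₂ (CoreOf.member c)))
      both : ∀ y → y ∈ˢ S → ∑ F (λ m → 𝟙 (has? x m) * 𝟙 (has? y m)) * (n * n) ≤ 4 * length 𝓐
      both y y∈ = ≤-trans (*-monoˡ-≤ (n * n) (≤-trans
          (∑-mono F (λ m _ → 𝟙*≤ (has? x m) _ (λ x∈ → 𝟙-mono (has? y m) (sat? (pairAt y ∷ pairAt x ∷ []) m) (λ y∈m → ∈-enc⁻ m y∈m ∷ ∈-enc⁻ m x∈ ∷ []))))
          (∑-⊆ 𝓐 (λ m → 𝟙 (sat? (pairAt y ∷ pairAt x ∷ []) m)) F-unique F⊆𝓐)))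
        (two-pairs (∈-𝓐⁻ (F⊆𝓐 (proj₁ g-spec))) i≢j (∈-enc⁻ g (proj₂ (proj₂ (CoreOf.member c)) y∈)) (λ i∼j → proj₂ g-spec (∈-enc⁺ g (i≢j , i∼j))))

    private
      c₁ : CoreOf F
      c₁ = core-of F-large
      S₁ : Subset (V * V)
      S₁ = CoreOf.core c₁

    S₁-proper : ∀ {x} → x ∈ˢ S₁ → proj₁ (pairAt x) ≢ proj₂ (pairAt x)
    S₁-proper x∈ = let (m , _ , S₁⊆) = CoreOf.member c₁ in proj₁ (∈-enc⁻ m (S₁⊆ x∈))

    dominant : ∃ λ x → x ∈ˢ S₁ × Small (filter (¬? ∘ has? x) F)
    dominant with Finₚ.any? (λ x → (x ∈ˢ? S₁) ×-dec small? (filter (¬? ∘ has? x) F))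
    ... | yes found = found
    -- Nesting `cover` bounds the density of `F` by `(1 + q + 4 q²) / n²`, whereas comparison with a
    -- star makes it at least `1 / (k * n)`. The hypothesis `n-large` separates the two.
    ... | no none = ⊥-elim (<-irrefl refl (<-≤-trans n-large (*-cancelʳ-≤ n _ (n * length 𝓐) {{>-nonZero (*-mono-≤ n>0 𝓐>0)}} (begin
      n * (n * length 𝓐)
        ≡⟨ r₁ n (length 𝓐) ⟩
      (n * n) * length 𝓐
        ≤⟨ *-monoʳ-≤ (n * n) 𝓐≤VF ⟩
      (n * n) * (V * length F)
        ≡⟨ r₂ n k (length F) ⟩
      k * n * (length F * (n * n))
        ≤⟨ *-monoʳ-≤ (k * n) F*n² ⟩
      k * n * (length 𝓐 + q * (length 𝓐 + q * (4 * length 𝓐)))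
        ≡⟨ r₃ k n q (length 𝓐) ⟩
      k * (1 + q + 4 * (q * q)) * (n * length 𝓐) ∎))))
      where
      open ≤-Reasoning
      r₁ : ∀ a b → a * (a * b) ≡ (a * a) * b
      r₁ = solve-∀
      r₂ : ∀ a b c → (a * a) * ((b * a) * c) ≡ b * a * (c * (a * a))
      r₂ = solve-∀
      r₃ : ∀ a b c d → a * b * (d + c * (d + c * (4 * d))) ≡ a * (1 + c + 4 * (c * c)) * (b * d)
      r₃ = solve-∀
      F*n² : length F * (n * n) ≤ length 𝓐 + q * (length 𝓐 + q * (4 * length 𝓐))
      F*n² = begin
        length F * (n * n)
          ≡⟨ cong (_* (n * n)) (length≡∑ F) ⟩
        ∑ F (λ _ → 1) * (n * n)
          ≤⟨ *-monoˡ-≤ (n * n) (cover S₁ (λ _ → 1) (λ _ → ≤-refl)) ⟩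
        (length (filter (misses? S₁) F) + ∑ (allFin (V * V)) (λ y → 𝟙 (y ∈ˢ? S₁) * ∑ F (λ m → 1 * 𝟙 (has? y m)))) * (n * n)
          ≡⟨ *-distribʳ-+ (n * n) (length (filter (misses? S₁) F)) _ ⟩
        length (filter (misses? S₁) F) * (n * n) + ∑ (allFin (V * V)) (λ y → 𝟙 (y ∈ˢ? S₁) * ∑ F (λ m → 1 * 𝟙 (has? y m))) * (n * n)
          ≤⟨ +-mono-≤ (small*n² {filter (misses? S₁) F} (core-covers F-large c₁)) (sum-over S₁ _ (n * n) (length 𝓐 + q * (4 * length 𝓐)) (CoreOf.size c₁)
               (λ y y∈ → ≤-trans (≤-reflexive (cong (_* (n * n)) (∑-cong F (λ m → *-identityˡ (𝟙 (has? y m)))))) (pair-degree y (S₁-proper y∈) (λ sm → none (y , y∈ , sm))))) ⟩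
        length 𝓐 + q * (length 𝓐 + q * (4 * length 𝓐)) ∎

    module Star {x : Fin (V * V)} (x-proper : proj₁ (pairAt x) ≢ proj₂ (pairAt x)) (x-small : Small (filter (¬? ∘ has? x) F)) where
      a b : Fin V
      a = proj₁ (pairAt x)
      b = proj₂ (pairAt x)

      F⊆star : ∀ {m} → m ∈ F → x ∈ˢ enc m
      F⊆star {m} m∈ = decidable-stable (x ∈ˢ? enc m) contradiction-at
        where
        contradiction-at : ¬ ¬ x ∈ˢ enc m
        contradiction-at x∉m = <-irrefl refl (begin-strict
          length (filter (¬? ∘ has? x) F) * n ^ s
            <⟨ x-small ⟩
          length 𝓐
            ≤⟨ N-pair-lower 2≤k x-proper ⟩
          V * N ((a , b) ∷ [])
            ≤⟨ *-monoʳ-≤ V (Av.avoiding-many k>0 6≤V V>2k²+2) ⟩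
          V * (2 * ((V * V) ^ (4 * (k * k)) * L₀))
            ≡⟨ cong (V *_) (*-assoc 2 ((V * V) ^ (4 * (k * k))) L₀) ⟨
          V * (2 * (V * V) ^ (4 * (k * k)) * L₀)
            ≡⟨ *-assoc V _ L₀ ⟨
          V * (2 * (V * V) ^ (4 * (k * k))) * L₀
            ≤⟨ *-mono-≤ switch-cost L₀≤ ⟩
          n ^ s * length (filter (¬? ∘ has? x) F)
            ≡⟨ *-comm (n ^ s) _ ⟩
          length (filter (¬? ∘ has? x) F) * n ^ s ∎)
          where
          open ≤-Reasoning
          m∈𝓐 : m ∈ 𝓐
          m∈𝓐 = F⊆𝓐 m∈
          module Av = Avoiding m∈𝓐 x-proper (λ a∼b → x∉m (∈-enc⁺ m (x-proper , a∼b)))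
          L₀ : ℕ
          L₀ = # (Av.level? 0) 𝓐
          meeting? : Decidable (λ g → Sat ((a , b) ∷ []) g × ¬ Av.Level 0 g)
          meeting? g = sat? ((a , b) ∷ []) g ×-dec ¬? (Av.level? 0 g)
          meets-m : ∀ g → g ∈ F → x ∈ˢ enc g → Sat ((a , b) ∷ []) g × ¬ Av.Level 0 g
          meets-m g g∈ x∈ = (∈-enc⁻ g x∈ ∷ []) , λ (_ , c≤0) → let (y , y∈g , y∈m) = intersecting g∈ m∈ in
            <-irrefl refl (<-≤-trans (subst (_≤ Av.common g) (∣⁅x⁆∣≡1 y)
              (p⊆q⇒∣p∣≤∣q∣ (λ z∈ → subst (_∈ˢ (enc g ∩ enc m)) (sym (x∈⁅y⁆⇒x≡y y z∈)) (x∈p∩q⁺ (y∈g , y∈m))))) c≤0)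
          disjoint-counts : ∀ {P Q : Set} (d : Dec P) (d′ : Dec Q) → 𝟙 (d ×-dec ¬? (d ×-dec d′)) + 𝟙 (d ×-dec d′) ≤ 𝟙 d
          disjoint-counts (yes _) (yes _) = ≤-refl
          disjoint-counts (yes _) (no _)  = ≤-refl
          disjoint-counts (no _)  _       = ≤-refl
          -- All members of `F` through `x` meet `m`, so in the star they do not overlap with the
          -- `L₀` matchings disjoint from `m`. The star is no larger than `F`; cancelling the
          -- members through `x` leaves those that miss it.
          L₀≤ : L₀ ≤ length (filter (¬? ∘ has? x) F)
          L₀≤ = +-cancelˡ-≤ (# (has? x) F) _ _ (begin
            # (has? x) F + L₀
              ≤⟨ +-monoˡ-≤ L₀ (≤-trans (#-mono (has? x) meeting? F meets-m) (∑-⊆ 𝓐 (λ g → 𝟙 (meeting? g)) F-unique F⊆𝓐)) ⟩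
            # meeting? 𝓐 + L₀
              ≡⟨ ∑-+ 𝓐 _ _ ⟨
            ∑ 𝓐 (λ g → 𝟙 (meeting? g) + 𝟙 (Av.level? 0 g))
              ≤⟨ ∑-mono 𝓐 (λ g _ → disjoint-counts (sat? ((a , b) ∷ []) g) (Av.common g ≤? 0)) ⟩
            N ((a , b) ∷ [])
              ≤⟨ star≤F x-proper ⟩
            length F
              ≡⟨ length-split (has? x) F ⟨
            # (has? x) F + # (¬? ∘ has? x) F
              ≡⟨ cong (# (has? x) F +_) (length-filter (¬? ∘ has? x) F) ⟨
            # (has? x) F + length (filter (¬? ∘ has? x) F) ∎)

      open DecMembership (Vecₚ.≡-dec {n = V} (Vecₚ.≡-dec {n = V} Boolₚ._≟_)) using () renaming (_∈?_ to _∈ᶠ?_)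

      -- `F` lies in the star, so a further matching of the star would make the star, itself an
      -- intersecting family, larger than `F`.
      star⊆F : ∀ {m} → PM m → a ∼[ m ] b → m ∈ F
      star⊆F {m} pm a∼b = decidable-stable (m ∈ᶠ? F) λ m∉ → <-irrefl refl (begin-strict
        length F
          <⟨ length-mono-⊆ (filter (sat? ((a , b) ∷ [])) 𝓐) (All.tabulate (λ {g} g∈ m≡g → m∉ (subst (_∈ F) (sym m≡g) g∈)) ∷ F-unique) within ⟩
        length (filter (sat? ((a , b) ∷ [])) 𝓐)
          ≡⟨ length-filter (sat? ((a , b) ∷ [])) 𝓐 ⟩
        N ((a , b) ∷ [])
          ≤⟨ star≤F x-proper ⟩
        length F ∎)
        where
        open ≤-Reasoning
        within : ∀ {g} → g ∈ m ∷ F → g ∈ filter (sat? ((a , b) ∷ [])) 𝓐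
        within (here refl) = ∈-filter⁺ (sat? ((a , b) ∷ [])) (∈-𝓐⁺ pm) ((x-proper , a∼b) ∷ [])
        within {g} (there g∈) = ∈-filter⁺ (sat? ((a , b) ∷ [])) (F⊆𝓐 g∈) (∈-enc⁻ g (F⊆star g∈) ∷ [])

      canonical : IsCanonical k n F
      canonical = a , b , x-proper , λ m → mk⇔ (λ m∈ → ∈-𝓐⁻ (F⊆𝓐 m∈) , proj₂ (∈-enc⁻ m (F⊆star m∈))) (λ (pm , a∼b) → star⊆F pm a∼b)

    nonempty-canonical : IsCanonical k n F
    nonempty-canonical = let (x , x∈ , sm) = dominant in Star.canonical (S₁-proper x∈) sm

  maximum⇒canonical : IsCanonical k n F
  maximum⇒canonical with 1 ≤? length 𝓐
  ... | yes 𝓐>0 = nonempty-canonical 𝓐>0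
  -- Were there no perfect matching, `F` and every star would be empty, so any two distinct vertices
  -- serve.
  ... | no ¬pos = v₀ , v₁ , v₀≢v₁ , λ m → mk⇔ (λ m∈ → ⊥-elim (none (F⊆𝓐 m∈))) (λ (pm , _) → ⊥-elim (none (∈-𝓐⁺ pm)))
    where
    none : ∀ {m} → ¬ m ∈ 𝓐
    none m∈ = ¬pos (≤-trans (∑-term (λ _ → 1) m∈) (≤-reflexive (sym (length≡∑ 𝓐))))

-- Choice of the parameters

1+n≤2^n : ∀ n → suc n ≤ 2 ^ n
1+n≤2^n zero    = ≤-refl
1+n≤2^n (suc n) = ≤-trans (+-mono-≤ (m^n>0 2 n) (1+n≤2^n n)) (≤-reflexive (cong (2 ^ n +_) (sym (+-identityʳ (2 ^ n)))))

2^-cancel-≤ : ∀ {a b} → 2 ^ a ≤ 2 ^ b → a ≤ b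
2^-cancel-≤ {a} {b} h = ≮⇒≥ (λ b<a → <-irrefl refl (<-≤-trans (^-monoʳ-< 2 (s≤s (s≤s z≤n)) b<a) h))

2^-cancel-< : ∀ {a b} → 2 ^ a < 2 ^ b → a < b
2^-cancel-< {a} {b} h = ≰⇒> (λ b≤a → <-irrefl refl (<-≤-trans h (^-monoʳ-≤ 2 b≤a)))

log₂-bracket : ∀ n → 0 < n → ∃ λ L → 2 ^ L ≤ n × n < 2 ^ suc L
log₂-bracket (suc zero)    _ = 0 , ≤-refl , ≤-refl
log₂-bracket (suc (suc n)) _ with log₂-bracket (suc n) z<s
... | L , lo , hi with suc (suc n) <? 2 ^ suc L
...   | yes below = L , ≤-trans lo (n≤1+n _) , below
...   | no ¬below = suc L , ≮⇒≥ ¬below , ≤-trans (s≤s hi)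
          (≤-trans (≤-reflexive (+-comm 1 (2 ^ suc L))) (+-monoʳ-≤ (2 ^ suc L) (≤-trans (m^n>0 2 (suc L)) (m≤m+n _ 0))))

linear≤exp : ∀ D Y → D + D * D ≤ Y → suc Y * D ≤ 2 ^ Y
linear≤exp D Y D+D²≤Y with Y ∸ D | m+[n∸m]≡n (≤-trans (m≤m+n D (D * D)) D+D²≤Y)
... | Z | refl = begin
  suc (D + Z) * D            ≡⟨ r₁ D Z ⟩
  D * D + (D + D * Z)        ≤⟨ +-monoˡ-≤ (D + D * Z) (+-cancelˡ-≤ D _ _ D+D²≤Y) ⟩
  Z + (D + D * Z)            ≤⟨ n≤1+n _ ⟩
  suc (Z + (D + D * Z))      ≡⟨ r₂ D Z ⟩
  suc D * suc Z              ≤⟨ *-mono-≤ (1+n≤2^n D) (1+n≤2^n Z) ⟩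
  2 ^ D * 2 ^ Z              ≡⟨ ^-distribˡ-+-* 2 D Z ⟨
  2 ^ (D + Z)                ∎
  where
  open ≤-Reasoning
  r₁ : ∀ d z → suc (d + z) * d ≡ d * d + (d + d * z)
  r₁ = solve-∀
  r₂ : ∀ d z → suc (z + (d + d * z)) ≡ suc d * suc z
  r₂ = solve-∀

-- With `2 ^ Y ≤ X < 2 ^ suc Y`, the claim reduces to comparing the exponents `suc Y * D` and
-- `2 ^ Y`.
power≤exp : ∀ D X → 2 ^ (D + D * D) ≤ X → X ^ D ≤ 2 ^ X
power≤exp D X big with log₂-bracket X (≤-trans (m^n>0 2 (D + D * D)) big)
... | Y , lo , hi = begin
  X ^ D               ≤⟨ ^-monoˡ-≤ D (<⇒≤ hi) ⟩
  (2 ^ suc Y) ^ D     ≡⟨ ^-*-assoc 2 (suc Y) D ⟩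
  2 ^ (suc Y * D)     ≤⟨ ^-monoʳ-≤ 2 (≤-trans (linear≤exp D Y (s≤s⁻¹ (2^-cancel-< {D + D * D} {suc Y} (≤-<-trans big hi)))) lo) ⟩
  2 ^ X               ∎
  where open ≤-Reasoning

spreadness≡ : ∀ J → spreadness J ≡ 64 * (J * J)
spreadness≡ = solved
  where
  solved : ∀ J → 4 * (J + J) * (8 * J) ≡ 64 * (J * J)
  solved = solve-∀

abstract
  -- `spreadness` is quadratic, so once `L` exceeds 64, `b` and `2 * c`, its value at `c * (b + L)`
  -- is at most `L ^ 5`. The left side is then a power of `L` with fixed exponent `1 + 5 * E`.
  spreadness-growth : ∀ c b E → ∃ λ L₀ → ∀ L → L₀ ≤ L → 2 * spreadness (c * (b + L)) ^ E ≤ 2 ^ L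
  spreadness-growth c b E = L₀ , bound
    where
    D L₀ : ℕ
    D = suc (5 * E)
    L₀ = 64 + (b + (2 * c + 2 ^ (D + D * D)))
    bound : ∀ L → L₀ ≤ L → 2 * spreadness (c * (b + L)) ^ E ≤ 2 ^ L
    bound L L₀≤L = begin
      2 * spreadness u ^ E         ≤⟨ *-mono-≤ (≤-trans (s≤s (s≤s z≤n)) 64≤L) (^-monoˡ-≤ E spread≤) ⟩
      L * (L ^ 5) ^ E              ≡⟨ cong (L *_) (^-*-assoc L 5 E) ⟩
      L ^ D                        ≤⟨ power≤exp D L (≤-trans (m≤n+m _ (2 * c)) (≤-trans (m≤n+m _ b) (≤-trans (m≤n+m _ 64) L₀≤L))) ⟩
      2 ^ L                        ∎
      where
      open ≤-Reasoning
      u : ℕ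
      u = c * (b + L)
      64≤L : 64 ≤ L
      64≤L = ≤-trans (m≤m+n 64 _) L₀≤L
      b≤L : b ≤ L
      b≤L = ≤-trans (m≤m+n b _) (≤-trans (m≤n+m _ 64) L₀≤L)
      2c≤L : 2 * c ≤ L
      2c≤L = ≤-trans (m≤m+n (2 * c) _) (≤-trans (m≤n+m _ b) (≤-trans (m≤n+m _ 64) L₀≤L))
      u≤L² : u ≤ L * L
      u≤L² = begin
        c * (b + L)    ≤⟨ *-monoʳ-≤ c (+-monoˡ-≤ L b≤L) ⟩
        c * (L + L)    ≡⟨ r c L ⟩
        2 * c * L      ≤⟨ *-monoˡ-≤ L 2c≤L ⟩
        L * L          ∎
        where
        r : ∀ x y → x * (y + y) ≡ 2 * x * y
        r = solve-∀
      spread≤ : spreadness u ≤ L ^ 5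
      spread≤ = begin
        spreadness u                 ≡⟨ spreadness≡ u ⟩
        64 * (u * u)                 ≤⟨ *-mono-≤ 64≤L (*-mono-≤ u≤L² u≤L²) ⟩
        L * ((L * L) * (L * L))      ≡⟨ r L ⟩
        L ^ 5                        ∎
        where
        r : ∀ x → x * ((x * x) * (x * x)) ≡ x * (x * (x * (x * (x * 1))))
        r = solve-∀

module Choice (k : ℕ) (2≤k : 2 ≤ k) where

  -- `t` is the number of transpositions. In `s`, each of them accounts for `V * V ≤ n ^ 4`, and the
  -- 3 covers the remaining factors `V ≤ n ^ 2` and `2 ≤ n`. In `c`, the summand `s` makes `J`
  -- exceed `q`, and 2 makes `2 ^ J` exceed `V * V`. `E` is the total exponent of `R` in `V-large`.
  t s c E : ℕ
  t = 4 * (k * k)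
  s = 4 * t + 3
  c = s + 2
  E = 16 * k * (4 * k + 1)

  N : ℕ
  N = 2 ^ proj₁ (spreadness-growth c (suc k) E)

  module _ {n L : ℕ} (2^L≤n : 2 ^ L ≤ n) (n<2^1+L : n < 2 ^ suc L)
    (large : 2 * spreadness (c * (suc k + L)) ^ E ≤ 2 ^ L) where

    -- `suc k + L` is an upper bound for the binary logarithm of `k * n`. The value of `q` comes
    -- from `2 ^ l ≤ R ^ l ≤ n ^ s < 2 ^ (suc L * s)`, where `l` is the size of a core.
    J R q : ℕ
    J = c * (suc k + L)
    R = spreadness J
    q = suc L * s

    k>0 : 0 < k
    k>0 = ≤-trans (s≤s z≤n) 2≤k

    1≤c : 1 ≤ c
    1≤c = ≤-trans (s≤s z≤n) (m≤n+m 2 s)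

    k≤J : k ≤ J
    k≤J = ≤-trans (≤-trans (n≤1+n k) (m≤m+n (suc k) L)) (≤-trans (≤-reflexive (sym (*-identityˡ _))) (*-monoˡ-≤ (suc k + L) 1≤c))

    J>0 : 0 < J
    J>0 = ≤-trans k>0 k≤J

    q≤J : q ≤ J
    q≤J = ≤-trans (≤-reflexive (*-comm (suc L) s)) (*-mono-≤ (m≤m+n s 2) (s≤s (m≤n+m L k)))

    J≤J² : J ≤ J * J
    J≤J² = ≤-trans (≤-reflexive (sym (*-identityʳ J))) (*-monoʳ-≤ J J>0)

    64J²≤R : 64 * (J * J) ≤ R
    64J²≤R = ≤-reflexive (sym (spreadness≡ J))

    R≥64 : 64 ≤ R
    R≥64 = ≤-trans (*-monoʳ-≤ 64 (≤-trans J>0 J≤J²)) 64J²≤R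

    R>0 : 0 < R
    R>0 = ≤-trans (s≤s z≤n) R≥64

    J²≤R : J * J ≤ R
    J²≤R = ≤-trans (m≤m+n (J * J) _) 64J²≤R

    2R^E≤n : 2 * R ^ E ≤ n
    2R^E≤n = ≤-trans large 2^L≤n

    2≤E : 2 ≤ E
    2≤E = *-mono-≤ (≤-trans (s≤s (s≤s z≤n)) (*-monoʳ-≤ 16 k>0)) (m≤n+m 1 (4 * k))

    R²<n : R * R < n
    R²<n = begin-strict
      R * R               ≡⟨ cong (R *_) (*-identityʳ R) ⟨
      R ^ 2               ≤⟨ ^-monoʳ-≤ R {{>-nonZero R>0}} 2≤E ⟩
      R ^ E               <⟨ m<m+n (R ^ E) (≤-trans (m^n>0 R {{>-nonZero R>0}} E) (m≤m+n _ 0)) ⟩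
      2 * R ^ E           ≤⟨ 2R^E≤n ⟩
      n                   ∎
      where open ≤-Reasoning

    R<n : R < n
    R<n = ≤-<-trans (≤-trans (≤-reflexive (sym (*-identityʳ R))) (*-monoʳ-≤ R R>0)) R²<n

    n≤V : n ≤ k * n
    n≤V = ≤-trans (≤-reflexive (sym (*-identityˡ n))) (*-monoˡ-≤ n k>0)

    k≤n : k ≤ n
    k≤n = ≤-trans k≤J (≤-trans J≤J² (≤-trans J²≤R (<⇒≤ R<n)))

    n>0 : 0 < n
    n>0 = ≤-trans (s≤s z≤n) R<n

    V<2^ : k * n < 2 ^ (suc k + L)
    V<2^ = begin-strict
      k * n                 <⟨ *-mono-< {k} {2 ^ k} {n} {2 ^ suc L} (1+n≤2^n k) n<2^1+L ⟩
      2 ^ k * 2 ^ suc L     ≡⟨ ^-distribˡ-+-* 2 k (suc L) ⟨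
      2 ^ (k + suc L)       ≡⟨ cong (2 ^_) (+-suc k L) ⟩
      2 ^ (suc k + L)       ∎
      where open ≤-Reasoning

    pairs<2^J : (k * n) * (k * n) < 2 ^ J
    pairs<2^J = begin-strict
      (k * n) * (k * n)                        <⟨ *-mono-< V<2^ V<2^ ⟩
      2 ^ (suc k + L) * 2 ^ (suc k + L)        ≡⟨ ^-distribˡ-+-* 2 (suc k + L) (suc k + L) ⟨
      2 ^ ((suc k + L) + (suc k + L))          ≤⟨ ^-monoʳ-≤ 2 (≤-trans (≤-reflexive (cong (suc k + L +_) (sym (+-identityʳ (suc k + L))))) (*-monoˡ-≤ (suc k + L) (m≤n+m 2 s))) ⟩
      2 ^ J                                    ∎
      where open ≤-Reasoning

    core-bound : ∀ l → R ^ l ≤ n ^ s → l ≤ q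
    core-bound l h = 2^-cancel-≤ {l} {q} (begin
      2 ^ l               ≤⟨ ^-monoˡ-≤ l (≤-trans (s≤s (s≤s z≤n)) R≥64) ⟩
      R ^ l               ≤⟨ h ⟩
      n ^ s               ≤⟨ ^-monoˡ-≤ s (<⇒≤ n<2^1+L) ⟩
      (2 ^ suc L) ^ s     ≡⟨ ^-*-assoc 2 (suc L) s ⟩
      2 ^ q               ∎)
      where open ≤-Reasoning

    6J²≤R : 6 * (J * J) ≤ R
    6J²≤R = ≤-trans (*-monoˡ-≤ (J * J) (m≤m+n 6 58)) 64J²≤R

    n-large : k * (1 + q + 4 * (q * q)) < n
    n-large = begin-strict
      k * (1 + q + 4 * (q * q))           ≤⟨ *-mono-≤ k≤J (+-mono-≤ (+-mono-≤ J>0 q≤J) (*-monoʳ-≤ 4 (*-mono-≤ q≤J q≤J))) ⟩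
      J * (J + J + 4 * (J * J))           ≤⟨ *-mono-≤ (≤-trans J≤J² J²≤R) (≤-trans (+-monoˡ-≤ (4 * (J * J)) (+-mono-≤ J≤J² J≤J²)) (≤-trans (≤-reflexive (r (J * J))) 6J²≤R)) ⟩
      R * R                               <⟨ R²<n ⟩
      n                                   ∎
      where
      open ≤-Reasoning
      r : ∀ x → x + x + 4 * x ≡ 6 * x
      r = solve-∀

    V>2k²+2 : 2 + (k * k + k * k) < k * n
    V>2k²+2 = begin-strict
      2 + (k * k + k * k)                     ≤⟨ +-mono-≤ (*-monoʳ-≤ 2 (≤-trans J>0 J≤J²)) (+-mono-≤ (*-mono-≤ k≤J k≤J) (*-mono-≤ k≤J k≤J)) ⟩
      2 * (J * J) + (J * J + J * J)           ≡⟨ r (J * J) ⟩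
      4 * (J * J)                             ≤⟨ *-monoˡ-≤ (J * J) (m≤m+n 4 60) ⟩
      64 * (J * J)                            ≤⟨ 64J²≤R ⟩
      R                                       <⟨ R<n ⟩
      n                                       ≤⟨ n≤V ⟩
      k * n                                   ∎
      where
      open ≤-Reasoning
      r : ∀ x → 2 * x + (x + x) ≡ 4 * x
      r = solve-∀

    V-large : 2 * (k * (R ^ (16 * k)) ^ (4 * k + 1)) ≤ k * n
    V-large = begin
      2 * (k * (R ^ (16 * k)) ^ (4 * k + 1))     ≡⟨ cong (λ x → 2 * (k * x)) (^-*-assoc R (16 * k) (4 * k + 1)) ⟩
      2 * (k * R ^ E)                            ≡⟨ r k (R ^ E) ⟩
      k * (2 * R ^ E)                            ≤⟨ *-monoʳ-≤ k 2R^E≤n ⟩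
      k * n                                      ∎
      where
      open ≤-Reasoning
      r : ∀ x y → 2 * (x * y) ≡ x * (2 * y)
      r = solve-∀

    switch-cost : (k * n) * (2 * ((k * n) * (k * n)) ^ t) ≤ n ^ s
    switch-cost = begin
      (k * n) * (2 * ((k * n) * (k * n)) ^ t)      ≤⟨ *-mono-≤ V≤n² (*-mono-≤ (≤-trans (s≤s (s≤s z≤n)) (≤-trans R≥64 (<⇒≤ R<n))) (^-monoˡ-≤ t (*-mono-≤ V≤n² V≤n²))) ⟩
      (n * n) * (n * ((n * n) * (n * n)) ^ t)      ≡⟨ cong (λ x → (n * n) * (n * x ^ t)) (r₁ n) ⟩
      (n * n) * (n * (n ^ 4) ^ t)                  ≡⟨ cong (λ x → (n * n) * (n * x)) (^-*-assoc n 4 t) ⟩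
      (n * n) * (n * n ^ (4 * t))                  ≡⟨ r₂ n (n ^ (4 * t)) ⟩
      n ^ (4 * t) * n ^ 3                          ≡⟨ ^-distribˡ-+-* n (4 * t) 3 ⟨
      n ^ s                                        ∎
      where
      open ≤-Reasoning
      V≤n² : k * n ≤ n * n
      V≤n² = *-monoˡ-≤ n k≤n
      r₁ : ∀ x → (x * x) * (x * x) ≡ x * (x * (x * (x * 1)))
      r₁ = solve-∀
      r₂ : ∀ x y → (x * x) * (x * y) ≡ y * (x * (x * (x * 1)))
      r₂ = solve-∀

    parameters : Parameters k n s q J
    parameters = record
      { 2≤k         = 2≤k
      ; J>0         = J>0
      ; pairs<2^J   = pairs<2^J
      ; 6≤V         = ≤-trans (m≤m+n 6 58) (≤-trans R≥64 (≤-trans (<⇒≤ R<n) n≤V))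
      ; V>2k²+2     = V>2k²+2
      ; V-large     = V-large
      ; core-bound  = core-bound
      ; 2q≤R        = ≤-trans (*-mono-≤ (m≤m+n 2 62) (≤-trans q≤J J≤J²)) 64J²≤R
      ; n-large     = n-large
      ; n²≤n^s      = ≤-trans (≤-reflexive (cong (n *_) (sym (*-identityʳ n)))) (^-monoʳ-≤ n {{>-nonZero n>0}} (≤-trans (m≤m+n 2 1) (m≤n+m 3 (4 * t))))
      ; switch-cost = switch-cost
      }

theorem9p2 : (k : ℕ) → 2 ≤ k →
    Σ ℕ λ N → (n : ℕ) → N ≤ n →
    (F : List (Rel (k * n))) → IsMaximumP2I k n F → IsCanonical k n F
theorem9p2 k 2≤k = Choice.N k 2≤k , λ n N≤n F F-max → conclude n N≤n F-max
  where
  open Choice k 2≤k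
  growth : ∃ λ L₀ → ∀ L → L₀ ≤ L → 2 * spreadness (c * (suc k + L)) ^ E ≤ 2 ^ L
  growth = spreadness-growth c (suc k) E
  conclude : ∀ n → N ≤ n → ∀ {F} → IsMaximumP2I k n F → IsCanonical k n F
  conclude n N≤n F-max with log₂-bracket n (≤-trans (m^n>0 2 (proj₁ growth)) N≤n)
  ... | L , lo , hi = Maximum.maximum⇒canonical
    (parameters lo hi (proj₂ growth L (s≤s⁻¹ (2^-cancel-< {proj₁ growth} {suc L} (≤-<-trans N≤n hi))))) F-max
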